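{- Let $k\ge t\ge 2$ be integers and let $0<\epsilon<\frac12\cdot 3^{ -t}\binom{k}{t}^{ -2}$. Then for all sufficiently large $v$ (depending on $t,k,\epsilon$), every $(1-\epsilon)$-dense simple $t$-graph $G$ on $v$ vertices has the property that the linear system $\widehat{M}\mathbf{x}=\theta_0\mathbf{1}$ has a solution $\mathbf{x}$ with all entries positive, where $\theta_0=\binom{k}{t}\binom{v-t}{k-t}$; consequently $G$ admits a fractional decomposition into copies of the complete $t$-graph $K_k^t$.
   Context: A simple $t$-graph $G$ on a $v$-set $V$ is a set of edges, each a $t$-subset of $V$. $G$ is $(1-\epsilon)$-dense if every $(t-1)$-subset of $V$ is contained in at least $(1-\epsilon)(v-t+1)$ edges of $G$. A $k$-subset $K\subseteq V$ induces a clique in $G$ if every $t$-subset of $K$ is an edge of $G$. $\widehat{M}$ is the square matrix with rows and columns indexed by the edges of $G$ whose $(T,U)$-entry is the number of $k$-subsets of $V$ that contain $T\cup U$ and induce a clique in $G$. $\mathbf{1}$ is the all-ones vector. $K_k^t$ is the $t$-graph on $k$ vertices whose edges are all $t$-subsets. A fractional decomposition of $G$ into copies of $H$ is a set of pairs $(H_i,w_i)$ where each $H_i$ is a subgraph of $G$ isomorphic to $H$, the $w_i$ are positive rational weights, and $\sum_{i:\,T\in H_i}w_i=1$ for every edge $T$ of $G$. -}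

module Defs where

open import Level using (0ℓ)
open import Data.Bool.Base using (if_then_else_)
open import Data.Fin.Base using (Fin)
open import Data.Fin.Properties using (any?)
import Data.Fin.Properties as Fin
open import Data.Fin.Subset
  using (Subset; inside; outside; _∈_; _⊆_; _∪_; ∣_∣)
open import Data.Fin.Subset.Properties using (_∈?_; _⊆?_; anySubset?)
open import Data.Integer.Base using (+_)
open import Data.List.Base using (List; []; _∷_; _++_; map; filter; length; lookup)
open import Data.Nat.Base as ℕ using (ℕ; zero; suc; _∸_; NonZero)
import Data.Nat.Properties as ℕ
open import Data.Nat.Combinatorics using (_C_; nCk+nC[k+1]≡[n+1]C[k+1])
open import Data.Product.Base using (∃; _×_; _,_)
open import Data.Rational.Base as ℚ using (ℚ; _/_; 0ℚ; 1ℚ; ½; Positive)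
import Data.Rational.Properties as ℚ
open import Data.Rational.Solver using (module +-*-Solver)
open import Data.Sum.Base using (_⊎_; inj₁; inj₂)
import Data.Sum.Base as Sum
import Data.Vec.Base as Vec
open import Data.Vec.Functional using (Vector)
open import Function.Base using (_∘_)
open import Function.Bundles using (_⇔_)
open import Function.Definitions using (Injective)
open import Relation.Binary.Definitions using (tri<; tri≈; tri>)
open import Relation.Binary.PropositionalEquality
  using (_≡_; refl; sym; trans; cong; subst)
open import Relation.Nullary using (¬_; Dec; does; ⌊_⌋; _×-dec_; _→-dec_; ¬?)
open import Relation.Nullary.Decidable using (map′; decidable-stable)
open import Relation.Unary using (Pred; Decidable)

open import Algebra.Properties.CommutativeMonoid.Sum ℚ.+-0-commutativeMonoid
  using (sum)

------------------------------------------------------------------------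
-- Real numbers, as two-sided Dedekind cuts: `lower q` means q < x and
-- `upper q` means x < q.

record ℝ : Set₁ where
  field
    lower upper     : Pred ℚ 0ℓ
    lower-inhabited : ∃ lower
    upper-inhabited : ∃ upper
    lower-closed    : ∀ {q r} → q ℚ.< r → lower r → lower q
    upper-closed    : ∀ {q r} → q ℚ.< r → upper q → upper r
    lower-open      : ∀ {q} → lower q → ∃ λ r → q ℚ.< r × lower r
    upper-open      : ∀ {r} → upper r → ∃ λ q → q ℚ.< r × upper q
    disjoint        : ∀ {q} → lower q → ¬ upper q
    located         : ∀ {q r} → q ℚ.< r → lower q ⊎ upper r

open ℝ

infix 4 _<ᴿ_ _≤ᴿ_

_<ᴿ_ : ℝ → ℝ → Set
x <ᴿ y = ∃ λ q → upper x q × lower y q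

_≤ᴿ_ : ℝ → ℝ → Set
x ≤ᴿ y = ∀ {q} → lower x q → lower y q

private
  p-1<p : ∀ p → p ℚ.- 1ℚ ℚ.< p
  p-1<p p = subst (p ℚ.- 1ℚ ℚ.<_) (ℚ.+-identityʳ p)
    (ℚ.+-monoʳ-< p (ℚ.negative⁻¹ (ℚ.- 1ℚ)))

  p<p+1 : ∀ p → p ℚ.< p ℚ.+ 1ℚ
  p<p+1 p = subst (ℚ._< p ℚ.+ 1ℚ) (ℚ.+-identityʳ p)
    (ℚ.+-monoʳ-< p (ℚ.positive⁻¹ 1ℚ))

fromℚ : ℚ → ℝ
fromℚ p .lower q         = q ℚ.< p
fromℚ p .upper q         = p ℚ.< q
fromℚ p .lower-inhabited = p ℚ.- 1ℚ , p-1<p p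
fromℚ p .upper-inhabited = p ℚ.+ 1ℚ , p<p+1 p
fromℚ p .lower-closed    = ℚ.<-trans
fromℚ p .upper-closed q<r p<q = ℚ.<-trans p<q q<r
fromℚ p .lower-open      = ℚ.<-dense
fromℚ p .upper-open p<r with q , p<q , q<r ← ℚ.<-dense p<r = q , q<r , p<q
fromℚ p .disjoint        = ℚ.<-asym
fromℚ p .located {q} {r} q<r with ℚ.<-cmp q p
... | tri< q<p _ _  = inj₁ q<p
... | tri≈ _ refl _ = inj₂ q<r
... | tri> _ _ p<q  = inj₂ (ℚ.<-trans p<q q<r)

fromℕ : ℕ → ℚ
fromℕ n = + n / 1

private
  1- : ℚ → ℚ
  1- q = 1ℚ ℚ.- q

  1-1- : ∀ q → 1- (1- q) ≡ q
  1-1- = solve 1 (λ q → con 1ℚ :- (con 1ℚ :- q) := q) refl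
    where open +-*-Solver

  1-anti : ∀ {q r} → q ℚ.< r → 1- r ℚ.< 1- q
  1-anti q<r = ℚ.+-monoʳ-< 1ℚ (ℚ.neg-antimono-< q<r)

-- q < 1 - x iff x < 1 - q.
1ᴿ-_ : ℝ → ℝ
(1ᴿ- x) .lower q = upper x (1- q)
(1ᴿ- x) .upper q = lower x (1- q)
(1ᴿ- x) .lower-inhabited with q , u ← upper-inhabited x =
  1- q , subst (upper x) (sym (1-1- q)) u
(1ᴿ- x) .upper-inhabited with q , l ← lower-inhabited x =
  1- q , subst (lower x) (sym (1-1- q)) l
(1ᴿ- x) .lower-closed q<r = upper-closed x (1-anti q<r)
(1ᴿ- x) .upper-closed q<r = lower-closed x (1-anti q<r)
(1ᴿ- x) .lower-open {q} u with r , r< , u′ ← upper-open x u =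
  1- r , subst (ℚ._< 1- r) (1-1- q) (1-anti r<) ,
  subst (upper x) (sym (1-1- r)) u′
(1ᴿ- x) .upper-open {r} l with q , <q , l′ ← lower-open x l =
  1- q , subst (1- q ℚ.<_) (1-1- r) (1-anti <q) ,
  subst (lower x) (sym (1-1- q)) l′
(1ᴿ- x) .disjoint u l = disjoint x l u
(1ᴿ- x) .located q<r = Sum.swap (located x (1-anti q<r))

private
  module _ (c : ℚ) .{{c>0 : Positive c}} where
    private instance
      c≢0 : ℚ.NonZero c
      c≢0 = ℚ.pos⇒nonZero c

      1/c>0 : Positive (ℚ.1/ c)
      1/c>0 = ℚ.1/pos⇒pos c

    div mul : ℚ → ℚ
    div q = q ℚ.* (ℚ.1/ c)
    mul q = q ℚ.* c

    div-mul : ∀ q → div (mul q) ≡ q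
    div-mul q = trans (ℚ.*-assoc q c (ℚ.1/ c))
      (trans (cong (q ℚ.*_) (ℚ.*-inverseʳ c)) (ℚ.*-identityʳ q))

    mul-div : ∀ q → mul (div q) ≡ q
    mul-div q = trans (ℚ.*-assoc q (ℚ.1/ c) c)
      (trans (cong (q ℚ.*_) (ℚ.*-inverseˡ c)) (ℚ.*-identityʳ q))

    div-mono : ∀ {q r} → q ℚ.< r → div q ℚ.< div r
    div-mono = ℚ.*-monoˡ-<-pos (ℚ.1/ c)

    mul-mono : ∀ {q r} → q ℚ.< r → mul q ℚ.< mul r
    mul-mono = ℚ.*-monoˡ-<-pos c

infixl 7 _*ᴿ_

-- Multiplication by a positive rational c: q < x * c iff q / c < x.
_*ᴿ_ : ℝ → (c : ℚ) .{{_ : Positive c}} → ℝ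
(x *ᴿ c) .lower q = lower x (div c q)
(x *ᴿ c) .upper q = upper x (div c q)
(x *ᴿ c) .lower-inhabited with q , l ← lower-inhabited x =
  mul c q , subst (lower x) (sym (div-mul c q)) l
(x *ᴿ c) .upper-inhabited with q , u ← upper-inhabited x =
  mul c q , subst (upper x) (sym (div-mul c q)) u
(x *ᴿ c) .lower-closed q<r = lower-closed x (div-mono c q<r)
(x *ᴿ c) .upper-closed q<r = upper-closed x (div-mono c q<r)
(x *ᴿ c) .lower-open {q} l with r , <r , l′ ← lower-open x l =
  mul c r , subst (ℚ._< mul c r) (mul-div c q) (mul-mono c <r) ,
  subst (lower x) (sym (div-mul c r)) l′
(x *ᴿ c) .upper-open {r} u with q , q< , u′ ← upper-open x u =
  mul c q , subst (mul c q ℚ.<_) (mul-div c r) (mul-mono c q<) ,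
  subst (upper x) (sym (div-mul c q)) u′
(x *ᴿ c) .disjoint = disjoint x
(x *ᴿ c) .located q<r = located x (div-mono c q<r)

------------------------------------------------------------------------
-- Finite enumeration of subsets

subsets : ∀ n → List (Subset n)
subsets zero    = Vec.[] ∷ []
subsets (suc n) =
  map (inside Vec.∷_) (subsets n) ++ map (outside Vec.∷_) (subsets n)

countSubsets : ∀ {n} {P : Pred (Subset n) 0ℓ} → Decidable P → ℕ
countSubsets P? = length (filter P? (subsets _))

allSubsets? : ∀ {n} {P : Pred (Subset n) 0ℓ} → Decidable P → Dec (∀ T → P T)
allSubsets? P? = map′
  (λ ∄ T → decidable-stable (P? T) (λ ¬p → ∄ (T , ¬p)))
  (λ ∀p (T , ¬p) → ¬p (∀p T))
  (¬? (anySubset? (¬? ∘ P?)))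

image : ∀ {m n} → (Fin m → Fin n) → Subset m → Subset n
image f S = Vec.tabulate λ y → ⌊ any? (λ x → (x ∈? S) ×-dec (f x Fin.≟ y)) ⌋

------------------------------------------------------------------------
-- t-graphs

-- The vertex set is Fin v; a (finite) set of edges is a decidable predicate.
record TGraph (t v : ℕ) : Set₁ where
  field
    Edge    : Pred (Subset v) 0ℓ
    Edge?   : Decidable Edge
    uniform : ∀ {T} → Edge T → ∣ T ∣ ≡ t

open TGraph public

module _ {t v : ℕ} (G : TGraph t v) where

  degree : Subset v → ℕ
  degree S = countSubsets (λ T → Edge? G T ×-dec S ⊆? T)

  -- `Dense ε` is (1 - ε)-density; suc (v ∸ t) is v - t + 1 whenever v ≥ t.
  Dense : ℝ → Set
  Dense ε = ∀ S → ∣ S ∣ ≡ t ∸ 1 →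
    (1ᴿ- ε) *ᴿ fromℕ (suc (v ∸ t)) ≤ᴿ fromℚ (fromℕ (degree S))
    where instance
      _ : Positive (fromℕ (suc (v ∸ t)))
      _ = ℚ.normalize-pos (suc (v ∸ t)) 1

  InducesClique : Pred (Subset v) 0ℓ
  InducesClique K = ∀ T → T ⊆ K → ∣ T ∣ ≡ t → Edge G T

  inducesClique? : Decidable InducesClique
  inducesClique? K =
    allSubsets? λ T → (T ⊆? K) →-dec ((∣ T ∣ ℕ.≟ t) →-dec Edge? G T)

  edges : List (Subset v)
  edges = filter (Edge? G) (subsets v)

  #edges : ℕ
  #edges = length edges

  edge : Fin #edges → Subset v
  edge = lookup edges

  M̂ : (k : ℕ) → Fin #edges → Fin #edges → ℕ
  M̂ k i j = countSubsets λ K →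
    (∣ K ∣ ℕ.≟ k) ×-dec (((edge i ∪ edge j) ⊆? K) ×-dec inducesClique? K)

infixr 7 _*ᵥ_

-- Vectors are taken over ℚ: an integer system with a positive real solution
-- also has a positive rational one.
_*ᵥ_ : ∀ {m n} → (Fin m → Fin n → ℕ) → Vector ℚ n → Vector ℚ m
(A *ᵥ x) i = sum λ j → fromℕ (A i j) ℚ.* x j

complete : ∀ t k → TGraph t k
complete t k .Edge T  = ∣ T ∣ ≡ t
complete t k .Edge? T = ∣ T ∣ ℕ.≟ t
complete t k .uniform eq = eq

------------------------------------------------------------------------
-- Fractional decompositions

record Subgraph {t v} (G : TGraph t v) : Set₁ where
  field
    vertices : Subset v
    graph    : TGraph t v
    incident : ∀ {T} → Edge graph T → T ⊆ vertices
    subgraph : ∀ {T} → Edge graph T → Edge G T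

open Subgraph public

record _≅_ {t h v} (H : TGraph t h) {G : TGraph t v} (F : Subgraph G) : Set where
  field
    to        : Fin h → Fin v
    injective : Injective _≡_ _≡_ to
    onto      : ∀ y → y ∈ vertices F ⇔ (∃ λ x → to x ≡ y)
    edges⇔    : ∀ S → Edge H S ⇔ Edge (graph F) (image to S)

record _≈_ {t v} {G : TGraph t v} (F F′ : Subgraph G) : Set where
  field
    vertices≡ : vertices F ≡ vertices F′
    edges⇔    : ∀ T → Edge (graph F) T ⇔ Edge (graph F′) T

record FractionalDecomposition {t h v} (G : TGraph t v) (H : TGraph t h) : Set₁ where
  field
    size     : ℕ
    copy     : Fin size → Subgraph G
    weight   : Fin size → ℚ
    iso      : ∀ i → H ≅ copy i
    positive : ∀ i → Positive (weight i)
    -- The pairs (copy i , weight i) form a set.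
    distinct : ∀ i j → copy i ≈ copy j → weight i ≡ weight j → i ≡ j
    covers   : ∀ T → Edge G T →
      sum (λ i → if does (Edge? (graph (copy i)) T) then weight i else 0ℚ) ≡ 1ℚ

------------------------------------------------------------------------
-- Parameters

C-nonZero : ∀ {k t} → t ℕ.≤ k → NonZero (k C t)
C-nonZero {k}     {zero}  _           = _
C-nonZero {suc k} {suc t} (ℕ.s≤s t≤k) =
  subst NonZero (nCk+nC[k+1]≡[n+1]C[k+1] k t)
    (ℕ.≢-nonZero λ ≡0 →
      ℕ.≢-nonZero⁻¹ (k C t) {{C-nonZero t≤k}} (ℕ.m+n≡0⇒m≡0 (k C t) ≡0))

-- ½ · 3⁻ᵗ · C(k,t)⁻²
ε-bound : (k t : ℕ) → t ℕ.≤ k → ℚ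
ε-bound k t t≤k = ½ ℚ.* (+ 1 / (3 ℕ.^ t)) ℚ.* (+ 1 / ((k C t) ℕ.^ 2))
  where instance
    _ : NonZero (3 ℕ.^ t)
    _ = ℕ.m^n≢0 3 t
    _ : NonZero ((k C t) ℕ.^ 2)
    _ = ℕ.m^n≢0 (k C t) 2 {{C-nonZero t≤k}}

θ₀ : (k t v : ℕ) → ℚ
θ₀ k t v = fromℕ ((k C t) ℕ.* ((v ∸ t) C (k ∸ t)))

{-# OPTIONS --safe #-}

-- Let w = v - t and n = k - t.  For a function x on t-subsets put
-- z K = Σ_{U ⊆ K} x U and Z I = Σ_{K ⊇ I} z K; the matrix M of the complete
-- t-graph sends x to the restriction of Z to t-subsets, and it has the explicit
-- inverse
--   C(w,n) (w-n)↓t x T = Σ_{I ⊆ T} (-n)↓|T ─ I| w↓|I| Z I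
-- by two applications of Vandermonde's identity, where x↓j is the falling
-- factorial.  Every Z I is a multiple of an average of values Z T with |T| = t,
-- so this bounds the ∞-norm of the inverse of M by (3/2) 2^t / C(w,n) for large
-- v.  A (t-1)-set misses fewer than a fraction q of
-- its possible edges, hence so does every smaller set, and so at most
-- (3/2) q C(k,t) C(w,n) of the k-sets above an edge fail to be cliques.  Since
-- (9/4) 2^t ≤ 3^t, replacing M by M̂ on the rows of edges is a perturbation of
-- relative size a = 3^t C(k,t)² q < 1/2: the system stays injective, hence
-- solvable, and its solution is within 2a < 1 of the constant 1.

module Submission where

open import Defs
import Data.Bool.Base as Bool
open import Data.Bool.Base using (true; false; if_then_else_)
open import Data.Fin.Base using (Fin; zero; suc; punchIn; punchOut)
import Data.Fin.Properties as Fin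
open import Data.Fin.Subset using (Subset; inside; outside; _⊆_; _∪_; _∩_; _─_; _∈_) renaming (∣_∣ to #[_]; ⊤ to full; ⊥ to ∅)
open import Data.Fin.Subset.Properties using (_⊆?_; _∈?_)
import Data.Fin.Subset.Properties as Subset
import Data.Integer.Base as ℤ
import Data.Integer.Properties as ℤ
open import Data.List.Base using (List; []; _∷_; _++_; map; filter; length; lookup; foldr)
open import Data.List.Membership.Propositional using () renaming (_∈_ to _∈ₗ_)
open import Data.List.Membership.Propositional.Properties using (∈-map⁺; ∈-map⁻; ∈-++⁺ˡ; ∈-++⁺ʳ; ∈-filter⁺; ∈-filter⁻; ∈-lookup)
import Data.List.Relation.Unary.All as All
open import Data.List.Relation.Unary.AllPairs using ([]; _∷_)
open import Data.List.Relation.Unary.Any as Any using (index)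
open import Data.List.Relation.Unary.Any.Properties using (lookup-index)
open import Data.List.Relation.Unary.Unique.Propositional using (Unique)
import Data.List.Relation.Unary.Unique.Propositional.Properties as Unique
open import Data.Nat.Base as ℕ using (ℕ; zero; suc; _∸_)
import Data.Nat.Properties as ℕ
open import Data.Nat.Combinatorics using (_C_)
import Data.Nat.Combinatorics as ℕ
open import Data.Product.Base using (∃; Σ-syntax; ∃-syntax; _×_; _,_; proj₁; proj₂)
open import Data.Rational.Base renaming (∣_∣ to abs)
open import Data.Rational.Properties
open import Data.Rational.Solver using (module +-*-Solver)
import Data.Rational.Unnormalised.Base as ℚᵘ
import Data.Rational.Unnormalised.Properties as ℚᵘ
open import Data.Sum.Base using (inj₁; inj₂)
open import Data.Vec.Base using ([]; _∷_; here; there)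
open import Data.Vec.Functional using (Vector; replicate)
import Data.Vec.Properties as Vec
open import Function.Base using (_∘_)
open import Function.Bundles using (mk⇔)
open import Function.Definitions using (Injective)
open import Level using (Level; 0ℓ)
open import Relation.Binary.PropositionalEquality
open import Relation.Nullary using (¬_; Dec; does; yes; no; _×-dec_; ¬?)
open import Relation.Nullary.Decidable using (decidable-stable; toWitness; isYes; isYes≗does; dec-true)
open import Relation.Nullary.Negation using (contradiction)
open import Relation.Unary using (Pred; Decidable)
open import Algebra.Properties.CommutativeMonoid.Sum +-0-commutativeMonoid using (sum; sum-cong-≗; ∑-distrib-+; sum-replicate-zero)
open +-*-Solver using (solve; _:=_; _:+_; _:*_; _:-_; :-_; con)

-- The factor 2^t is the number of subsets I of T. A single term of the inverse is at most v↓t max|Z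
-- T|, because |(-n)↓|T ─ I|| does not exceed the falling factorial that averaging puts in front of
-- |Z I|. Each factor 3/2 absorbs a ratio of falling factorials that tends to 1 as v grows; it is
-- the largest constant whose square times 2^t stays below 3^t from t = 2 on. The two factors C(k,t)
-- in a have different sources. One is the sum of C(k-t, |T ─ J|) over the possible traces J of a
-- missing edge on T, the other is the number of values of x that are added up in z K. The obstacle
-- is that the inverse is explicit only over all t-subsets, while M̂ is indexed by edges. So x lives
-- on all t-subsets and non-edges receive complete rows; an edge row never sees the values at
-- non-edges, since every t-subset of a clique is an edge. The real number ε enters only through a
-- rational q strictly between it and the threshold.

private variable
  n : ℕ
  ℓ : Level
  A : Set ℓ

-- Rational arithmetic

fromℕ-+ : ∀ m n → fromℕ (m ℕ.+ n) ≡ fromℕ m + fromℕ n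
fromℕ-+ m n = toℚᵘ-injective (begin
  toℚᵘ (fromℕ (m ℕ.+ n))               ≈⟨ toℚᵘ-fromℚᵘ (ℚᵘ.mkℚᵘ (ℤ.+ (m ℕ.+ n)) 0) ⟩
  ℚᵘ.mkℚᵘ (ℤ.+ (m ℕ.+ n)) 0              ≈⟨ ℚᵘ.*≡* (cong (ℤ._* (ℤ.+ 1)) (sym (cong₂ ℤ._+_ (ℤ.*-identityʳ (ℤ.+ m)) (ℤ.*-identityʳ (ℤ.+ n))))) ⟩
  ℚᵘ.mkℚᵘ (ℤ.+ m) 0 ℚᵘ.+ ℚᵘ.mkℚᵘ (ℤ.+ n) 0 ≈⟨ ℚᵘ.+-cong (toℚᵘ-fromℚᵘ (ℚᵘ.mkℚᵘ (ℤ.+ m) 0)) (toℚᵘ-fromℚᵘ (ℚᵘ.mkℚᵘ (ℤ.+ n) 0)) ⟨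
  toℚᵘ (fromℕ m) ℚᵘ.+ toℚᵘ (fromℕ n)   ≈⟨ toℚᵘ-homo-+ (fromℕ m) (fromℕ n) ⟨
  toℚᵘ (fromℕ m + fromℕ n)             ∎)
  where open ℚᵘ.≃-Reasoning

fromℕ-suc : ∀ n → fromℕ (suc n) ≡ 1ℚ + fromℕ n
fromℕ-suc n = fromℕ-+ 1 n

fromℕ-* : ∀ m n → fromℕ (m ℕ.* n) ≡ fromℕ m * fromℕ n
fromℕ-* zero    n = sym (*-zeroˡ (fromℕ n))
fromℕ-* (suc m) n = begin
  fromℕ (n ℕ.+ m ℕ.* n)        ≡⟨ fromℕ-+ n (m ℕ.* n) ⟩
  fromℕ n + fromℕ (m ℕ.* n)    ≡⟨ cong (fromℕ n +_) (fromℕ-* m n) ⟩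
  fromℕ n + fromℕ m * fromℕ n  ≡⟨ solve 2 (λ m n → n :+ m :* n := (con 1ℚ :+ m) :* n) refl (fromℕ m) (fromℕ n) ⟩
  (1ℚ + fromℕ m) * fromℕ n     ≡⟨ cong (_* fromℕ n) (fromℕ-suc m) ⟨
  fromℕ (suc m) * fromℕ n      ∎
  where open ≡-Reasoning

fromℕ-nonNeg : ∀ n → 0ℚ ≤ fromℕ n
fromℕ-nonNeg n = nonNegative⁻¹ (fromℕ n) {{normalize-nonNeg n 1}}

fromℕ-pos : ∀ {n} → 1 ℕ.≤ n → 0ℚ < fromℕ n
fromℕ-pos {suc n} _ = positive⁻¹ (fromℕ (suc n)) {{normalize-pos (suc n) 1}}

p≤p+q : ∀ {p q} → 0ℚ ≤ q → p ≤ p + q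
p≤p+q {p} {q} 0≤q = subst (_≤ p + q) (+-identityʳ p) (+-monoʳ-≤ p 0≤q)

p≤q+p : ∀ {p q} → 0ℚ ≤ q → p ≤ q + p
p≤q+p {p} {q} 0≤q = subst (p ≤_) (+-comm p q) (p≤p+q 0≤q)

fromℕ-mono : ∀ {m n} → m ℕ.≤ n → fromℕ m ≤ fromℕ n
fromℕ-mono {m} {n} m≤n = subst (fromℕ m ≤_)
  (trans (sym (fromℕ-+ m (n ∸ m))) (cong fromℕ (ℕ.m+[n∸m]≡n m≤n)))
  (p≤p+q (fromℕ-nonNeg (n ∸ m)))

fromℕ-∸ : ∀ {m n} → m ℕ.≤ n → fromℕ (n ∸ m) ≡ fromℕ n - fromℕ m
fromℕ-∸ {m} {n} m≤n = begin
  fromℕ (n ∸ m)                      ≡⟨ solve 2 (λ a b → a := b :+ a :- b) refl (fromℕ (n ∸ m)) (fromℕ m) ⟩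
  fromℕ m + fromℕ (n ∸ m) - fromℕ m  ≡⟨ cong (_- fromℕ m) (fromℕ-+ m (n ∸ m)) ⟨
  fromℕ (m ℕ.+ (n ∸ m)) - fromℕ m    ≡⟨ cong (λ x → fromℕ x - fromℕ m) (ℕ.m+[n∸m]≡n m≤n) ⟩
  fromℕ n - fromℕ m                  ∎
  where open ≡-Reasoning

*-monoˡ : ∀ {r p q} → 0ℚ ≤ r → p ≤ q → r * p ≤ r * q
*-monoˡ {r} 0≤r = *-monoˡ-≤-nonNeg r {{nonNegative 0≤r}}

*-monoʳ : ∀ {r p q} → 0ℚ ≤ r → p ≤ q → p * r ≤ q * r
*-monoʳ {r} 0≤r = *-monoʳ-≤-nonNeg r {{nonNegative 0≤r}}

*-mono : ∀ {p q r s} → 0ℚ ≤ p → 0ℚ ≤ s → p ≤ q → r ≤ s → p * r ≤ q * s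
*-mono 0≤p 0≤s p≤q r≤s = ≤-trans (*-monoˡ 0≤p r≤s) (*-monoʳ 0≤s p≤q)

*-nonNeg : ∀ {p q} → 0ℚ ≤ p → 0ℚ ≤ q → 0ℚ ≤ p * q
*-nonNeg {p} {q} 0≤p 0≤q = subst (_≤ p * q) (*-zeroʳ p) (*-monoˡ 0≤p 0≤q)

*-pos : ∀ {p q} → 0ℚ < p → 0ℚ < q → 0ℚ < p * q
*-pos {p} {q} 0<p 0<q =
  positive⁻¹ (p * q) {{pos*pos⇒pos p {{positive 0<p}} q {{positive 0<q}}}}

*-cancelˡ : ∀ {r p q} → 0ℚ < r → r * p ≤ r * q → p ≤ q
*-cancelˡ {r} 0<r = *-cancelˡ-≤-pos r {{positive 0<r}}

p≤q⇒0≤q-p : ∀ {p q} → p ≤ q → 0ℚ ≤ q - p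
p≤q⇒0≤q-p {p} {q} p≤q = subst (_≤ q - p) (+-inverseʳ p) (+-monoˡ-≤ (- p) p≤q)

abs-* : ∀ {p} q → 0ℚ ≤ p → abs (p * q) ≡ p * abs q
abs-* {p} q 0≤p = trans (∣p*q∣≡∣p∣*∣q∣ p q) (cong (_* abs q) (0≤p⇒∣p∣≡p 0≤p))

p≤abs : ∀ p → p ≤ abs p
p≤abs p with ≤-total 0ℚ p
... | inj₁ 0≤p = ≤-reflexive (sym (0≤p⇒∣p∣≡p 0≤p))
... | inj₂ p≤0 = ≤-trans p≤0 (0≤∣p∣ p)

-- Indicators

𝟙 : Dec A → ℚ
𝟙 a? = if does a? then 1ℚ else 0ℚ

𝟙-yes : (a? : Dec A) → A → 𝟙 a? ≡ 1ℚ
𝟙-yes (yes _) _ = refl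
𝟙-yes (no ¬a) a = contradiction a ¬a

𝟙-no : (a? : Dec A) → ¬ A → 𝟙 a? ≡ 0ℚ
𝟙-no (yes a) ¬a = contradiction a ¬a
𝟙-no (no _)  _  = refl

𝟙-⇔ : {B : Set ℓ} (a? : Dec A) (b? : Dec B) → (A → B) → (B → A) → 𝟙 a? ≡ 𝟙 b?
𝟙-⇔ (yes a) b? f g = sym (𝟙-yes b? (f a))
𝟙-⇔ (no ¬a) b? f g = sym (𝟙-no b? (¬a ∘ g))

𝟙-nonNeg : (a? : Dec A) → 0ℚ ≤ 𝟙 a?
𝟙-nonNeg (yes _) = nonNegative⁻¹ 1ℚ
𝟙-nonNeg (no _)  = ≤-refl

𝟙≤1 : (a? : Dec A) → 𝟙 a? ≤ 1ℚ
𝟙≤1 (yes _) = ≤-refl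
𝟙≤1 (no _)  = nonNegative⁻¹ 1ℚ

𝟙-× : {B : Set ℓ} (a? : Dec A) (b? : Dec B) → 𝟙 (a? ×-dec b?) ≡ 𝟙 a? * 𝟙 b?
𝟙-× (yes _) b? = sym (*-identityˡ (𝟙 b?))
𝟙-× (no _)  b? = sym (*-zeroˡ (𝟙 b?))

𝟙-¬ : (a? : Dec A) → 𝟙 a? + 𝟙 (¬? a?) ≡ 1ℚ
𝟙-¬ (yes _) = refl
𝟙-¬ (no _)  = refl

𝟙-cong : (a? : Dec A) {p q : ℚ} → (A → p ≡ q) → 𝟙 a? * p ≡ 𝟙 a? * q
𝟙-cong (yes a) p≡q = cong (1ℚ *_) (p≡q a)
𝟙-cong (no _) {p} {q} _ = trans (*-zeroˡ p) (sym (*-zeroˡ q))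

𝟙-mono : (a? : Dec A) {p q : ℚ} → (A → p ≤ q) → 𝟙 a? * p ≤ 𝟙 a? * q
𝟙-mono (yes a) p≤q = *-monoˡ (nonNegative⁻¹ 1ℚ) (p≤q a)
𝟙-mono (no _) {p} {q} _ = ≤-reflexive (trans (*-zeroˡ p) (sym (*-zeroˡ q)))

𝟙-yes-* : (a? : Dec A) → A → ∀ p → 𝟙 a? * p ≡ p
𝟙-yes-* a? a p = trans (cong (_* p) (𝟙-yes a? a)) (*-identityˡ p)

𝟙-no-* : (a? : Dec A) → ¬ A → ∀ p → 𝟙 a? * p ≡ 0ℚ
𝟙-no-* a? ¬a p = trans (cong (_* p) (𝟙-no a? ¬a)) (*-zeroˡ p)

-- Sums over subsets

opaque

  -- Splitting on the first vertex mirrors `subsets`, so `listSum-subsets` is a plain induction.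
  -- Being opaque, `∑` expands only through `∑-[]` and `∑-∷` outside the blocks that unfold it.
  ∑ : (Subset n → ℚ) → ℚ
  ∑ {zero}  f = f []
  ∑ {suc n} f = ∑ (λ S → f (inside ∷ S)) + ∑ (λ S → f (outside ∷ S))

  ∑-[] : (f : Subset 0 → ℚ) → ∑ f ≡ f []
  ∑-[] f = refl

  ∑-∷ : (f : Subset (suc n) → ℚ) → ∑ f ≡ ∑ (λ S → f (inside ∷ S)) + ∑ (λ S → f (outside ∷ S))
  ∑-∷ f = refl

  ∑-cong : {f g : Subset n → ℚ} → (∀ S → f S ≡ g S) → ∑ f ≡ ∑ g
  ∑-cong {zero}  f≡g = f≡g []
  ∑-cong {suc n} f≡g =
    cong₂ _+_ (∑-cong {n} (λ S → f≡g (inside ∷ S))) (∑-cong {n} (λ S → f≡g (outside ∷ S)))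

  ∑-mono : {f g : Subset n → ℚ} → (∀ S → f S ≤ g S) → ∑ f ≤ ∑ g
  ∑-mono {zero}  f≤g = f≤g []
  ∑-mono {suc n} f≤g =
    +-mono-≤ (∑-mono {n} (λ S → f≤g (inside ∷ S))) (∑-mono {n} (λ S → f≤g (outside ∷ S)))

  ∑-+ : (f g : Subset n → ℚ) → ∑ (λ S → f S + g S) ≡ ∑ f + ∑ g
  ∑-+ {zero}  f g = refl
  ∑-+ {suc n} f g = trans
    (cong₂ _+_ (∑-+ fᵢ gᵢ) (∑-+ fₒ gₒ))
    (solve 4 (λ a b c d → (a :+ b) :+ (c :+ d) := (a :+ c) :+ (b :+ d)) refl
      (∑ fᵢ) (∑ gᵢ) (∑ fₒ) (∑ gₒ))
    where
    fᵢ fₒ gᵢ gₒ : Subset n → ℚ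
    fᵢ S = f (inside ∷ S)
    fₒ S = f (outside ∷ S)
    gᵢ S = g (inside ∷ S)
    gₒ S = g (outside ∷ S)

  ∑-* : ∀ c (f : Subset n → ℚ) → ∑ (λ S → c * f S) ≡ c * ∑ f
  ∑-* {zero}  c f = refl
  ∑-* {suc n} c f = trans
    (cong₂ _+_ (∑-* c (λ S → f (inside ∷ S))) (∑-* c (λ S → f (outside ∷ S))))
    (sym (*-distribˡ-+ c (∑ λ S → f (inside ∷ S)) (∑ λ S → f (outside ∷ S))))

  ∑-0 : ∀ n → ∑ {n} (λ _ → 0ℚ) ≡ 0ℚ
  ∑-0 zero    = refl
  ∑-0 (suc n) = cong₂ _+_ (∑-0 n) (∑-0 n)

  ∑-comm : ∀ {m n} (f : Subset m → Subset n → ℚ) →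
    ∑ (λ S → ∑ λ T → f S T) ≡ ∑ (λ T → ∑ λ S → f S T)
  ∑-comm {zero}  f = refl
  ∑-comm {suc m} f = trans
    (cong₂ _+_ (∑-comm λ S → f (inside ∷ S)) (∑-comm λ S → f (outside ∷ S)))
    (sym (∑-+ (λ T → ∑ λ S → f (inside ∷ S) T) (λ T → ∑ λ S → f (outside ∷ S) T)))

  ∑-abs : (f : Subset n → ℚ) → abs (∑ f) ≤ ∑ (λ S → abs (f S))
  ∑-abs {zero}  f = ≤-refl
  ∑-abs {suc n} f = ≤-trans
    (∣p+q∣≤∣p∣+∣q∣ (∑ λ S → f (inside ∷ S)) (∑ λ S → f (outside ∷ S)))
    (+-mono-≤ (∑-abs λ S → f (inside ∷ S)) (∑-abs λ S → f (outside ∷ S)))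

∑-nonNeg : {f : Subset n → ℚ} → (∀ S → 0ℚ ≤ f S) → 0ℚ ≤ ∑ f
∑-nonNeg {n} {f} 0≤f = subst (_≤ ∑ f) (∑-0 n) (∑-mono 0≤f)

opaque
  unfolding ∑

  term≤∑ : {f : Subset n → ℚ} → (∀ S → 0ℚ ≤ f S) → ∀ S → f S ≤ ∑ f
  term≤∑ 0≤f []            = ≤-refl
  term≤∑ 0≤f (inside  ∷ S) = ≤-trans (term≤∑ (λ S → 0≤f (inside ∷ S)) S)
    (p≤p+q (∑-nonNeg λ S → 0≤f (outside ∷ S)))
  term≤∑ 0≤f (outside ∷ S) = ≤-trans (term≤∑ (λ S → 0≤f (outside ∷ S)) S)
    (p≤q+p (∑-nonNeg λ S → 0≤f (inside ∷ S)))

infix 5 ∑⟨_⟩_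

opaque

  -- Restriction by an indicator factor keeps every sum a full one, so two restricted sums are
  -- exchanged by `∑-comm` and linearity alone.
  ∑⟨_⟩_ : {P : Pred (Subset n) ℓ} → Decidable P → (Subset n → ℚ) → ℚ
  ∑⟨ P? ⟩ f = ∑ λ S → 𝟙 (P? S) * f S

  ∑⟨⟩-def : {P : Pred (Subset n) ℓ} (P? : Decidable P) (f : Subset n → ℚ) →
    (∑⟨ P? ⟩ f) ≡ (∑ λ S → 𝟙 (P? S) * f S)
  ∑⟨⟩-def P? f = refl

module _ {P : Pred (Subset n) ℓ} {P? : Decidable P} where

  opaque
    unfolding ∑⟨_⟩_

    ∑⟨⟩-cong : {f g : Subset n → ℚ} → (∀ S → P S → f S ≡ g S) → (∑⟨ P? ⟩ f) ≡ (∑⟨ P? ⟩ g)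
    ∑⟨⟩-cong f≡g = ∑-cong λ S → 𝟙-cong (P? S) (f≡g S)

    ∑⟨⟩-mono : {f g : Subset n → ℚ} → (∀ S → P S → f S ≤ g S) → (∑⟨ P? ⟩ f) ≤ (∑⟨ P? ⟩ g)
    ∑⟨⟩-mono f≤g = ∑-mono λ S → 𝟙-mono (P? S) (f≤g S)

    ∑⟨⟩-nonNeg : {f : Subset n → ℚ} → (∀ S → P S → 0ℚ ≤ f S) → 0ℚ ≤ (∑⟨ P? ⟩ f)
    ∑⟨⟩-nonNeg {f} 0≤f = ∑-nonNeg λ S →
      subst (_≤ 𝟙 (P? S) * f S) (*-zeroʳ (𝟙 (P? S))) (𝟙-mono (P? S) (0≤f S))

    ∑⟨⟩-+ : (f g : Subset n → ℚ) → (∑⟨ P? ⟩ λ S → f S + g S) ≡ (∑⟨ P? ⟩ f) + (∑⟨ P? ⟩ g)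
    ∑⟨⟩-+ f g = trans (∑-cong λ S → *-distribˡ-+ (𝟙 (P? S)) (f S) (g S))
      (∑-+ (λ S → 𝟙 (P? S) * f S) (λ S → 𝟙 (P? S) * g S))

    ∑⟨⟩-* : ∀ c (f : Subset n → ℚ) → (∑⟨ P? ⟩ λ S → c * f S) ≡ c * (∑⟨ P? ⟩ f)
    ∑⟨⟩-* c f = trans
      (∑-cong λ S → solve 3 (λ a b c → a :* (b :* c) := b :* (a :* c)) refl (𝟙 (P? S)) c (f S))
      (∑-* c (λ S → 𝟙 (P? S) * f S))

    ∑⟨⟩-abs : (f : Subset n → ℚ) → abs (∑⟨ P? ⟩ f) ≤ (∑⟨ P? ⟩ λ S → abs (f S))
    ∑⟨⟩-abs f = ≤-trans (∑-abs λ S → 𝟙 (P? S) * f S)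
      (≤-reflexive (∑-cong λ S → abs-* (f S) (𝟙-nonNeg (P? S))))

    ∑⟨⟩-∑ : ∀ {m} (f : Subset n → Subset m → ℚ) →
      (∑⟨ P? ⟩ λ S → ∑ λ T → f S T) ≡ (∑ λ T → ∑⟨ P? ⟩ λ S → f S T)
    ∑⟨⟩-∑ f = trans
      (sym (∑-cong λ S → ∑-* (𝟙 (P? S)) (f S)))
      (∑-comm λ S T → 𝟙 (P? S) * f S T)

    ∑⟨⟩-comm : ∀ {m ℓ′} {Q : Pred (Subset m) ℓ′} {Q? : Decidable Q} (f : Subset n → Subset m → ℚ) →
      (∑⟨ P? ⟩ λ S → ∑⟨ Q? ⟩ λ T → f S T) ≡ (∑⟨ Q? ⟩ λ T → ∑⟨ P? ⟩ λ S → f S T)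
    ∑⟨⟩-comm {Q? = Q?} f = trans
      (∑⟨⟩-∑ λ S T → 𝟙 (Q? T) * f S T)
      (∑-cong λ T → ∑⟨⟩-* (𝟙 (Q? T)) (λ S → f S T))

opaque
  unfolding ∑⟨_⟩_

  term≤∑⟨⟩ : {P : Pred (Subset n) ℓ} (P? : Decidable P) {f : Subset n → ℚ} →
    (∀ S → P S → 0ℚ ≤ f S) → ∀ {S} → P S → f S ≤ (∑⟨ P? ⟩ f)
  term≤∑⟨⟩ P? {f} 0≤f {S} PS = subst (_≤ (∑⟨ P? ⟩ f))
    (𝟙-yes-* (P? S) PS (f S))
    (term≤∑ (λ S → subst (_≤ 𝟙 (P? S) * f S) (*-zeroʳ (𝟙 (P? S))) (𝟙-mono (P? S) (0≤f S))) S)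

size? : ∀ r (S : Subset n) → Dec (#[ S ] ≡ r)
size? r S = #[ S ] ℕ.≟ r

-- Counting subsets of a given size

∑-zero : {f : Subset n → ℚ} → (∀ S → f S ≡ 0ℚ) → ∑ f ≡ 0ℚ
∑-zero {n} f≡0 = trans (∑-cong f≡0) (∑-0 n)

-- The number of ways to extend a set of size i to one of size r by elements
-- of a disjoint set of size f.
extensions : (i f r : ℕ) → ℕ
extensions zero    f r       = f C r
extensions (suc i) f zero    = 0
extensions (suc i) f (suc r) = extensions i f r

extensions-zero : ∀ i f → extensions i (suc f) 0 ≡ extensions i f 0
extensions-zero zero    f = refl
extensions-zero (suc i) f = refl

extensions-pascal : ∀ i f r → extensions i (suc f) (suc r) ≡ extensions i f r ℕ.+ extensions i f (suc r)
extensions-pascal zero    f r       = sym (ℕ.nCk+nC[k+1]≡[n+1]C[k+1] f r)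
extensions-pascal (suc i) f zero    = extensions-zero i f
extensions-pascal (suc i) f (suc r) = extensions-pascal i f r

extensions-+ : ∀ i f m → extensions i f (i ℕ.+ m) ≡ f C m
extensions-+ zero    f m = refl
extensions-+ (suc i) f m = extensions-+ i f m

-- Vertex by vertex: a vertex of `I` must lie in `J` and uses up one unit of `r`; a vertex of
-- `K ─ I` may be taken or left, which is Pascal's rule for `extensions`; a vertex outside `K` is
-- left, and if it belongs to `I` both sides vanish.
count-between : ∀ {n} (I K : Subset n) r →
  (∑⟨ size? r ⟩ λ J → 𝟙 (I ⊆? J) * 𝟙 (J ⊆? K)) ≡ 𝟙 (I ⊆? K) * fromℕ (extensions #[ I ] #[ K ─ I ] r)
count-between I K r = trans (∑⟨⟩-def (size? r) _) (go I K r)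
  where
  term : ∀ {n} (I K : Subset n) → ℕ → Subset n → ℚ
  term I K r J = 𝟙 (size? r J) * (𝟙 (I ⊆? J) * 𝟙 (J ⊆? K))

  0ˡ : ∀ {n} (I K : Subset n) (s : Subset n → ℚ) → ∑ (λ J → s J * (0ℚ * 𝟙 (J ⊆? K))) ≡ 0ℚ
  0ˡ I K s = ∑-zero λ J → solve 2 (λ a b → a :* (con 0ℚ :* b) := con 0ℚ) refl (s J) (𝟙 (J ⊆? K))

  0ʳ : ∀ {n} (I : Subset n) (s : Subset n → ℚ) → ∑ (λ J → s J * (𝟙 (I ⊆? J) * 0ℚ)) ≡ 0ℚ
  0ʳ I s = ∑-zero λ J → solve 2 (λ a b → a :* (b :* con 0ℚ) := con 0ℚ) refl (s J) (𝟙 (I ⊆? J))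

  0ₛ : ∀ {n} (I K : Subset n) → ∑ (λ J → 0ℚ * (𝟙 (I ⊆? J) * 𝟙 (J ⊆? K))) ≡ 0ℚ
  0ₛ I K = ∑-zero λ J → *-zeroˡ (𝟙 (I ⊆? J) * 𝟙 (J ⊆? K))

  left : ∀ {p q p′} → p ≡ p′ → q ≡ 0ℚ → p + q ≡ p′
  left {p} refl refl = +-identityʳ p

  right : ∀ {p q q′} → p ≡ 0ℚ → q ≡ q′ → p + q ≡ q′
  right {q = q} refl refl = +-identityˡ q

  go : ∀ {n} (I K : Subset n) r → ∑ (term I K r) ≡ 𝟙 (I ⊆? K) * fromℕ (extensions #[ I ] #[ K ─ I ] r)
  go [] [] zero    = ∑-[] (term [] [] 0)
  go [] [] (suc r) = ∑-[] (term [] [] (suc r))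
  go (inside ∷ I) (inside ∷ K) zero = trans (∑-∷ (term (inside ∷ I) (inside ∷ K) 0))
    (left (trans (0ₛ I K) (sym (*-zeroʳ (𝟙 (I ⊆? K))))) (0ˡ I K (λ J → 𝟙 (size? 0 J))))
  go (inside ∷ I) (inside ∷ K) (suc r) = trans (∑-∷ (term (inside ∷ I) (inside ∷ K) (suc r)))
    (left (go I K r) (0ˡ I K (λ J → 𝟙 (size? (suc r) J))))
  go (inside ∷ I) (outside ∷ K) r = trans (∑-∷ (term (inside ∷ I) (outside ∷ K) r))
    (left (trans (0ʳ I (λ J → 𝟙 (size? r (inside ∷ J)))) (sym (*-zeroˡ (fromℕ (extensions #[ inside ∷ I ] #[ K ─ I ] r))))) (0ˡ I K (λ J → 𝟙 (size? r J))))
  go (outside ∷ I) (inside ∷ K) zero = trans (∑-∷ (term (outside ∷ I) (inside ∷ K) 0))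
    (right (0ₛ I K) (trans (go I K 0)
      (cong (λ c → 𝟙 (I ⊆? K) * fromℕ c) (sym (extensions-zero #[ I ] #[ K ─ I ])))))
  go (outside ∷ I) (inside ∷ K) (suc r) = trans (∑-∷ (term (outside ∷ I) (inside ∷ K) (suc r))) (begin
    ∑ (term I K r) + ∑ (term I K (suc r))  ≡⟨ cong₂ _+_ (go I K r) (go I K (suc r)) ⟩
    b * fromℕ c + b * fromℕ d              ≡⟨ *-distribˡ-+ b (fromℕ c) (fromℕ d) ⟨
    b * (fromℕ c + fromℕ d)                ≡⟨ cong (b *_) (fromℕ-+ c d) ⟨
    b * fromℕ (c ℕ.+ d)                    ≡⟨ cong (λ e → b * fromℕ e) (extensions-pascal #[ I ] #[ K ─ I ] r) ⟨
    b * fromℕ (extensions #[ I ] (suc #[ K ─ I ]) (suc r)) ∎)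
    where
    open ≡-Reasoning
    b = 𝟙 (I ⊆? K)
    c = extensions #[ I ] #[ K ─ I ] r
    d = extensions #[ I ] #[ K ─ I ] (suc r)
  go (outside ∷ I) (outside ∷ K) r = trans (∑-∷ (term (outside ∷ I) (outside ∷ K) r))
    (right (0ʳ I (λ J → 𝟙 (size? r (inside ∷ J)))) (go I K r))

full─ : ∀ {n} (I : Subset n) → #[ full ─ I ] ≡ n ∸ #[ I ]
full─ I = trans (cong #[_] (∁≡ I)) (Subset.∣∁p∣≡n∸∣p∣ I)
  where
  open import Data.Fin.Subset using (∁)
  ∁≡ : ∀ {n} (I : Subset n) → full ─ I ≡ ∁ I
  ∁≡ []            = refl
  ∁≡ (inside  ∷ I) = cong (outside ∷_) (∁≡ I)
  ∁≡ (outside ∷ I) = cong (inside ∷_) (∁≡ I)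

─∅ : ∀ {n} (K : Subset n) → K ─ ∅ ≡ K
─∅ []            = refl
─∅ (inside  ∷ K) = cong (inside ∷_) (─∅ K)
─∅ (outside ∷ K) = cong (outside ∷_) (─∅ K)

#-─ : ∀ {n} {I K : Subset n} → I ⊆ K → #[ K ] ≡ #[ I ] ℕ.+ #[ K ─ I ]
#-─ {I = []}          {[]}          I⊆K = refl
#-─ {I = inside ∷ I}  {inside ∷ K}  I⊆K = cong suc (#-─ (Subset.drop-∷-⊆ I⊆K))
#-─ {I = inside ∷ I}  {outside ∷ K} I⊆K with () ← I⊆K here
#-─ {I = outside ∷ I} {inside ∷ K}  I⊆K =
  trans (cong suc (#-─ (Subset.drop-∷-⊆ I⊆K))) (sym (ℕ.+-suc #[ I ] #[ K ─ I ]))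
#-─ {I = outside ∷ I} {outside ∷ K} I⊆K = #-─ (Subset.drop-∷-⊆ I⊆K)

#-∪ : ∀ {n} (I U : Subset n) → #[ I ∪ U ] ≡ #[ U ] ℕ.+ #[ I ─ U ]
#-∪ []            []            = refl
#-∪ (inside  ∷ I) (inside  ∷ U) = cong suc (#-∪ I U)
#-∪ (inside  ∷ I) (outside ∷ U) = trans (cong suc (#-∪ I U)) (sym (ℕ.+-suc #[ U ] #[ I ─ U ]))
#-∪ (outside ∷ I) (inside  ∷ U) = cong suc (#-∪ I U)
#-∪ (outside ∷ I) (outside ∷ U) = #-∪ I U

count-above : ∀ {n} (I : Subset n) r →
  (∑⟨ size? r ⟩ λ J → 𝟙 (I ⊆? J)) ≡ fromℕ (extensions #[ I ] (n ∸ #[ I ]) r)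
count-above {n} I r = begin
  (∑⟨ size? r ⟩ λ J → 𝟙 (I ⊆? J))                  ≡⟨ ∑⟨⟩-cong (λ J _ → sym (trans (cong (𝟙 (I ⊆? J) *_) (𝟙-yes (J ⊆? full) Subset.⊆⊤)) (*-identityʳ (𝟙 (I ⊆? J))))) ⟩
  (∑⟨ size? r ⟩ λ J → 𝟙 (I ⊆? J) * 𝟙 (J ⊆? full))  ≡⟨ count-between I full r ⟩
  𝟙 (I ⊆? full) * fromℕ (extensions #[ I ] #[ full ─ I ] r)  ≡⟨ 𝟙-yes-* (I ⊆? full) Subset.⊆⊤ _ ⟩
  fromℕ (extensions #[ I ] #[ full ─ I ] r)          ≡⟨ cong (λ f → fromℕ (extensions #[ I ] f r)) (full─ I) ⟩
  fromℕ (extensions #[ I ] (n ∸ #[ I ]) r)           ∎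
  where open ≡-Reasoning

count-below : ∀ {n} (K : Subset n) r →
  (∑⟨ size? r ⟩ λ J → 𝟙 (J ⊆? K)) ≡ fromℕ (#[ K ] C r)
count-below {n} K r = begin
  (∑⟨ size? r ⟩ λ J → 𝟙 (J ⊆? K))                  ≡⟨ ∑⟨⟩-cong (λ J _ → sym (𝟙-yes-* (∅ ⊆? J) Subset.⊥⊆ (𝟙 (J ⊆? K)))) ⟩
  (∑⟨ size? r ⟩ λ J → 𝟙 (∅ ⊆? J) * 𝟙 (J ⊆? K))     ≡⟨ count-between ∅ K r ⟩
  𝟙 (∅ ⊆? K) * fromℕ (extensions #[ ∅ {n} ] #[ K ─ ∅ ] r)  ≡⟨ 𝟙-yes-* (∅ ⊆? K) Subset.⊥⊆ _ ⟩
  fromℕ (extensions #[ ∅ {n} ] #[ K ─ ∅ ] r)         ≡⟨ cong₂ (λ i J → fromℕ (extensions i #[ J ] r)) (Subset.∣⊥∣≡0 n) (─∅ K) ⟩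
  fromℕ (#[ K ] C r)                                ∎
  where open ≡-Reasoning

-- Falling factorials

infixl 8 _↓_

-- Rational bases are needed because the inverse contains falling factorials of the negative number
-- t - k.
_↓_ : ℚ → ℕ → ℚ
x ↓ zero  = 1ℚ
x ↓ suc i = x ↓ i * (x - fromℕ i)

↓-suc : ∀ x i → x ↓ suc i ≡ x * (x - 1ℚ) ↓ i
↓-suc x zero    = solve 1 (λ x → con 1ℚ :* (x :- con 0ℚ) := x :* con 1ℚ) refl x
↓-suc x (suc i) = begin
  x ↓ suc i * (x - fromℕ (suc i))                ≡⟨ cong₂ (λ a b → a * (x - b)) (↓-suc x i) (fromℕ-suc i) ⟩
  x * (x - 1ℚ) ↓ i * (x - (1ℚ + fromℕ i))        ≡⟨ solve 3 (λ x a b → x :* a :* (x :- (con 1ℚ :+ b)) := x :* (a :* (x :- con 1ℚ :- b))) refl x ((x - 1ℚ) ↓ i) (fromℕ i) ⟩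
  x * ((x - 1ℚ) ↓ i * (x - 1ℚ - fromℕ i))        ∎
  where open ≡-Reasoning

↓-+ : ∀ x i m → x ↓ (i ℕ.+ m) ≡ x ↓ i * (x - fromℕ i) ↓ m
↓-+ x i zero    = trans (cong (x ↓_) (ℕ.+-identityʳ i)) (sym (*-identityʳ (x ↓ i)))
↓-+ x i (suc m) = begin
  x ↓ (i ℕ.+ suc m)                                           ≡⟨ cong (x ↓_) (ℕ.+-suc i m) ⟩
  x ↓ (i ℕ.+ m) * (x - fromℕ (i ℕ.+ m))                       ≡⟨ cong₂ (λ a b → a * (x - b)) (↓-+ x i m) (fromℕ-+ i m) ⟩
  x ↓ i * (x - fromℕ i) ↓ m * (x - (fromℕ i + fromℕ m))       ≡⟨ solve 5 (λ a b x i m → a :* b :* (x :- (i :+ m)) := a :* (b :* (x :- i :- m))) refl (x ↓ i) ((x - fromℕ i) ↓ m) x (fromℕ i) (fromℕ m) ⟩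
  x ↓ i * ((x - fromℕ i) ↓ m * (x - fromℕ i - fromℕ m))       ∎
  where open ≡-Reasoning

fromℕ-pred : ∀ a → fromℕ (suc a) - 1ℚ ≡ fromℕ a
fromℕ-pred a = trans (cong (_- 1ℚ) (fromℕ-suc a)) (solve 1 (λ a → con 1ℚ :+ a :- con 1ℚ := a) refl (fromℕ a))

fromℕ-↓-suc : ∀ a i → fromℕ (suc a) ↓ suc i ≡ fromℕ (suc a) * fromℕ a ↓ i
fromℕ-↓-suc a i = trans (↓-suc (fromℕ (suc a)) i) (cong (λ x → fromℕ (suc a) * x ↓ i) (fromℕ-pred a))

0↓suc : ∀ i → 0ℚ ↓ suc i ≡ 0ℚ
0↓suc i = trans (↓-suc 0ℚ i) (*-zeroˡ ((0ℚ - 1ℚ) ↓ i))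

↓-nonNeg : ∀ a i → 0ℚ ≤ fromℕ a ↓ i
↓-nonNeg a       zero    = nonNegative⁻¹ 1ℚ
↓-nonNeg zero    (suc i) = ≤-reflexive (sym (0↓suc i))
↓-nonNeg (suc a) (suc i) = subst (0ℚ ≤_) (sym (fromℕ-↓-suc a i))
  (*-nonNeg (fromℕ-nonNeg (suc a)) (↓-nonNeg a i))

↓-mono : ∀ {a b} → a ℕ.≤ b → ∀ i → fromℕ a ↓ i ≤ fromℕ b ↓ i
↓-mono                 a≤b         zero    = ≤-refl
↓-mono {b = b}         ℕ.z≤n       (suc i) = subst (_≤ fromℕ b ↓ suc i) (sym (0↓suc i)) (↓-nonNeg b (suc i))
↓-mono {suc a} {suc b} (ℕ.s≤s a≤b) (suc i) = subst₂ _≤_ (sym (fromℕ-↓-suc a i)) (sym (fromℕ-↓-suc b i))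
  (*-mono (fromℕ-nonNeg (suc a)) (↓-nonNeg b i) (fromℕ-mono (ℕ.s≤s a≤b)) (↓-mono a≤b i))

↓-pos : ∀ {a i} → i ℕ.≤ a → 0ℚ < fromℕ a ↓ i
↓-pos ℕ.z≤n                   = positive⁻¹ 1ℚ
↓-pos {suc a} {suc i} (ℕ.s≤s i≤a) = subst (0ℚ <_) (sym (fromℕ-↓-suc a i))
  (*-pos (fromℕ-pos {suc a} (ℕ.s≤s ℕ.z≤n)) (↓-pos i≤a))

-- Absorption: a set of size m + 1 with a marked element is chosen in either order.
[1+m]*C : ∀ f m → suc m ℕ.* (suc f C suc m) ≡ suc f ℕ.* (f C m)
[1+m]*C zero    zero    = refl
[1+m]*C zero    (suc m) = ℕ.*-zeroʳ (suc (suc m))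
[1+m]*C (suc f) zero    = trans (ℕ.*-identityˡ _) (trans (ℕ.nC1≡n (suc (suc f))) (sym (ℕ.*-identityʳ _)))
[1+m]*C (suc f) (suc m) = begin
  suc (suc m) ℕ.* (suc (suc f) C suc (suc m))              ≡⟨ cong (suc (suc m) ℕ.*_) (ℕ.nCk+nC[k+1]≡[n+1]C[k+1] (suc f) (suc m)) ⟨
  suc (suc m) ℕ.* (c ℕ.+ d)                                ≡⟨ ℕ.*-distribˡ-+ (suc (suc m)) c d ⟩
  c ℕ.+ suc m ℕ.* c ℕ.+ suc (suc m) ℕ.* d                  ≡⟨ cong₂ (λ a b → c ℕ.+ a ℕ.+ b) ([1+m]*C f m) ([1+m]*C f (suc m)) ⟩
  c ℕ.+ suc f ℕ.* (f C m) ℕ.+ suc f ℕ.* (f C suc m)        ≡⟨ ℕ.+-assoc c _ _ ⟩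
  c ℕ.+ (suc f ℕ.* (f C m) ℕ.+ suc f ℕ.* (f C suc m))      ≡⟨ cong (c ℕ.+_) (ℕ.*-distribˡ-+ (suc f) (f C m) (f C suc m)) ⟨
  c ℕ.+ suc f ℕ.* (f C m ℕ.+ f C suc m)                    ≡⟨ cong (λ a → c ℕ.+ suc f ℕ.* a) (ℕ.nCk+nC[k+1]≡[n+1]C[k+1] f m) ⟩
  suc (suc f) ℕ.* (suc f C suc m)                          ∎
  where
  open ≡-Reasoning
  c = suc f C suc m
  d = suc f C suc (suc m)

-- `fromℕ m ↓ m` serves as m! here and in all later bounds.
↓-C : ∀ f m → fromℕ f ↓ m ≡ fromℕ m ↓ m * fromℕ (f C m)
↓-C f       zero    = refl
↓-C zero    (suc m) = trans (0↓suc m) (sym (*-zeroʳ (fromℕ (suc m) ↓ suc m)))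
↓-C (suc f) (suc m) = begin
  fromℕ (suc f) ↓ suc m                                      ≡⟨ fromℕ-↓-suc f m ⟩
  fromℕ (suc f) * fromℕ f ↓ m                                ≡⟨ cong (fromℕ (suc f) *_) (↓-C f m) ⟩
  fromℕ (suc f) * (fromℕ m ↓ m * fromℕ (f C m))              ≡⟨ solve 3 (λ a b c → a :* (b :* c) := b :* (a :* c)) refl (fromℕ (suc f)) (fromℕ m ↓ m) (fromℕ (f C m)) ⟩
  fromℕ m ↓ m * (fromℕ (suc f) * fromℕ (f C m))              ≡⟨ cong (fromℕ m ↓ m *_) (begin
    fromℕ (suc f) * fromℕ (f C m)                              ≡⟨ fromℕ-* (suc f) (f C m) ⟨
    fromℕ (suc f ℕ.* (f C m))                                  ≡⟨ cong fromℕ ([1+m]*C f m) ⟨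
    fromℕ (suc m ℕ.* (suc f C suc m))                          ≡⟨ fromℕ-* (suc m) (suc f C suc m) ⟩
    fromℕ (suc m) * fromℕ (suc f C suc m)                      ∎) ⟩
  fromℕ m ↓ m * (fromℕ (suc m) * fromℕ (suc f C suc m))      ≡⟨ solve 3 (λ a b c → a :* (b :* c) := b :* a :* c) refl (fromℕ m ↓ m) (fromℕ (suc m)) (fromℕ (suc f C suc m)) ⟩
  fromℕ (suc m) * fromℕ m ↓ m * fromℕ (suc f C suc m)        ≡⟨ cong (_* fromℕ (suc f C suc m)) (fromℕ-↓-suc m m) ⟨
  fromℕ (suc m) ↓ suc m * fromℕ (suc f C suc m)              ∎
  where open ≡-Reasoning

-- Both sides count r-sets above a j-set with one further element marked. Subtraction is rational,
-- so for r < j the first factor is negative, but then both counts are zero.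
extensions-absorb : ∀ j f r →
  (fromℕ r - fromℕ j) * fromℕ (extensions j (suc f) r) ≡ fromℕ (suc f) * fromℕ (extensions (suc j) f r)
extensions-absorb zero    f zero    = sym (*-zeroʳ (fromℕ (suc f)))
extensions-absorb zero    f (suc r) = begin
  (fromℕ (suc r) - 0ℚ) * fromℕ (suc f C suc r)  ≡⟨ cong (_* fromℕ (suc f C suc r)) (+-identityʳ (fromℕ (suc r))) ⟩
  fromℕ (suc r) * fromℕ (suc f C suc r)         ≡⟨ fromℕ-* (suc r) (suc f C suc r) ⟨
  fromℕ (suc r ℕ.* (suc f C suc r))             ≡⟨ cong fromℕ ([1+m]*C f r) ⟩
  fromℕ (suc f ℕ.* (f C r))                     ≡⟨ fromℕ-* (suc f) (f C r) ⟩
  fromℕ (suc f) * fromℕ (f C r)                 ∎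
  where open ≡-Reasoning
extensions-absorb (suc j) f zero    = trans (*-zeroʳ (0ℚ - fromℕ (suc j))) (sym (*-zeroʳ (fromℕ (suc f))))
extensions-absorb (suc j) f (suc r) = trans
  (cong (_* fromℕ (extensions j (suc f) r)) (begin
    fromℕ (suc r) - fromℕ (suc j)          ≡⟨ cong₂ _-_ (fromℕ-suc r) (fromℕ-suc j) ⟩
    1ℚ + fromℕ r - (1ℚ + fromℕ j)          ≡⟨ solve 2 (λ r j → con 1ℚ :+ r :- (con 1ℚ :+ j) := r :- j) refl (fromℕ r) (fromℕ j) ⟩
    fromℕ r - fromℕ j                      ∎))
  (extensions-absorb j f r)
  where open ≡-Reasoning

-- Iterated absorption: enlarging a set of size t + b by one vertex multiplies the number of k-sets
-- above it by (k - t - b) / (v - t - b). In the inversion this turns a count of k-sets into a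
-- falling factorial, to which Vandermonde's identity applies again.
extensions-↓ : ∀ {v} t k b → t ℕ.+ b ℕ.≤ v →
  (fromℕ v - fromℕ t) ↓ b * fromℕ (extensions (t ℕ.+ b) (v ∸ (t ℕ.+ b)) k) ≡
  (fromℕ k - fromℕ t) ↓ b * fromℕ (extensions t (v ∸ t) k)
extensions-↓ {v} t k zero    _ = cong (λ s → 1ℚ * fromℕ (extensions s (v ∸ s) k)) (ℕ.+-identityʳ t)
extensions-↓ {v} t k (suc b) t+b<v = begin
  w ↓ b * (w - β) * c (t ℕ.+ suc b)                   ≡⟨ cong (λ s → w ↓ b * (w - β) * c s) (ℕ.+-suc t b) ⟩
  w ↓ b * (w - β) * c (suc (t ℕ.+ b))                 ≡⟨ *-assoc (w ↓ b) (w - β) (c (suc (t ℕ.+ b))) ⟩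
  w ↓ b * ((w - β) * c (suc (t ℕ.+ b)))               ≡⟨ cong (w ↓ b *_) absorb ⟩
  w ↓ b * ((ν - β) * c (t ℕ.+ b))                     ≡⟨ solve 3 (λ a b c → a :* (b :* c) := b :* (a :* c)) refl (w ↓ b) (ν - β) (c (t ℕ.+ b)) ⟩
  (ν - β) * (w ↓ b * c (t ℕ.+ b))                     ≡⟨ cong ((ν - β) *_) (extensions-↓ t k b (ℕ.<⇒≤ t+b<v′)) ⟩
  (ν - β) * (ν ↓ b * c t)                             ≡⟨ solve 3 (λ a b c → a :* (b :* c) := b :* a :* c) refl (ν - β) (ν ↓ b) (c t) ⟩
  ν ↓ b * (ν - β) * c t                               ∎
  where
  open ≡-Reasoning
  w = fromℕ v - fromℕ t
  ν = fromℕ k - fromℕ t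
  β = fromℕ b
  c : ℕ → ℚ
  c s = fromℕ (extensions s (v ∸ s) k)
  t+b<v′ : t ℕ.+ b ℕ.< v
  t+b<v′ = subst (ℕ._≤ v) (ℕ.+-suc t b) t+b<v
  regroup : ∀ v → v - fromℕ t - β ≡ v - fromℕ (t ℕ.+ b)
  regroup v = trans (solve 3 (λ v t b → v :- t :- b := v :- (t :+ b)) refl v (fromℕ t) β)
    (cong (λ s → v - s) (sym (fromℕ-+ t b)))
  f = v ∸ suc (t ℕ.+ b)
  f+1 : v ∸ (t ℕ.+ b) ≡ suc f
  f+1 = ℕ.+-∸-assoc 1 t+b<v′
  absorb : (w - β) * c (suc (t ℕ.+ b)) ≡ (ν - β) * c (t ℕ.+ b)
  absorb = begin
    (w - β) * fromℕ (extensions (suc (t ℕ.+ b)) f k)            ≡⟨ cong (_* fromℕ (extensions (suc (t ℕ.+ b)) f k)) (begin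
      fromℕ v - fromℕ t - β                                      ≡⟨ regroup (fromℕ v) ⟩
      fromℕ v - fromℕ (t ℕ.+ b)                                  ≡⟨ fromℕ-∸ (ℕ.<⇒≤ t+b<v′) ⟨
      fromℕ (v ∸ (t ℕ.+ b))                                      ≡⟨ cong fromℕ f+1 ⟩
      fromℕ (suc f)                                              ∎) ⟩
    fromℕ (suc f) * fromℕ (extensions (suc (t ℕ.+ b)) f k)      ≡⟨ extensions-absorb (t ℕ.+ b) f k ⟨
    (fromℕ k - fromℕ (t ℕ.+ b)) * fromℕ (extensions (t ℕ.+ b) (suc f) k) ≡⟨ cong₂ _*_ (sym (regroup (fromℕ k))) (cong (λ e → fromℕ (extensions (t ℕ.+ b) e k)) (sym f+1)) ⟩
    (ν - β) * c (t ℕ.+ b)                                       ∎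

-- Binomial sums and Vandermonde's identity.

-- binomialSum p F j i = Σₐ C(p,a) F (j + p - a) (i + a)
binomialSum : ℕ → (ℕ → ℕ → ℚ) → ℕ → ℕ → ℚ
binomialSum zero    F j i = F j i
binomialSum (suc p) F j i = binomialSum p F (suc j) i + binomialSum p F j (suc i)

-- Every step raises exactly one index, so all leaves lie on the antidiagonal j + i = s and
-- agreement there suffices. The inversion relies on this: its inner sums simplify only for indices
-- adding up to |T ─ U|.
binomialSum-cong : ∀ p {F G : ℕ → ℕ → ℚ} {j i s} → j ℕ.+ i ℕ.+ p ≡ s →
  (∀ j i → j ℕ.+ i ≡ s → F j i ≡ G j i) → binomialSum p F j i ≡ binomialSum p G j i
binomialSum-cong zero    {j = j} {i} eq F≡G = F≡G j i (trans (sym (ℕ.+-identityʳ (j ℕ.+ i))) eq)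
binomialSum-cong (suc p) {j = j} {i} {s} eq F≡G = cong₂ _+_
  (binomialSum-cong p eq₁ F≡G)
  (binomialSum-cong p (trans (cong (ℕ._+ p) (ℕ.+-suc j i)) eq₁) F≡G)
  where
  eq₁ : suc j ℕ.+ i ℕ.+ p ≡ s
  eq₁ = trans (sym (ℕ.+-suc (j ℕ.+ i) p)) eq

binomialSum-cong-≗ : ∀ p {F G : ℕ → ℕ → ℚ} {j i} → (∀ j i → F j i ≡ G j i) →
  binomialSum p F j i ≡ binomialSum p G j i
binomialSum-cong-≗ p F≡G = binomialSum-cong p refl λ j i _ → F≡G j i

binomialSum-+ : ∀ p F G j i →
  binomialSum p (λ j i → F j i + G j i) j i ≡ binomialSum p F j i + binomialSum p G j i
binomialSum-+ zero    F G j i = refl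
binomialSum-+ (suc p) F G j i = trans
  (cong₂ _+_ (binomialSum-+ p F G (suc j) i) (binomialSum-+ p F G j (suc i)))
  (solve 4 (λ a b c d → (a :+ b) :+ (c :+ d) := (a :+ c) :+ (b :+ d)) refl
    (binomialSum p F (suc j) i) (binomialSum p G (suc j) i) (binomialSum p F j (suc i)) (binomialSum p G j (suc i)))

binomialSum-* : ∀ p c F j i → binomialSum p (λ j i → c * F j i) j i ≡ c * binomialSum p F j i
binomialSum-* zero    c F j i = refl
binomialSum-* (suc p) c F j i = trans
  (cong₂ _+_ (binomialSum-* p c F (suc j) i) (binomialSum-* p c F j (suc i)))
  (sym (*-distribˡ-+ c (binomialSum p F (suc j) i) (binomialSum p F j (suc i))))

binomialSum-sucˡ : ∀ p F j i → binomialSum p (λ j i → F (suc j) i) j i ≡ binomialSum p F (suc j) i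
binomialSum-sucˡ zero    F j i = refl
binomialSum-sucˡ (suc p) F j i = cong₂ _+_ (binomialSum-sucˡ p F (suc j) i) (binomialSum-sucˡ p F j (suc i))

binomialSum-sucʳ : ∀ p F j i → binomialSum p (λ j i → F j (suc i)) j i ≡ binomialSum p F j (suc i)
binomialSum-sucʳ zero    F j i = refl
binomialSum-sucʳ (suc p) F j i = cong₂ _+_ (binomialSum-sucʳ p F (suc j) i) (binomialSum-sucʳ p F j (suc i))

-- Arbitrary starting indices make the induction close; the usual identity has both equal to 0. The
-- two summands share the factor (e - 1)↓p, which depends only on j + i, and their remaining factors
-- add to (x - j) + (y - i) = e, the missing first factor of e↓(p + 1).
vandermonde : ∀ p x y j i →
  binomialSum p (λ j i → x ↓ j * y ↓ i) j i ≡ x ↓ j * y ↓ i * (x + y - fromℕ (j ℕ.+ i)) ↓ p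
vandermonde zero    x y j i = sym (*-identityʳ (x ↓ j * y ↓ i))
vandermonde (suc p) x y j i = begin
  binomialSum p F (suc j) i + binomialSum p F j (suc i)
    ≡⟨ cong₂ _+_ (vandermonde p x y (suc j) i) (vandermonde p x y j (suc i)) ⟩
  x ↓ suc j * y ↓ i * (x + y - fromℕ (suc (j ℕ.+ i))) ↓ p + x ↓ j * y ↓ suc i * (x + y - fromℕ (j ℕ.+ suc i)) ↓ p
    ≡⟨ cong₂ (λ a b → x ↓ suc j * y ↓ i * a ↓ p + x ↓ j * y ↓ suc i * b ↓ p) (eq refl) (eq (ℕ.+-suc j i)) ⟩
  x ↓ j * (x - fromℕ j) * y ↓ i * (e - 1ℚ) ↓ p + x ↓ j * (y ↓ i * (y - fromℕ i)) * (e - 1ℚ) ↓ p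
    ≡⟨ solve 7 (λ X Y E x y j i → X :* (x :- j) :* Y :* E :+ X :* (Y :* (y :- i)) :* E
                 := X :* Y :* ((x :+ y :- (j :+ i)) :* E)) refl (x ↓ j) (y ↓ i) ((e - 1ℚ) ↓ p) x y (fromℕ j) (fromℕ i) ⟩
  x ↓ j * y ↓ i * ((x + y - (fromℕ j + fromℕ i)) * (e - 1ℚ) ↓ p)
    ≡⟨ cong (λ a → x ↓ j * y ↓ i * ((x + y - a) * (e - 1ℚ) ↓ p)) (fromℕ-+ j i) ⟨
  x ↓ j * y ↓ i * (e * (e - 1ℚ) ↓ p)
    ≡⟨ cong (x ↓ j * y ↓ i *_) (↓-suc e p) ⟨
  x ↓ j * y ↓ i * e ↓ suc p ∎
  where
  open ≡-Reasoning
  F : ℕ → ℕ → ℚ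
  F j i = x ↓ j * y ↓ i
  e = x + y - fromℕ (j ℕ.+ i)
  eq : ∀ {s} → s ≡ suc (j ℕ.+ i) → x + y - fromℕ s ≡ e - 1ℚ
  eq refl = trans (cong (λ a → x + y - a) (fromℕ-suc (j ℕ.+ i)))
    (solve 2 (λ a b → a :- (con 1ℚ :+ b) := a :- b :- con 1ℚ) refl (x + y) (fromℕ (j ℕ.+ i)))

-- Vandermonde for binomial coefficients. The weight ignores the second index, so each step of the
-- sum is one use of Pascal's rule.
binomialSum-C : ∀ p n j i → binomialSum p (λ j i → fromℕ (n C j)) j i ≡ fromℕ ((n ℕ.+ p) C (j ℕ.+ p))
binomialSum-C zero    n j i = cong₂ (λ a b → fromℕ (a C b)) (sym (ℕ.+-identityʳ n)) (sym (ℕ.+-identityʳ j))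
binomialSum-C (suc p) n j i = begin
  binomialSum p _ (suc j) i + binomialSum p _ j (suc i)                ≡⟨ cong₂ _+_ (binomialSum-C p n (suc j) i) (binomialSum-C p n j (suc i)) ⟩
  fromℕ ((n ℕ.+ p) C suc (j ℕ.+ p)) + fromℕ ((n ℕ.+ p) C (j ℕ.+ p))    ≡⟨ +-comm (fromℕ ((n ℕ.+ p) C suc (j ℕ.+ p))) (fromℕ ((n ℕ.+ p) C (j ℕ.+ p))) ⟩
  fromℕ ((n ℕ.+ p) C (j ℕ.+ p)) + fromℕ ((n ℕ.+ p) C suc (j ℕ.+ p))    ≡⟨ fromℕ-+ ((n ℕ.+ p) C (j ℕ.+ p)) ((n ℕ.+ p) C suc (j ℕ.+ p)) ⟨
  fromℕ ((n ℕ.+ p) C (j ℕ.+ p) ℕ.+ (n ℕ.+ p) C suc (j ℕ.+ p))          ≡⟨ cong fromℕ (ℕ.nCk+nC[k+1]≡[n+1]C[k+1] (n ℕ.+ p) (j ℕ.+ p)) ⟩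
  fromℕ (suc (n ℕ.+ p) C suc (j ℕ.+ p))                                ≡⟨ cong₂ (λ a b → fromℕ (a C b)) (ℕ.+-suc n p) (ℕ.+-suc j p) ⟨
  fromℕ ((n ℕ.+ suc p) C (j ℕ.+ suc p))                                ∎
  where open ≡-Reasoning

-- Inverting the inclusion sums

-- A subset `I` of `T` is a choice in `T ─ U`, taking b elements and leaving b′, followed by a
-- choice in `T ∩ U`. Only the first choice affects `I ─ U`, so the inner sum freezes `b` while its
-- own counters continue from `b′` and `b`.
∑-⊆ : ∀ {n} (T U : Subset n) (H : ℕ → ℕ → ℕ → ℚ) →
  (∑⟨ _⊆? T ⟩ λ I → H (#[ T ─ I ]) (#[ I ]) (#[ I ─ U ])) ≡
  binomialSum #[ T ─ U ] (λ b′ b → binomialSum #[ T ∩ U ] (λ j i → H j i b) b′ b) 0 0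
∑-⊆ T U H = trans (∑⟨⟩-def (_⊆? T) _) (go T U H)
  where
  term : ∀ {n} → Subset n → Subset n → (ℕ → ℕ → ℕ → ℚ) → Subset n → ℚ
  term T U H I = 𝟙 (I ⊆? T) * H (#[ T ─ I ]) (#[ I ]) (#[ I ─ U ])
  inner : ∀ {n} → Subset n → Subset n → (ℕ → ℕ → ℕ → ℚ) → ℕ → ℕ → ℚ
  inner T U H b′ b = binomialSum #[ T ∩ U ] (λ j i → H j i b) b′ b
  result : ∀ {n} → Subset n → Subset n → (ℕ → ℕ → ℕ → ℚ) → ℚ
  result T U H = binomialSum #[ T ─ U ] (inner T U H) 0 0
  go : ∀ {n} (T U : Subset n) H → ∑ (term T U H) ≡ result T U H
  out : ∀ {n} (T U : Subset n) {u} (H : ℕ → ℕ → ℕ → ℚ) →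
    ∑ (term (outside ∷ T) (u ∷ U) H) ≡ ∑ (term T U H)
  out T U {u} H = trans (∑-∷ (term (outside ∷ T) (u ∷ U) H))
    (trans (cong₂ _+_ (∑-zero λ I → *-zeroˡ (H (#[ T ─ I ]) (suc #[ I ]) (#[ (inside ∷ I) ─ (u ∷ U) ]))) (same u))
           (+-identityˡ (∑ (term T U H))))
    where
    same : ∀ u → ∑ (λ I → term (outside ∷ T) (u ∷ U) H (outside ∷ I)) ≡ ∑ (term T U H)
    same inside  = refl
    same outside = refl
  go [] [] H = trans (∑-[] (term [] [] H)) (*-identityˡ (H 0 0 0))
  go (inside ∷ T) (inside ∷ U) H = begin
    ∑ (term (inside ∷ T) (inside ∷ U) H)      ≡⟨ ∑-∷ (term (inside ∷ T) (inside ∷ U) H) ⟩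
    ∑ (term T U Hᵢ) + ∑ (term T U Hₒ)         ≡⟨ cong₂ _+_ (go T U Hᵢ) (go T U Hₒ) ⟩
    result T U Hᵢ + result T U Hₒ             ≡⟨ binomialSum-+ #[ T ─ U ] (inner T U Hᵢ) (inner T U Hₒ) 0 0 ⟨
    binomialSum #[ T ─ U ] (λ b′ b → inner T U Hᵢ b′ b + inner T U Hₒ b′ b) 0 0
      ≡⟨ binomialSum-cong-≗ #[ T ─ U ] (λ b′ b → trans
           (cong₂ _+_ (binomialSum-sucʳ #[ T ∩ U ] (λ j i → H j i b) b′ b) (binomialSum-sucˡ #[ T ∩ U ] (λ j i → H j i b) b′ b))
           (+-comm _ (binomialSum #[ T ∩ U ] (λ j i → H j i b) (suc b′) b))) ⟩
    result (inside ∷ T) (inside ∷ U) H        ∎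
    where
    open ≡-Reasoning
    Hᵢ Hₒ : ℕ → ℕ → ℕ → ℚ
    Hᵢ j i b = H j (suc i) b
    Hₒ j i b = H (suc j) i b
  go (inside ∷ T) (outside ∷ U) H = begin
    ∑ (term (inside ∷ T) (outside ∷ U) H)     ≡⟨ ∑-∷ (term (inside ∷ T) (outside ∷ U) H) ⟩
    ∑ (term T U Hᵢ) + ∑ (term T U Hₒ)         ≡⟨ cong₂ _+_ (go T U Hᵢ) (go T U Hₒ) ⟩
    result T U Hᵢ + result T U Hₒ             ≡⟨ cong₂ _+_
      (trans (binomialSum-cong-≗ #[ T ─ U ] λ b′ b → binomialSum-sucʳ #[ T ∩ U ] (λ j i → H j i (suc b)) b′ b)
             (binomialSum-sucʳ #[ T ─ U ] (inner T U H) 0 0))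
      (trans (binomialSum-cong-≗ #[ T ─ U ] λ b′ b → binomialSum-sucˡ #[ T ∩ U ] (λ j i → H j i b) b′ b)
             (binomialSum-sucˡ #[ T ─ U ] (inner T U H) 0 0)) ⟩
    binomialSum #[ T ─ U ] (inner T U H) 0 1 + binomialSum #[ T ─ U ] (inner T U H) 1 0
                                              ≡⟨ +-comm (binomialSum #[ T ─ U ] (inner T U H) 0 1) (binomialSum #[ T ─ U ] (inner T U H) 1 0) ⟩
    result (inside ∷ T) (outside ∷ U) H       ∎
    where
    open ≡-Reasoning
    Hᵢ Hₒ : ℕ → ℕ → ℕ → ℚ
    Hᵢ j i b = H j (suc i) (suc b)
    Hₒ j i b = H (suc j) i b
  go (outside ∷ T) (inside  ∷ U) H = trans (out T U H) (go T U H)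
  go (outside ∷ T) (outside ∷ U) H = trans (out T U H) (go T U H)

#-∩-─ : ∀ {n} (T U : Subset n) → #[ T ] ≡ #[ T ─ U ] ℕ.+ #[ T ∩ U ]
#-∩-─ []            []            = refl
#-∩-─ (inside  ∷ T) (inside  ∷ U) = trans (cong suc (#-∩-─ T U)) (sym (ℕ.+-suc #[ T ─ U ] #[ T ∩ U ]))
#-∩-─ (inside  ∷ T) (outside ∷ U) = cong suc (#-∩-─ T U)
#-∩-─ (outside ∷ T) (inside  ∷ U) = #-∩-─ T U
#-∩-─ (outside ∷ T) (outside ∷ U) = #-∩-─ T U

#─≡0⇒⊆ : ∀ {n} (T U : Subset n) → #[ T ─ U ] ≡ 0 → T ⊆ U
#─≡0⇒⊆ (inside  ∷ T) (inside  ∷ U) eq = Subset.in⊆in (#─≡0⇒⊆ T U eq)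
#─≡0⇒⊆ (outside ∷ T) (inside  ∷ U) eq = Subset.out⊆ (#─≡0⇒⊆ T U eq)
#─≡0⇒⊆ (outside ∷ T) (outside ∷ U) eq = Subset.out⊆ (#─≡0⇒⊆ T U eq)

⊆⇒#─≡0 : ∀ {n} (T U : Subset n) → T ⊆ U → #[ T ─ U ] ≡ 0
⊆⇒#─≡0 []            []            _   = refl
⊆⇒#─≡0 (inside  ∷ T) (inside  ∷ U) T⊆U = ⊆⇒#─≡0 T U (Subset.drop-∷-⊆ T⊆U)
⊆⇒#─≡0 (inside  ∷ T) (outside ∷ U) T⊆U with () ← T⊆U here
⊆⇒#─≡0 (outside ∷ T) (inside  ∷ U) T⊆U = ⊆⇒#─≡0 T U (Subset.drop-∷-⊆ T⊆U)
⊆⇒#─≡0 (outside ∷ T) (outside ∷ U) T⊆U = ⊆⇒#─≡0 T U (Subset.drop-∷-⊆ T⊆U)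

⊆∧#≡⇒≡ : ∀ {n} {T U : Subset n} → T ⊆ U → #[ T ] ≡ #[ U ] → T ≡ U
⊆∧#≡⇒≡ {T = []}          {[]}          _   _  = refl
⊆∧#≡⇒≡ {T = inside ∷ T}  {inside ∷ U}  T⊆U eq = cong (inside ∷_) (⊆∧#≡⇒≡ (Subset.drop-∷-⊆ T⊆U) (ℕ.suc-injective eq))
⊆∧#≡⇒≡ {T = inside ∷ T}  {outside ∷ U} T⊆U eq with () ← T⊆U here
⊆∧#≡⇒≡ {T = outside ∷ T} {inside ∷ U}  T⊆U eq =
  contradiction (Subset.p⊆q⇒∣p∣≤∣q∣ (Subset.drop-∷-⊆ T⊆U)) (ℕ.<⇒≱ (ℕ.≤-reflexive (sym eq)))
⊆∧#≡⇒≡ {T = outside ∷ T} {outside ∷ U} T⊆U eq = cong (outside ∷_) (⊆∧#≡⇒≡ (Subset.drop-∷-⊆ T⊆U) eq)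

below : ∀ {v} → ℕ → (Subset v → ℚ) → Subset v → ℚ
below t x K = ∑⟨ size? t ⟩ λ U → 𝟙 (U ⊆? K) * x U

-- `above k (below t x)` is the Z of the overview. Applied to the indicator of the non-edges,
-- `above t` counts the missing edges over a set.
above : ∀ {v} → ℕ → (Subset v → ℚ) → Subset v → ℚ
above k z I = ∑⟨ size? k ⟩ λ K → 𝟙 (I ⊆? K) * z K

𝟙-⊆-∪ : ∀ {n} (I U K : Subset n) → 𝟙 (I ⊆? K) * 𝟙 (U ⊆? K) ≡ 𝟙 ((I ∪ U) ⊆? K)
𝟙-⊆-∪ I U K = trans (sym (𝟙-× (I ⊆? K) (U ⊆? K)))
  (𝟙-⇔ ((I ⊆? K) ×-dec (U ⊆? K)) ((I ∪ U) ⊆? K)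
    (λ (I⊆K , U⊆K) x∈I∪U → [ (λ x∈I → I⊆K x∈I) , (λ x∈U → U⊆K x∈U) ]′ (Subset.x∈p∪q⁻ I U x∈I∪U))
    (λ I∪U⊆K → (λ x∈I → I∪U⊆K (Subset.p⊆p∪q U x∈I)) , (λ x∈U → I∪U⊆K (Subset.q⊆p∪q I U x∈U))))
  where open import Data.Sum.Base using ([_,_]′)

∑-same-size : ∀ {v t} {T : Subset v} (f : Subset v → ℚ) → #[ T ] ≡ t →
  (∑⟨ size? t ⟩ λ U → 𝟙 (T ⊆? U) * f U) ≡ f T
∑-same-size {v} {t} {T} f refl = begin
  (∑⟨ size? t ⟩ λ U → 𝟙 (T ⊆? U) * f U)  ≡⟨ ∑⟨⟩-cong (λ U #U → trans
    (𝟙-cong (T ⊆? U) (λ T⊆U → cong f (sym (⊆∧#≡⇒≡ T⊆U (sym #U)))))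
    (*-comm (𝟙 (T ⊆? U)) (f T))) ⟩
  (∑⟨ size? t ⟩ λ U → f T * 𝟙 (T ⊆? U))  ≡⟨ ∑⟨⟩-* (f T) (λ U → 𝟙 (T ⊆? U)) ⟩
  f T * (∑⟨ size? t ⟩ λ U → 𝟙 (T ⊆? U))  ≡⟨ cong (f T *_) (count-above T t) ⟩
  f T * fromℕ (extensions t (v ∸ t) t)   ≡⟨ cong (λ s → f T * fromℕ (extensions t (v ∸ t) s)) (ℕ.+-identityʳ t) ⟨
  f T * fromℕ (extensions t (v ∸ t) (t ℕ.+ 0)) ≡⟨ cong (λ c → f T * fromℕ c) (extensions-+ t (v ∸ t) 0) ⟩
  f T * 1ℚ                               ≡⟨ *-identityʳ (f T) ⟩
  f T                                    ∎
  where open ≡-Reasoning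

-- Exchanging the sums leaves for each `U` the number of k-sets above `I ∪ U`, a set of size t + |I
-- ─ U|.
above-below : ∀ {v} k t (x : Subset v → ℚ) I → above k (below t x) I ≡
  (∑⟨ size? t ⟩ λ U → fromℕ (extensions (t ℕ.+ #[ I ─ U ]) (v ∸ (t ℕ.+ #[ I ─ U ])) k) * x U)
above-below {v} k t x I = begin
  (∑⟨ size? k ⟩ λ K → 𝟙 (I ⊆? K) * (∑⟨ size? t ⟩ λ U → 𝟙 (U ⊆? K) * x U))
    ≡⟨ ∑⟨⟩-cong (λ K _ → sym (∑⟨⟩-* (𝟙 (I ⊆? K)) (λ U → 𝟙 (U ⊆? K) * x U))) ⟩
  (∑⟨ size? k ⟩ λ K → ∑⟨ size? t ⟩ λ U → 𝟙 (I ⊆? K) * (𝟙 (U ⊆? K) * x U))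
    ≡⟨ ∑⟨⟩-comm (λ K U → 𝟙 (I ⊆? K) * (𝟙 (U ⊆? K) * x U)) ⟩
  (∑⟨ size? t ⟩ λ U → ∑⟨ size? k ⟩ λ K → 𝟙 (I ⊆? K) * (𝟙 (U ⊆? K) * x U))
    ≡⟨ ∑⟨⟩-cong (λ U #U → begin
      (∑⟨ size? k ⟩ λ K → 𝟙 (I ⊆? K) * (𝟙 (U ⊆? K) * x U))  ≡⟨ ∑⟨⟩-cong (λ K _ → trans
        (solve 3 (λ a b c → a :* (b :* c) := c :* (a :* b)) refl (𝟙 (I ⊆? K)) (𝟙 (U ⊆? K)) (x U))
        (cong (x U *_) (𝟙-⊆-∪ I U K))) ⟩
      (∑⟨ size? k ⟩ λ K → x U * 𝟙 ((I ∪ U) ⊆? K))           ≡⟨ ∑⟨⟩-* (x U) (λ K → 𝟙 ((I ∪ U) ⊆? K)) ⟩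
      x U * (∑⟨ size? k ⟩ λ K → 𝟙 ((I ∪ U) ⊆? K))           ≡⟨ cong (x U *_) (count-above (I ∪ U) k) ⟩
      x U * c #[ I ∪ U ]                                     ≡⟨ cong (λ s → x U * c s) (trans (#-∪ I U) (cong (ℕ._+ #[ I ─ U ]) #U)) ⟩
      x U * c (t ℕ.+ #[ I ─ U ])                             ≡⟨ *-comm (x U) (c (t ℕ.+ #[ I ─ U ])) ⟩
      c (t ℕ.+ #[ I ─ U ]) * x U                             ∎) ⟩
  (∑⟨ size? t ⟩ λ U → c (t ℕ.+ #[ I ─ U ]) * x U) ∎
  where
  open ≡-Reasoning
  c : ℕ → ℚ
  c s = fromℕ (extensions s (v ∸ s) k)

module _ {v : ℕ} (k t : ℕ) (t+t≤v : t ℕ.+ t ℕ.≤ v) where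

  private
    m w c₀ : ℚ
    m = fromℕ k - fromℕ t
    w = fromℕ v - fromℕ t
    c₀ = fromℕ (extensions t (v ∸ t) k)

    c : ℕ → ℚ
    c b = fromℕ (extensions (t ℕ.+ b) (v ∸ (t ℕ.+ b)) k)

  -- Write d = |T ─ U| and p = |T ∩ U|. Vandermonde over the part of `I` in `T ∩ U` gives (w - m -
  -- d)↓p, whatever the other part is, because b′ + b = d. By `extensions-↓`, w↓b times `c b`
  -- becomes m↓b times `c₀`. The second Vandermonde sum then has bases -m and m and equals 0↓d,
  -- which vanishes unless d = 0, that is, unless T ⊆ U.
  inversion-coefficient : ∀ (T U : Subset v) → #[ T ] ≡ t →
    (∑⟨ _⊆? T ⟩ λ I → (- m) ↓ #[ T ─ I ] * w ↓ #[ I ] * c #[ I ─ U ]) ≡ 𝟙 (T ⊆? U) * (c₀ * (w - m) ↓ t)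
  inversion-coefficient T U #T = begin
    (∑⟨ _⊆? T ⟩ λ I → (- m) ↓ #[ T ─ I ] * w ↓ #[ I ] * c #[ I ─ U ])
      ≡⟨ ∑-⊆ T U (λ j i b → (- m) ↓ j * w ↓ i * c b) ⟩
    binomialSum d (λ b′ b → binomialSum p (λ j i → (- m) ↓ j * w ↓ i * c b) b′ b) 0 0
      ≡⟨ binomialSum-cong d refl step ⟩
    binomialSum d (λ b′ b → (e ↓ p * c₀) * ((- m) ↓ b′ * m ↓ b)) 0 0
      ≡⟨ binomialSum-* d (e ↓ p * c₀) (λ b′ b → (- m) ↓ b′ * m ↓ b) 0 0 ⟩
    (e ↓ p * c₀) * binomialSum d (λ b′ b → (- m) ↓ b′ * m ↓ b) 0 0
      ≡⟨ cong (e ↓ p * c₀ *_) (vandermonde d (- m) m 0 0) ⟩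
    (e ↓ p * c₀) * (1ℚ * 1ℚ * (- m + m - 0ℚ) ↓ d)
      ≡⟨ cong (λ a → (e ↓ p * c₀) * (1ℚ * 1ℚ * a ↓ d)) (solve 1 (λ m → :- m :+ m :- con 0ℚ := con 0ℚ) refl m) ⟩
    (e ↓ p * c₀) * (1ℚ * 1ℚ * 0ℚ ↓ d)
      ≡⟨ solve 2 (λ a b → a :* (con 1ℚ :* con 1ℚ :* b) := a :* b) refl (e ↓ p * c₀) (0ℚ ↓ d) ⟩
    (e ↓ p * c₀) * 0ℚ ↓ d
      ≡⟨ final d refl ⟩
    𝟙 (T ⊆? U) * (c₀ * (w - m) ↓ t) ∎
    where
    open ≡-Reasoning
    d = #[ T ─ U ]
    p = #[ T ∩ U ]
    e = - m + w - fromℕ d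
    d+p≡t : d ℕ.+ p ≡ t
    d+p≡t = trans (sym (#-∩-─ T U)) #T
    step : ∀ b′ b → b′ ℕ.+ b ≡ d →
      binomialSum p (λ j i → (- m) ↓ j * w ↓ i * c b) b′ b ≡ (e ↓ p * c₀) * ((- m) ↓ b′ * m ↓ b)
    step b′ b b′+b≡d = begin
      binomialSum p (λ j i → (- m) ↓ j * w ↓ i * c b) b′ b
        ≡⟨ binomialSum-cong-≗ p (λ j i → *-comm ((- m) ↓ j * w ↓ i) (c b)) ⟩
      binomialSum p (λ j i → c b * ((- m) ↓ j * w ↓ i)) b′ b
        ≡⟨ binomialSum-* p (c b) (λ j i → (- m) ↓ j * w ↓ i) b′ b ⟩
      c b * binomialSum p (λ j i → (- m) ↓ j * w ↓ i) b′ b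
        ≡⟨ cong (c b *_) (vandermonde p (- m) w b′ b) ⟩
      c b * ((- m) ↓ b′ * w ↓ b * (- m + w - fromℕ (b′ ℕ.+ b)) ↓ p)
        ≡⟨ cong (λ s → c b * ((- m) ↓ b′ * w ↓ b * (- m + w - fromℕ s) ↓ p)) b′+b≡d ⟩
      c b * ((- m) ↓ b′ * w ↓ b * e ↓ p)
        ≡⟨ solve 4 (λ c m w e → c :* (m :* w :* e) := e :* m :* (w :* c)) refl (c b) ((- m) ↓ b′) (w ↓ b) (e ↓ p) ⟩
      e ↓ p * (- m) ↓ b′ * (w ↓ b * c b)
        ≡⟨ cong (e ↓ p * (- m) ↓ b′ *_) (extensions-↓ t k b (ℕ.≤-trans (ℕ.+-monoʳ-≤ t b≤t) t+t≤v)) ⟩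
      e ↓ p * (- m) ↓ b′ * (m ↓ b * c₀)
        ≡⟨ solve 4 (λ e m n c → e :* m :* (n :* c) := e :* c :* (m :* n)) refl (e ↓ p) ((- m) ↓ b′) (m ↓ b) c₀ ⟩
      (e ↓ p * c₀) * ((- m) ↓ b′ * m ↓ b) ∎
      where
      b≤t : b ℕ.≤ t
      b≤t = ℕ.≤-trans (ℕ.m≤n+m b b′) (ℕ.≤-trans (ℕ.≤-reflexive b′+b≡d)
        (ℕ.≤-trans (ℕ.m≤m+n d p) (ℕ.≤-reflexive d+p≡t)))
    final : ∀ d′ → d ≡ d′ → (e ↓ p * c₀) * 0ℚ ↓ d′ ≡ 𝟙 (T ⊆? U) * (c₀ * (w - m) ↓ t)
    final zero d≡0 = begin
      e ↓ p * c₀ * 1ℚ                  ≡⟨ cong (λ s → (- m + w - fromℕ s) ↓ p * c₀ * 1ℚ) d≡0 ⟩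
      (- m + w - 0ℚ) ↓ p * c₀ * 1ℚ     ≡⟨ cong₂ (λ x s → x ↓ s * c₀ * 1ℚ)
        (solve 2 (λ m w → :- m :+ w :- con 0ℚ := w :- m) refl m w)
        (trans (cong (ℕ._+ p) (sym d≡0)) d+p≡t) ⟩
      (w - m) ↓ t * c₀ * 1ℚ            ≡⟨ solve 2 (λ a b → a :* b :* con 1ℚ := b :* a) refl ((w - m) ↓ t) c₀ ⟩
      c₀ * (w - m) ↓ t                 ≡⟨ 𝟙-yes-* (T ⊆? U) (#─≡0⇒⊆ T U d≡0) (c₀ * (w - m) ↓ t) ⟨
      𝟙 (T ⊆? U) * (c₀ * (w - m) ↓ t)  ∎
    final (suc d′) d≡suc = begin
      e ↓ p * c₀ * 0ℚ ↓ suc d′         ≡⟨ cong (e ↓ p * c₀ *_) (0↓suc d′) ⟩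
      e ↓ p * c₀ * 0ℚ                  ≡⟨ *-zeroʳ (e ↓ p * c₀) ⟩
      0ℚ                               ≡⟨ 𝟙-no-* (T ⊆? U) (λ T⊆U → ℕ.0≢1+n (trans (sym (⊆⇒#─≡0 T U T⊆U)) d≡suc)) (c₀ * (w - m) ↓ t) ⟨
      𝟙 (T ⊆? U) * (c₀ * (w - m) ↓ t)  ∎

  inversion : (x : Subset v → ℚ) {T : Subset v} → #[ T ] ≡ t →
    c₀ * (w - m) ↓ t * x T ≡
    (∑⟨ _⊆? T ⟩ λ I → (- m) ↓ #[ T ─ I ] * w ↓ #[ I ] * above k (below t x) I)
  inversion x {T} #T = sym (begin
    (∑⟨ _⊆? T ⟩ λ I → a I * above k (below t x) I)
      ≡⟨ ∑⟨⟩-cong (λ I _ → trans (cong (a I *_) (above-below k t x I)) (sym (∑⟨⟩-* (a I) (λ U → c #[ I ─ U ] * x U)))) ⟩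
    (∑⟨ _⊆? T ⟩ λ I → ∑⟨ size? t ⟩ λ U → a I * (c #[ I ─ U ] * x U))
      ≡⟨ ∑⟨⟩-comm (λ I U → a I * (c #[ I ─ U ] * x U)) ⟩
    (∑⟨ size? t ⟩ λ U → ∑⟨ _⊆? T ⟩ λ I → a I * (c #[ I ─ U ] * x U))
      ≡⟨ ∑⟨⟩-cong (λ U _ → begin
        (∑⟨ _⊆? T ⟩ λ I → a I * (c #[ I ─ U ] * x U))  ≡⟨ ∑⟨⟩-cong (λ I _ → solve 3 (λ a c x → a :* (c :* x) := x :* (a :* c)) refl (a I) (c #[ I ─ U ]) (x U)) ⟩
        (∑⟨ _⊆? T ⟩ λ I → x U * (a I * c #[ I ─ U ]))  ≡⟨ ∑⟨⟩-* (x U) (λ I → a I * c #[ I ─ U ]) ⟩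
        x U * (∑⟨ _⊆? T ⟩ λ I → a I * c #[ I ─ U ])    ≡⟨ cong (x U *_) (inversion-coefficient T U #T) ⟩
        x U * (𝟙 (T ⊆? U) * D)                        ≡⟨ solve 3 (λ x b d → x :* (b :* d) := b :* (d :* x)) refl (x U) (𝟙 (T ⊆? U)) D ⟩
        𝟙 (T ⊆? U) * (D * x U)                        ∎) ⟩
    (∑⟨ size? t ⟩ λ U → 𝟙 (T ⊆? U) * (D * x U))
      ≡⟨ ∑-same-size (λ U → D * x U) #T ⟩
    D * x T ∎)
    where
    open ≡-Reasoning
    D = c₀ * (w - m) ↓ t
    a : Subset v → ℚ
    a I = (- m) ↓ #[ T ─ I ] * w ↓ #[ I ]

-- Averaging bounds

-- Double counting of chains I ⊆ J ⊆ K: each h-set `K` over `I` contains equally many r-sets `J`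
-- over `I`.
averaging : ∀ {v} h r (g : Subset v → ℚ) I →
  (∑⟨ size? r ⟩ λ J → 𝟙 (I ⊆? J) * above h g J) ≡ fromℕ (extensions #[ I ] (h ∸ #[ I ]) r) * above h g I
averaging {v} h r g I = begin
  (∑⟨ size? r ⟩ λ J → 𝟙 (I ⊆? J) * above h g J)
    ≡⟨ ∑⟨⟩-cong (λ J _ → sym (∑⟨⟩-* (𝟙 (I ⊆? J)) (λ K → 𝟙 (J ⊆? K) * g K))) ⟩
  (∑⟨ size? r ⟩ λ J → ∑⟨ size? h ⟩ λ K → 𝟙 (I ⊆? J) * (𝟙 (J ⊆? K) * g K))
    ≡⟨ ∑⟨⟩-comm (λ J K → 𝟙 (I ⊆? J) * (𝟙 (J ⊆? K) * g K)) ⟩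
  (∑⟨ size? h ⟩ λ K → ∑⟨ size? r ⟩ λ J → 𝟙 (I ⊆? J) * (𝟙 (J ⊆? K) * g K))
    ≡⟨ ∑⟨⟩-cong (λ K #K → begin
      (∑⟨ size? r ⟩ λ J → 𝟙 (I ⊆? J) * (𝟙 (J ⊆? K) * g K))   ≡⟨ ∑⟨⟩-cong (λ J _ →
        solve 3 (λ a b c → a :* (b :* c) := c :* (a :* b)) refl (𝟙 (I ⊆? J)) (𝟙 (J ⊆? K)) (g K)) ⟩
      (∑⟨ size? r ⟩ λ J → g K * (𝟙 (I ⊆? J) * 𝟙 (J ⊆? K)))   ≡⟨ ∑⟨⟩-* (g K) (λ J → 𝟙 (I ⊆? J) * 𝟙 (J ⊆? K)) ⟩
      g K * (∑⟨ size? r ⟩ λ J → 𝟙 (I ⊆? J) * 𝟙 (J ⊆? K))     ≡⟨ cong (g K *_) (count-between I K r) ⟩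
      g K * (𝟙 (I ⊆? K) * fromℕ (e #[ K ─ I ]))              ≡⟨ cong (g K *_) (𝟙-cong (I ⊆? K) λ I⊆K →
        cong (fromℕ ∘ e) (trans (sym (ℕ.m+n∸m≡n #[ I ] #[ K ─ I ])) (cong (_∸ #[ I ]) (trans (sym (#-─ I⊆K)) #K)))) ⟩
      g K * (𝟙 (I ⊆? K) * fromℕ (e (h ∸ #[ I ])))            ≡⟨ solve 3 (λ a b c → a :* (b :* c) := c :* (b :* a)) refl (g K) (𝟙 (I ⊆? K)) (fromℕ (e (h ∸ #[ I ]))) ⟩
      fromℕ (e (h ∸ #[ I ])) * (𝟙 (I ⊆? K) * g K)            ∎) ⟩
  (∑⟨ size? h ⟩ λ K → fromℕ (e (h ∸ #[ I ])) * (𝟙 (I ⊆? K) * g K))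
    ≡⟨ ∑⟨⟩-* (fromℕ (e (h ∸ #[ I ]))) (λ K → 𝟙 (I ⊆? K) * g K) ⟩
  fromℕ (e (h ∸ #[ I ])) * above h g I ∎
  where
  open ≡-Reasoning
  e : ℕ → ℕ
  e f = extensions #[ I ] f r

-- The triangle inequality applied to the average, multiplied through by m!. In this form the two
-- sides are falling factorials, which later combine by `↓-+`, and no division has to be justified.
averaging-bound : ∀ {v} h r (g : Subset v → ℚ) I m {β} → #[ I ] ℕ.+ m ≡ r →
  (∀ J → #[ J ] ≡ r → abs (above h g J) ≤ β) →
  fromℕ (h ∸ #[ I ]) ↓ m * abs (above h g I) ≤ fromℕ (v ∸ #[ I ]) ↓ m * β
averaging-bound {v} h r g I m {β} #I+m≡r bound = begin
  fromℕ f ↓ m * abs (above h g I)                          ≡⟨ cong (_* abs (above h g I)) (↓-C f m) ⟩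
  fromℕ m ↓ m * fromℕ (f C m) * abs (above h g I)          ≡⟨ *-assoc (fromℕ m ↓ m) (fromℕ (f C m)) (abs (above h g I)) ⟩
  fromℕ m ↓ m * (fromℕ (f C m) * abs (above h g I))        ≤⟨ *-monoˡ (↓-nonNeg m m) averaged ⟩
  fromℕ m ↓ m * (fromℕ ((v ∸ #[ I ]) C m) * β)             ≡⟨ *-assoc (fromℕ m ↓ m) (fromℕ ((v ∸ #[ I ]) C m)) β ⟨
  fromℕ m ↓ m * fromℕ ((v ∸ #[ I ]) C m) * β               ≡⟨ cong (_* β) (↓-C (v ∸ #[ I ]) m) ⟨
  fromℕ (v ∸ #[ I ]) ↓ m * β                               ∎
  where
  open ≤-Reasoning
  f = h ∸ #[ I ]
  ext≡C : ∀ f → extensions #[ I ] f r ≡ f C m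
  ext≡C f = trans (cong (extensions #[ I ] f) (sym #I+m≡r)) (extensions-+ #[ I ] f m)
  averaged : fromℕ (f C m) * abs (above h g I) ≤ fromℕ ((v ∸ #[ I ]) C m) * β
  averaged = begin
    fromℕ (f C m) * abs (above h g I)                        ≡⟨ abs-* (above h g I) (fromℕ-nonNeg (f C m)) ⟨
    abs (fromℕ (f C m) * above h g I)                        ≡⟨ cong (λ c → abs (fromℕ c * above h g I)) (ext≡C f) ⟨
    abs (fromℕ (extensions #[ I ] f r) * above h g I)        ≡⟨ cong abs (averaging h r g I) ⟨
    abs (∑⟨ size? r ⟩ λ J → 𝟙 (I ⊆? J) * above h g J)        ≤⟨ ∑⟨⟩-abs (λ J → 𝟙 (I ⊆? J) * above h g J) ⟩
    (∑⟨ size? r ⟩ λ J → abs (𝟙 (I ⊆? J) * above h g J))      ≤⟨ ∑⟨⟩-mono (λ J #J → begin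
      abs (𝟙 (I ⊆? J) * above h g J)  ≡⟨ abs-* (above h g J) (𝟙-nonNeg (I ⊆? J)) ⟩
      𝟙 (I ⊆? J) * abs (above h g J)  ≤⟨ *-monoˡ (𝟙-nonNeg (I ⊆? J)) (bound J #J) ⟩
      𝟙 (I ⊆? J) * β                  ≡⟨ *-comm (𝟙 (I ⊆? J)) β ⟩
      β * 𝟙 (I ⊆? J)                  ∎) ⟩
    (∑⟨ size? r ⟩ λ J → β * 𝟙 (I ⊆? J))                      ≡⟨ ∑⟨⟩-* β (λ J → 𝟙 (I ⊆? J)) ⟩
    β * (∑⟨ size? r ⟩ λ J → 𝟙 (I ⊆? J))                      ≡⟨ cong (β *_) (count-above I r) ⟩
    β * fromℕ (extensions #[ I ] (v ∸ #[ I ]) r)             ≡⟨ cong (λ c → β * fromℕ c) (ext≡C (v ∸ #[ I ])) ⟩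
    β * fromℕ ((v ∸ #[ I ]) C m)                             ≡⟨ *-comm β (fromℕ ((v ∸ #[ I ]) C m)) ⟩
    fromℕ ((v ∸ #[ I ]) C m) * β                             ∎

-- The case `U = T` of `∑-⊆`: nothing of `T` lies outside `U`, so the outer choice disappears.
∑-⊆-sizes : ∀ {n} (T : Subset n) (F : ℕ → ℕ → ℚ) →
  (∑⟨ _⊆? T ⟩ λ I → F (#[ T ─ I ]) (#[ I ])) ≡ binomialSum #[ T ] F 0 0
∑-⊆-sizes T F = trans (∑-⊆ T T λ j i _ → F j i)
  (cong₂ (λ d p → binomialSum d (binomialSum p F) 0 0)
    (⊆⇒#─≡0 T T (λ x∈T → x∈T)) (cong #[_] (Subset.∩-idem T)))

binomialSum-const : ∀ p c j i → binomialSum p (λ _ _ → c) j i ≡ fromℕ (2 ℕ.^ p) * c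
binomialSum-const zero    c j i = sym (*-identityˡ c)
binomialSum-const (suc p) c j i = begin
  binomialSum p (λ _ _ → c) (suc j) i + binomialSum p (λ _ _ → c) j (suc i) ≡⟨ cong₂ _+_ (binomialSum-const p c (suc j) i) (binomialSum-const p c j (suc i)) ⟩
  fromℕ (2 ℕ.^ p) * c + fromℕ (2 ℕ.^ p) * c   ≡⟨ solve 2 (λ a c → a :* c :+ a :* c := con (fromℕ 2) :* a :* c) refl (fromℕ (2 ℕ.^ p)) c ⟩
  fromℕ 2 * fromℕ (2 ℕ.^ p) * c               ≡⟨ cong (_* c) (fromℕ-* 2 (2 ℕ.^ p)) ⟨
  fromℕ (2 ℕ.^ suc p) * c                     ∎
  where open ≡-Reasoning

-- Ratios of falling factorials.

fromℕ-≤⇒0≤- : ∀ {a b} → a ℕ.≤ b → 0ℚ ≤ fromℕ b - fromℕ a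
fromℕ-≤⇒0≤- a≤b = p≤q⇒0≤q-p (fromℕ-mono a≤b)

-- Each factor satisfies (a + d - μ) / (a - μ) ≤ (A - μ) / (A - μ - 1), which amounts to d (A - μ -
-- 1) ≤ a - μ; the right sides telescope to A / (A - m).
↓-growth : ∀ A d a m → m ℕ.≤ A → d ℕ.* A ℕ.+ m ℕ.≤ a →
  fromℕ (a ℕ.+ d) ↓ m * (fromℕ A - fromℕ m) ≤ fromℕ a ↓ m * fromℕ A
↓-growth A d a zero    _   _ = ≤-reflexive
  (solve 1 (λ A → con 1ℚ :* (A :- con 0ℚ) := con 1ℚ :* A) refl (fromℕ A))
↓-growth A d a (suc m) m<A dA+m<a = begin
  X * (fromℕ (a ℕ.+ d) - μ) * (α - fromℕ (suc m))  ≡⟨ cong₂ (λ b c → X * (b - μ) * (α - c)) (fromℕ-+ a d) (fromℕ-suc m) ⟩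
  X * (a′ + δ - μ) * (α - (1ℚ + μ))                ≡⟨ *-assoc X (a′ + δ - μ) (α - (1ℚ + μ)) ⟩
  X * ((a′ + δ - μ) * (α - (1ℚ + μ)))              ≤⟨ *-monoˡ (↓-nonNeg (a ℕ.+ d) m) (≤-trans (p≤p+q slack)
    (≤-reflexive (solve 4 (λ a δ α μ → (a :+ δ :- μ) :* (α :- (con 1ℚ :+ μ)) :+ (a :- (δ :* α :+ μ) :+ δ :* (con 1ℚ :+ μ))
                    := (α :- μ) :* (a :- μ)) refl a′ δ α μ))) ⟩
  X * ((α - μ) * (a′ - μ))                         ≡⟨ *-assoc X (α - μ) (a′ - μ) ⟨
  X * (α - μ) * (a′ - μ)                           ≤⟨ *-monoʳ (fromℕ-≤⇒0≤- (ℕ.≤-trans (ℕ.m≤n+m m (d ℕ.* A)) dA+m≤a))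
                                                       (↓-growth A d a m (ℕ.<⇒≤ m<A) dA+m≤a) ⟩
  fromℕ a ↓ m * α * (a′ - μ)                       ≡⟨ solve 3 (λ a b c → a :* b :* c := a :* c :* b) refl (fromℕ a ↓ m) α (a′ - μ) ⟩
  fromℕ a ↓ m * (a′ - μ) * α                       ∎
  where
  open ≤-Reasoning
  X = fromℕ (a ℕ.+ d) ↓ m
  a′ = fromℕ a
  δ = fromℕ d
  α = fromℕ A
  μ = fromℕ m
  dA+m≤a : d ℕ.* A ℕ.+ m ℕ.≤ a
  dA+m≤a = ℕ.≤-trans (ℕ.+-monoʳ-≤ (d ℕ.* A) (ℕ.n≤1+n m)) dA+m<a
  slack : 0ℚ ≤ a′ - (δ * α + μ) + δ * (1ℚ + μ)
  slack = +-mono-≤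
    (subst (λ b → 0ℚ ≤ a′ - b) (trans (fromℕ-+ (d ℕ.* A) m) (cong (_+ μ) (fromℕ-* d A))) (fromℕ-≤⇒0≤- dA+m≤a))
    (*-nonNeg (fromℕ-nonNeg d) (subst (0ℚ ≤_) (fromℕ-suc m) (fromℕ-nonNeg (suc m))))

-- With A = 3t the telescoped ratio A / (A - m) is at most 3t / 2t. This is the origin of the
-- constant 3/2 and of the 3t in the lower bound on v.
↓-ratio : ∀ {t d a m} → 1 ℕ.≤ t → m ℕ.≤ t → d ℕ.* (3 ℕ.* t) ℕ.+ t ℕ.≤ a →
  fromℕ 2 * fromℕ (a ℕ.+ d) ↓ m ≤ fromℕ 3 * fromℕ a ↓ m
↓-ratio {t} {d} {a} {m} 1≤t m≤t large = *-cancelˡ (fromℕ-pos 1≤t) (begin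
  τ * (fromℕ 2 * X)          ≤⟨ p≤p+q (*-nonNeg (↓-nonNeg (a ℕ.+ d) m) (fromℕ-≤⇒0≤- m≤t)) ⟩
  τ * (fromℕ 2 * X) + X * (τ - fromℕ m) ≡⟨ solve 3 (λ τ X m → τ :* (con (fromℕ 2) :* X) :+ X :* (τ :- m) := X :* (con (fromℕ 3) :* τ :- m)) refl τ X (fromℕ m) ⟩
  X * (fromℕ 3 * τ - fromℕ m)           ≡⟨ cong (λ b → X * (b - fromℕ m)) (fromℕ-* 3 t) ⟨
  X * (fromℕ (3 ℕ.* t) - fromℕ m)       ≤⟨ ↓-growth (3 ℕ.* t) d a m (ℕ.≤-trans m≤t (ℕ.m≤m+n t _)) (ℕ.≤-trans (ℕ.+-monoʳ-≤ (d ℕ.* (3 ℕ.* t)) m≤t) large) ⟩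
  Y * fromℕ (3 ℕ.* t)                   ≡⟨ cong (Y *_) (fromℕ-* 3 t) ⟩
  Y * (fromℕ 3 * τ)                     ≡⟨ solve 3 (λ Y a τ → Y :* (a :* τ) := τ :* (a :* Y)) refl Y (fromℕ 3) τ ⟩
  τ * (fromℕ 3 * Y)                     ∎)
  where
  open ≤-Reasoning
  τ = fromℕ t
  X = fromℕ (a ℕ.+ d) ↓ m
  Y = fromℕ a ↓ m

-- The left side is the rising product m (m + 1) ... (m + j - 1), the right side the same product
-- shifted up by one. The shift costs little and produces the factor that `averaging-bound` offers.
abs-↓-neg : ∀ m j → abs ((- fromℕ m) ↓ j) ≤ fromℕ (m ℕ.+ j) ↓ j
abs-↓-neg m zero    = ≤-refl
abs-↓-neg m (suc j) = begin
  abs (X * (- fromℕ m - fromℕ j))            ≡⟨ ∣p*q∣≡∣p∣*∣q∣ X (- fromℕ m - fromℕ j) ⟩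
  abs X * abs (- fromℕ m - fromℕ j)          ≡⟨ cong (λ a → abs X * abs a) (solve 2 (λ m j → :- m :- j := :- (m :+ j)) refl (fromℕ m) (fromℕ j)) ⟩
  abs X * abs (- (fromℕ m + fromℕ j))        ≡⟨ cong (abs X *_) (∣-p∣≡∣p∣ (fromℕ m + fromℕ j)) ⟩
  abs X * abs (fromℕ m + fromℕ j)            ≡⟨ cong (λ a → abs X * abs a) (fromℕ-+ m j) ⟨
  abs X * abs (fromℕ (m ℕ.+ j))              ≡⟨ cong (abs X *_) (0≤p⇒∣p∣≡p (fromℕ-nonNeg (m ℕ.+ j))) ⟩
  abs X * fromℕ (m ℕ.+ j)                    ≤⟨ *-mono (0≤∣p∣ X) (fromℕ-nonNeg (suc (m ℕ.+ j))) (abs-↓-neg m j) (fromℕ-mono (ℕ.n≤1+n (m ℕ.+ j))) ⟩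
  fromℕ (m ℕ.+ j) ↓ j * fromℕ (suc (m ℕ.+ j)) ≡⟨ *-comm (fromℕ (m ℕ.+ j) ↓ j) (fromℕ (suc (m ℕ.+ j))) ⟩
  fromℕ (suc (m ℕ.+ j)) * fromℕ (m ℕ.+ j) ↓ j ≡⟨ fromℕ-↓-suc (m ℕ.+ j) j ⟨
  fromℕ (suc (m ℕ.+ j)) ↓ suc j              ≡⟨ cong (λ a → fromℕ a ↓ suc j) (ℕ.+-suc m j) ⟨
  fromℕ (m ℕ.+ suc j) ↓ suc j                ∎
  where
  open ≤-Reasoning
  X = (- fromℕ m) ↓ j

#[T─[T∩U]] : ∀ {n} (T U : Subset n) → #[ T ─ (T ∩ U) ] ≡ #[ T ─ U ]
#[T─[T∩U]] []            []            = refl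
#[T─[T∩U]] (inside  ∷ T) (inside  ∷ U) = #[T─[T∩U]] T U
#[T─[T∩U]] (inside  ∷ T) (outside ∷ U) = cong suc (#[T─[T∩U]] T U)
#[T─[T∩U]] (outside ∷ T) (inside  ∷ U) = #[T─[T∩U]] T U
#[T─[T∩U]] (outside ∷ T) (outside ∷ U) = #[T─[T∩U]] T U

∸-split : ∀ {a s i j} → s ℕ.≤ a → i ℕ.+ j ≡ s → a ∸ s ℕ.+ j ≡ a ∸ i
∸-split {a} {i = i} {j} i+j≤a refl = begin
  a ∸ (i ℕ.+ j) ℕ.+ j  ≡⟨ cong (ℕ._+ j) (ℕ.∸-+-assoc a i j) ⟨
  a ∸ i ∸ j ℕ.+ j      ≡⟨ ℕ.m∸n+n≡m (ℕ.m+n≤o⇒m≤o∸n j (subst (ℕ._≤ a) (ℕ.+-comm i j) i+j≤a)) ⟩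
  a ∸ i                ∎
  where open ≡-Reasoning

-- The norm of the inverse, and the loss of cliques above an edge, for large v.

module _ {v k t : ℕ} (1≤t : 1 ℕ.≤ t) (t≤k : t ℕ.≤ k) (large : k ℕ.* (3 ℕ.* t) ℕ.+ t ℕ.+ k ℕ.≤ v) where

  private
    c : ℕ → ℚ
    c s = fromℕ (extensions s (v ∸ s) k)

    k≤v : k ℕ.≤ v
    k≤v = ℕ.≤-trans (ℕ.m≤n+m k (k ℕ.* (3 ℕ.* t) ℕ.+ t)) large

    t≤v : t ℕ.≤ v
    t≤v = ℕ.≤-trans t≤k k≤v

    large-k : k ℕ.* (3 ℕ.* t) ℕ.+ t ℕ.≤ v ∸ k
    large-k = subst (ℕ._≤ v ∸ k) (ℕ.m+n∸n≡m (k ℕ.* (3 ℕ.* t) ℕ.+ t) k) (ℕ.∸-monoˡ-≤ k large)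

    large-t : k ℕ.* (3 ℕ.* t) ℕ.+ t ℕ.≤ v ∸ t
    large-t = ℕ.≤-trans large-k (ℕ.∸-monoʳ-≤ v t≤k)

    t≤v∸k : t ℕ.≤ v ∸ k
    t≤v∸k = ℕ.≤-trans (ℕ.m≤n+m t (k ℕ.* (3 ℕ.* t))) large-k

    t≤v∸t : t ℕ.≤ v ∸ t
    t≤v∸t = ℕ.≤-trans (ℕ.m≤n+m t (k ℕ.* (3 ℕ.* t))) large-t

    t+t≤v : t ℕ.+ t ℕ.≤ v
    t+t≤v = subst (t ℕ.+ t ℕ.≤_) (ℕ.m+[n∸m]≡n t≤v) (ℕ.+-monoʳ-≤ t t≤v∸t)

  -- By `inversion`, c E |x T| is bounded by 2^t terms of size at most v↓t β, where E = (v - k)↓t.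
  -- Then `↓-ratio` with d = k bounds v↓t by (3/2) E, and E cancels.
  inverse-bound : (x : Subset v → ℚ) {β : ℚ} →
    (∀ T → #[ T ] ≡ t → abs (above k (below t x) T) ≤ β) →
    ∀ T → #[ T ] ≡ t → fromℕ 2 * (c t * abs (x T)) ≤ fromℕ 3 * (fromℕ (2 ℕ.^ t) * β)
  inverse-bound x {β} bound T #T = *-cancelˡ 0<E (begin
    E * (fromℕ 2 * (c t * abs (x T)))       ≡⟨ solve 4 (λ a b c d → a :* (b :* (c :* d)) := b :* (c :* a :* d)) refl E (fromℕ 2) (c t) (abs (x T)) ⟩
    fromℕ 2 * (c t * E * abs (x T))         ≤⟨ *-monoˡ (fromℕ-nonNeg 2) weak ⟩
    fromℕ 2 * (fromℕ (2 ℕ.^ t) * (V * β))   ≡⟨ solve 4 (λ a b c d → a :* (b :* (c :* d)) := b :* d :* (a :* c)) refl (fromℕ 2) (fromℕ (2 ℕ.^ t)) V β ⟩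
    fromℕ (2 ℕ.^ t) * β * (fromℕ 2 * V)     ≤⟨ *-monoˡ (*-nonNeg (fromℕ-nonNeg (2 ℕ.^ t)) 0≤β)
      (subst (λ a → fromℕ 2 * fromℕ a ↓ t ≤ fromℕ 3 * E) (ℕ.m∸n+n≡m k≤v) (↓-ratio 1≤t ℕ.≤-refl large-k)) ⟩
    fromℕ (2 ℕ.^ t) * β * (fromℕ 3 * E)     ≡⟨ solve 4 (λ a b c d → a :* b :* (c :* d) := d :* (c :* (a :* b))) refl (fromℕ (2 ℕ.^ t)) β (fromℕ 3) E ⟩
    E * (fromℕ 3 * (fromℕ (2 ℕ.^ t) * β))   ∎)
    where
    open ≤-Reasoning
    E V m w : ℚ
    E = fromℕ (v ∸ k) ↓ t
    V = fromℕ v ↓ t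
    m = fromℕ k - fromℕ t
    w = fromℕ v - fromℕ t
    0<E : 0ℚ < E
    0<E = ↓-pos t≤v∸k
    0≤β : 0ℚ ≤ β
    0≤β = ≤-trans (0≤∣p∣ (above k (below t x) T)) (bound T #T)
    Z : Subset v → ℚ
    Z = above k (below t x)
    w-m : w - m ≡ fromℕ (v ∸ k)
    w-m = trans (solve 3 (λ v k t → v :- t :- (k :- t) := v :- k) refl (fromℕ v) (fromℕ k) (fromℕ t)) (sym (fromℕ-∸ k≤v))
    -- With i = |I| and j = |T ─ I|, the factor |(t - k)↓j| is at most (k - t + j)↓j = (k - i)↓j.
    -- This is exactly the coefficient of |Z I| in `averaging-bound`, so every term is at most v↓i
    -- (v - i)↓j β = v↓t β.
    termBound : ∀ I → I ⊆ T → abs ((- m) ↓ #[ T ─ I ] * w ↓ #[ I ] * Z I) ≤ V * β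
    termBound I I⊆T = begin
      abs ((- m) ↓ j * w ↓ i * Z I)               ≡⟨ trans (∣p*q∣≡∣p∣*∣q∣ ((- m) ↓ j * w ↓ i) (Z I)) (cong (_* abs (Z I)) (∣p*q∣≡∣p∣*∣q∣ ((- m) ↓ j) (w ↓ i))) ⟩
      abs ((- m) ↓ j) * abs (w ↓ i) * abs (Z I)   ≡⟨ cong₂ (λ a b → abs ((- a) ↓ j) * abs (b ↓ i) * abs (Z I)) (fromℕ-∸ t≤k) (fromℕ-∸ t≤v) ⟨
      abs ((- fromℕ (k ∸ t)) ↓ j) * abs (fromℕ (v ∸ t) ↓ i) * abs (Z I)
                                                  ≡⟨ cong (λ a → abs ((- fromℕ (k ∸ t)) ↓ j) * a * abs (Z I)) (0≤p⇒∣p∣≡p (↓-nonNeg (v ∸ t) i)) ⟩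
      abs ((- fromℕ (k ∸ t)) ↓ j) * fromℕ (v ∸ t) ↓ i * abs (Z I)
                                                  ≤⟨ *-monoʳ (0≤∣p∣ (Z I)) (*-mono (0≤∣p∣ ((- fromℕ (k ∸ t)) ↓ j)) (↓-nonNeg v i) (abs-↓-neg (k ∸ t) j) (↓-mono (ℕ.m∸n≤m v t) i)) ⟩
      fromℕ (k ∸ t ℕ.+ j) ↓ j * fromℕ v ↓ i * abs (Z I) ≡⟨ cong (λ a → fromℕ a ↓ j * fromℕ v ↓ i * abs (Z I)) k∸t+j ⟩
      fromℕ (k ∸ i) ↓ j * fromℕ v ↓ i * abs (Z I) ≡⟨ solve 3 (λ a b c → a :* b :* c := b :* (a :* c)) refl (fromℕ (k ∸ i) ↓ j) (fromℕ v ↓ i) (abs (Z I)) ⟩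
      fromℕ v ↓ i * (fromℕ (k ∸ i) ↓ j * abs (Z I)) ≤⟨ *-monoˡ (↓-nonNeg v i) (averaging-bound k t (below t x) I j i+j≡t bound) ⟩
      fromℕ v ↓ i * (fromℕ (v ∸ i) ↓ j * β)       ≡⟨ *-assoc (fromℕ v ↓ i) (fromℕ (v ∸ i) ↓ j) β ⟨
      fromℕ v ↓ i * fromℕ (v ∸ i) ↓ j * β         ≡⟨ cong (λ a → fromℕ v ↓ i * a ↓ j * β) (fromℕ-∸ i≤v) ⟩
      fromℕ v ↓ i * (fromℕ v - fromℕ i) ↓ j * β   ≡⟨ cong (_* β) (↓-+ (fromℕ v) i j) ⟨
      fromℕ v ↓ (i ℕ.+ j) * β                     ≡⟨ cong (λ s → fromℕ v ↓ s * β) i+j≡t ⟩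
      V * β                                       ∎
      where
      i j : ℕ
      i = #[ I ]
      j = #[ T ─ I ]
      i+j≡t : i ℕ.+ j ≡ t
      i+j≡t = trans (sym (#-─ I⊆T)) #T
      i≤v : i ℕ.≤ v
      i≤v = Subset.∣p∣≤n I
      k∸t+j : k ∸ t ℕ.+ j ≡ k ∸ i
      k∸t+j = ∸-split t≤k i+j≡t
    weak : c t * E * abs (x T) ≤ fromℕ (2 ℕ.^ t) * (V * β)
    weak = begin
      c t * E * abs (x T)                                    ≡⟨ abs-* (x T) (*-nonNeg (fromℕ-nonNeg (extensions t (v ∸ t) k)) (↓-nonNeg (v ∸ k) t)) ⟨
      abs (c t * E * x T)                                    ≡⟨ cong (λ a → abs (c t * a ↓ t * x T)) w-m ⟨
      abs (c t * (w - m) ↓ t * x T)                          ≡⟨ cong abs (inversion k t t+t≤v x #T) ⟩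
      abs (∑⟨ _⊆? T ⟩ λ I → (- m) ↓ #[ T ─ I ] * w ↓ #[ I ] * Z I)   ≤⟨ ∑⟨⟩-abs (λ I → (- m) ↓ #[ T ─ I ] * w ↓ #[ I ] * Z I) ⟩
      (∑⟨ _⊆? T ⟩ λ I → abs ((- m) ↓ #[ T ─ I ] * w ↓ #[ I ] * Z I)) ≤⟨ ∑⟨⟩-mono termBound ⟩
      (∑⟨ _⊆? T ⟩ λ _ → V * β)                               ≡⟨ ∑-⊆-sizes T (λ _ _ → V * β) ⟩
      binomialSum #[ T ] (λ _ _ → V * β) 0 0                 ≡⟨ binomialSum-const #[ T ] (V * β) 0 0 ⟩
      fromℕ (2 ℕ.^ #[ T ]) * (V * β)                         ≡⟨ cong (λ s → fromℕ (2 ℕ.^ s) * (V * β)) #T ⟩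
      fromℕ (2 ℕ.^ t) * (V * β)                              ∎

  module _ (missing : Subset v → ℚ) (0≤missing : ∀ S → 0ℚ ≤ missing S) {q : ℚ} (0≤q : 0ℚ ≤ q)
    (sparse : ∀ S → #[ S ] ≡ t ∸ 1 → above t missing S ≤ q * fromℕ (suc (v ∸ t)))
    {T : Subset v} (#T : #[ T ] ≡ t) (present : missing T ≡ 0ℚ) where

    private
      N : Subset v → ℚ
      N = above t missing

      0≤N : ∀ J → 0ℚ ≤ N J
      0≤N J = ∑⟨⟩-nonNeg λ U _ → *-nonNeg (𝟙-nonNeg (J ⊆? U)) (0≤missing U)

    -- The proportion q passes from (t-1)-sets down to `J` by averaging over the (t-1)-sets above
    -- `J`. For m = 0 there are none; then J = T, and `present` makes the count zero.
    missing-bound : ∀ {J} → J ⊆ T → ∀ m → #[ T ─ J ] ≡ m →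
      fromℕ m ↓ m * N J ≤ q * fromℕ (v ∸ #[ J ]) ↓ m
    missing-bound {J} J⊆T zero #T─J = begin
      1ℚ * N J        ≡⟨ *-identityˡ (N J) ⟩
      N J             ≡⟨ cong N J≡T ⟩
      N T             ≡⟨ ∑-same-size missing #T ⟩
      missing T       ≡⟨ present ⟩
      0ℚ              ≤⟨ 0≤q ⟩
      q               ≡⟨ *-identityʳ q ⟨
      q * 1ℚ          ∎
      where
      open ≤-Reasoning
      J≡T : J ≡ T
      J≡T = ⊆∧#≡⇒≡ J⊆T (sym (trans (#-─ J⊆T) (trans (cong (#[ J ] ℕ.+_) #T─J) (ℕ.+-identityʳ #[ J ]))))
    missing-bound {J} J⊆T (suc m) #T─J = begin
      -- The last factor of (m + 1)↓(m + 1) is 1, so dropping it leaves the (t - |J|)↓m supplied by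
      -- averaging up to size t - 1.
      fromℕ (suc m) ↓ suc m * N J                     ≡⟨ cong (_* N J) (begin-equality
        fromℕ (suc m) ↓ m * (fromℕ (suc m) - fromℕ m)    ≡⟨ cong (fromℕ (suc m) ↓ m *_) (trans (cong (_- fromℕ m) (fromℕ-suc m)) (solve 1 (λ m → con 1ℚ :+ m :- m := con 1ℚ) refl (fromℕ m))) ⟩
        fromℕ (suc m) ↓ m * 1ℚ                           ≡⟨ *-identityʳ (fromℕ (suc m) ↓ m) ⟩
        fromℕ (suc m) ↓ m                                ≡⟨ cong (λ s → fromℕ s ↓ m) t∸#J ⟨
        fromℕ (t ∸ #[ J ]) ↓ m                           ∎) ⟩
      fromℕ (t ∸ #[ J ]) ↓ m * N J                    ≡⟨ cong (fromℕ (t ∸ #[ J ]) ↓ m *_) (0≤p⇒∣p∣≡p (0≤N J)) ⟨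
      fromℕ (t ∸ #[ J ]) ↓ m * abs (N J)              ≤⟨ averaging-bound t (t ∸ 1) missing J m #J+m (λ S #S → subst (_≤ β) (sym (0≤p⇒∣p∣≡p (0≤N S))) (sparse S #S)) ⟩
      fromℕ (v ∸ #[ J ]) ↓ m * (q * fromℕ (suc (v ∸ t)))  ≡⟨ solve 3 (λ a q b → a :* (q :* b) := q :* (a :* b)) refl (fromℕ (v ∸ #[ J ]) ↓ m) q (fromℕ (suc (v ∸ t))) ⟩
      -- v - t + 1 = v - |J| - m is the next factor, completing (v - |J|)↓(m + 1).
      q * (fromℕ (v ∸ #[ J ]) ↓ m * fromℕ (suc (v ∸ t)))  ≡⟨ cong (λ a → q * (fromℕ (v ∸ #[ J ]) ↓ m * a)) (trans (cong fromℕ 1+v∸t) (fromℕ-∸ m≤)) ⟩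
      q * (fromℕ (v ∸ #[ J ]) ↓ m * (fromℕ (v ∸ #[ J ]) - fromℕ m)) ∎
      where
      open ≤-Reasoning
      β = q * fromℕ (suc (v ∸ t))
      #J+suc-m : #[ J ] ℕ.+ suc m ≡ t
      #J+suc-m = trans (cong (#[ J ] ℕ.+_) (sym #T─J)) (trans (sym (#-─ J⊆T)) #T)
      #J+m : #[ J ] ℕ.+ m ≡ t ∸ 1
      #J+m = trans (cong (_∸ 1) (sym (ℕ.+-suc #[ J ] m))) (cong (_∸ 1) #J+suc-m)
      t∸#J : t ∸ #[ J ] ≡ suc m
      t∸#J = trans (cong (_∸ #[ J ]) (sym #J+suc-m)) (ℕ.m+n∸m≡n #[ J ] (suc m))
      suc-m≤ : suc m ℕ.≤ v ∸ #[ J ]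
      suc-m≤ = subst (ℕ._≤ v ∸ #[ J ]) t∸#J (ℕ.∸-monoˡ-≤ #[ J ] t≤v)
      m≤ : m ℕ.≤ v ∸ #[ J ]
      m≤ = ℕ.≤-trans (ℕ.n≤1+n m) suc-m≤
      1+v∸t : suc (v ∸ t) ≡ v ∸ #[ J ] ∸ m
      1+v∸t = trans (cong suc (trans (cong (v ∸_) (sym #J+suc-m)) (sym (ℕ.∸-+-assoc v #[ J ] (suc m)))))
        (sym (ℕ.+-∸-assoc 1 suc-m≤))

    -- The count of k-sets above t + m vertices shrinks by (k - t)↓m / (v - t)↓m, while
    -- `missing-bound` lets `N J` grow up to q (v - |J|)↓m / m!. As v - |J| = (v - t) + m, the
    -- powers of v cancel up to a ratio of at most 3/2.
    pair-bound : ∀ {J} → J ⊆ T → ∀ m → #[ T ─ J ] ≡ m →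
      fromℕ 2 * (c (t ℕ.+ m) * N J) ≤ fromℕ 3 * (q * c t) * fromℕ ((k ∸ t) C m)
    pair-bound {J} J⊆T m #T─J = *-cancelˡ 0<M*W (begin
      M * W * (fromℕ 2 * (c (t ℕ.+ m) * N J))   ≡⟨ solve 5 (λ M W a c N → M :* W :* (a :* (c :* N)) := a :* (M :* N :* (W :* c))) refl M W (fromℕ 2) (c (t ℕ.+ m)) (N J) ⟩
      fromℕ 2 * (M * N J * (W * c (t ℕ.+ m)))   ≡⟨ cong (λ a → fromℕ 2 * (M * N J * a)) ext ⟩
      fromℕ 2 * (M * N J * (M * B * c t))       ≤⟨ *-monoˡ (fromℕ-nonNeg 2) (*-monoʳ 0≤MBc (missing-bound J⊆T m #T─J)) ⟩
      fromℕ 2 * (q * V * (M * B * c t))         ≡⟨ solve 4 (λ a q V X → a :* (q :* V :* X) := q :* X :* (a :* V)) refl (fromℕ 2) q V (M * B * c t) ⟩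
      q * (M * B * c t) * (fromℕ 2 * V)         ≤⟨ *-monoˡ (*-nonNeg 0≤q 0≤MBc)
        (subst (λ s → fromℕ 2 * fromℕ s ↓ m ≤ fromℕ 3 * W) (sym v∸#J) (↓-ratio 1≤t m≤t large′)) ⟩
      q * (M * B * c t) * (fromℕ 3 * W)         ≡⟨ solve 6 (λ q M B c a W → q :* (M :* B :* c) :* (a :* W) := M :* W :* (a :* (q :* c) :* B)) refl q M B (c t) (fromℕ 3) W ⟩
      M * W * (fromℕ 3 * (q * c t) * B)         ∎)
      where
      open ≤-Reasoning
      M W B V : ℚ
      M = fromℕ m ↓ m
      W = fromℕ (v ∸ t) ↓ m
      B = fromℕ ((k ∸ t) C m)
      V = fromℕ (v ∸ #[ J ]) ↓ m
      #J+m : #[ J ] ℕ.+ m ≡ t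
      #J+m = trans (cong (#[ J ] ℕ.+_) (sym #T─J)) (trans (sym (#-─ J⊆T)) #T)
      m≤t : m ℕ.≤ t
      m≤t = subst (m ℕ.≤_) #J+m (ℕ.m≤n+m m #[ J ])
      0<M*W : 0ℚ < M * W
      0<M*W = *-pos (↓-pos {m} ℕ.≤-refl) (↓-pos (ℕ.≤-trans m≤t t≤v∸t))
      0≤MBc : 0ℚ ≤ M * B * c t
      0≤MBc = *-nonNeg (*-nonNeg (↓-nonNeg m m) (fromℕ-nonNeg ((k ∸ t) C m))) (fromℕ-nonNeg (extensions t (v ∸ t) k))
      v∸#J : v ∸ #[ J ] ≡ v ∸ t ℕ.+ m
      v∸#J = sym (∸-split t≤v #J+m)
      large′ : m ℕ.* (3 ℕ.* t) ℕ.+ t ℕ.≤ v ∸ t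
      large′ = ℕ.≤-trans (ℕ.+-monoˡ-≤ t (ℕ.*-monoˡ-≤ (3 ℕ.* t) (ℕ.≤-trans m≤t t≤k))) large-t
      ext : W * c (t ℕ.+ m) ≡ M * B * c t
      ext = begin-equality
        fromℕ (v ∸ t) ↓ m * c (t ℕ.+ m)           ≡⟨ cong (λ a → a ↓ m * c (t ℕ.+ m)) (fromℕ-∸ t≤v) ⟩
        (fromℕ v - fromℕ t) ↓ m * c (t ℕ.+ m)     ≡⟨ extensions-↓ t k m (ℕ.≤-trans (ℕ.+-monoʳ-≤ t m≤t) t+t≤v) ⟩
        (fromℕ k - fromℕ t) ↓ m * c t             ≡⟨ cong (λ a → a ↓ m * c t) (fromℕ-∸ t≤k) ⟨
        fromℕ (k ∸ t) ↓ m * c t                   ≡⟨ cong (_* c t) (↓-C (k ∸ t) m) ⟩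
        M * B * c t                               ∎

    -- Group the sets `U` by their trace J = T ∩ U, for which |T ─ U| = |T ─ J|, and then let `U`
    -- range over all t-sets containing `J`. Nonnegative weights make this relaxation an upper
    -- bound.
    collisions : (∑⟨ size? t ⟩ λ U → c (t ℕ.+ #[ T ─ U ]) * missing U) ≤
      (∑⟨ _⊆? T ⟩ λ J → c (t ℕ.+ #[ T ─ J ]) * N J)
    collisions = begin
      (∑⟨ size? t ⟩ λ U → e U * missing U)  ≤⟨ ∑⟨⟩-mono (λ U _ → *-monoʳ (0≤missing U) (begin
        e U                                     ≡⟨ cong (λ s → c (t ℕ.+ s)) (#[T─[T∩U]] T U) ⟨
        e (T ∩ U)                               ≡⟨ trans (cong (e (T ∩ U) *_) (𝟙-yes ((T ∩ U) ⊆? U) (Subset.p∩q⊆q T U))) (*-identityʳ (e (T ∩ U))) ⟨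
        e (T ∩ U) * 𝟙 ((T ∩ U) ⊆? U)            ≤⟨ term≤∑⟨⟩ (_⊆? T) (λ J _ → *-nonNeg (0≤e J) (𝟙-nonNeg (J ⊆? U))) (Subset.p∩q⊆p T U) ⟩
        (∑⟨ _⊆? T ⟩ λ J → e J * 𝟙 (J ⊆? U))     ∎)) ⟩
      (∑⟨ size? t ⟩ λ U → (∑⟨ _⊆? T ⟩ λ J → e J * 𝟙 (J ⊆? U)) * missing U)
        ≡⟨ ∑⟨⟩-cong (λ U _ → trans (*-comm _ (missing U)) (sym (∑⟨⟩-* (missing U) (λ J → e J * 𝟙 (J ⊆? U))))) ⟩
      (∑⟨ size? t ⟩ λ U → ∑⟨ _⊆? T ⟩ λ J → missing U * (e J * 𝟙 (J ⊆? U)))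
        ≡⟨ ∑⟨⟩-comm (λ U J → missing U * (e J * 𝟙 (J ⊆? U))) ⟩
      (∑⟨ _⊆? T ⟩ λ J → ∑⟨ size? t ⟩ λ U → missing U * (e J * 𝟙 (J ⊆? U)))
        ≡⟨ ∑⟨⟩-cong (λ J _ → trans
          (∑⟨⟩-cong λ U _ → solve 3 (λ a b c → a :* (b :* c) := b :* (c :* a)) refl (missing U) (e J) (𝟙 (J ⊆? U)))
          (∑⟨⟩-* (e J) (λ U → 𝟙 (J ⊆? U) * missing U))) ⟩
      (∑⟨ _⊆? T ⟩ λ J → e J * N J) ∎
      where
      open ≤-Reasoning
      e : Subset v → ℚ
      e J = c (t ℕ.+ #[ T ─ J ])
      0≤e : ∀ J → 0ℚ ≤ e J
      0≤e J = fromℕ-nonNeg (extensions (t ℕ.+ #[ T ─ J ]) (v ∸ (t ℕ.+ #[ T ─ J ])) k)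

    -- When `missing` is an indicator, each k-set over `T` is weighted by the number of its missing
    -- t-subsets, so this controls the k-sets over `T` that fail to be cliques.
    missing-total : fromℕ 2 * above k (below t missing) T ≤ fromℕ 3 * (q * c t) * fromℕ (k C t)
    missing-total = begin
      fromℕ 2 * above k (below t missing) T      ≡⟨ cong (fromℕ 2 *_) (above-below k t missing T) ⟩
      fromℕ 2 * (∑⟨ size? t ⟩ λ U → c (t ℕ.+ #[ T ─ U ]) * missing U)
                                                 ≤⟨ *-monoˡ (fromℕ-nonNeg 2) collisions ⟩
      fromℕ 2 * (∑⟨ _⊆? T ⟩ λ J → c (t ℕ.+ #[ T ─ J ]) * N J)
                                                 ≡⟨ ∑⟨⟩-* (fromℕ 2) (λ J → c (t ℕ.+ #[ T ─ J ]) * N J) ⟨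
      (∑⟨ _⊆? T ⟩ λ J → fromℕ 2 * (c (t ℕ.+ #[ T ─ J ]) * N J))
                                                 ≤⟨ ∑⟨⟩-mono (λ J J⊆T → pair-bound J⊆T #[ T ─ J ] refl) ⟩
      (∑⟨ _⊆? T ⟩ λ J → r * fromℕ ((k ∸ t) C #[ T ─ J ])) ≡⟨ ∑⟨⟩-* r (λ J → fromℕ ((k ∸ t) C #[ T ─ J ])) ⟩
      -- A t-subset of a k-set containing `T` consists of its trace `J` on `T` and |T ─ J| of the k
      -- - t remaining vertices, so these binomials add up to C(k,t).
      r * (∑⟨ _⊆? T ⟩ λ J → fromℕ ((k ∸ t) C #[ T ─ J ])) ≡⟨ cong (r *_) (begin-equality
        (∑⟨ _⊆? T ⟩ λ J → fromℕ ((k ∸ t) C #[ T ─ J ]))      ≡⟨ ∑-⊆-sizes T (λ j _ → fromℕ ((k ∸ t) C j)) ⟩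
        binomialSum #[ T ] (λ j _ → fromℕ ((k ∸ t) C j)) 0 0 ≡⟨ binomialSum-C #[ T ] (k ∸ t) 0 0 ⟩
        fromℕ ((k ∸ t ℕ.+ #[ T ]) C #[ T ])                  ≡⟨ cong (λ s → fromℕ ((k ∸ t ℕ.+ s) C s)) #T ⟩
        fromℕ ((k ∸ t ℕ.+ t) C t)                            ≡⟨ cong (λ s → fromℕ (s C t)) (ℕ.m∸n+n≡m t≤k) ⟩
        fromℕ (k C t)                                        ∎) ⟩
      r * fromℕ (k C t) ∎
      where
      open ≤-Reasoning
      r = fromℕ 3 * (q * c t)

-- Injective square matrices are surjective

sum-* : ∀ {n} c (x : Vector ℚ n) → sum (λ j → c * x j) ≡ c * sum x
sum-* {zero}  c x = sym (*-zeroʳ c)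
sum-* {suc n} c x = trans (cong (c * x zero +_) (sum-* c (x ∘ suc)))
  (sym (*-distribˡ-+ c (x zero) (sum (x ∘ suc))))

Matrix : ℕ → Set
Matrix n = Fin n → Fin n → ℚ

infixr 7 _∙_

_∙_ : ∀ {n} → Matrix n → Vector ℚ n → Vector ℚ n
(A ∙ x) i = sum λ j → A i j * x j

-- Gaussian elimination. If the first column vanishes, the first unit vector lies in the kernel.
-- Otherwise a nonzero pivot leaves a smaller matrix `A′` whose kernel vectors extend to kernel
-- vectors of `A`, so `A′` is injective as well and the induction applies to it.
injective⇒surjective : ∀ {n} (A : Matrix n) →
  (∀ x → (∀ i → (A ∙ x) i ≡ 0ℚ) → ∀ j → x j ≡ 0ℚ) →
  ∀ (b : Vector ℚ n) → ∃ λ x → ∀ i → (A ∙ x) i ≡ b i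
injective⇒surjective {zero}  A inj b = (λ ()) , λ ()
injective⇒surjective {suc n} A inj b with Fin.any? (λ i → ¬? (A i zero ≟ 0ℚ))
... | no noPivot = contradiction (inj e₀ Ae₀≡0 zero) 1≢0
  where
  e₀ : Vector ℚ (suc n)
  e₀ zero    = 1ℚ
  e₀ (suc _) = 0ℚ
  Ae₀≡0 : ∀ i → (A ∙ e₀) i ≡ 0ℚ
  Ae₀≡0 i = begin
    A i zero * 1ℚ + sum (λ j → A i (suc j) * 0ℚ)  ≡⟨ cong₂ (λ a s → a * 1ℚ + s)
      (decidable-stable (A i zero ≟ 0ℚ) (λ Ai0≢0 → noPivot (i , Ai0≢0)))
      (trans (sum-cong-≗ (λ j → *-zeroʳ (A i (suc j)))) (sum-replicate-zero n)) ⟩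
    0ℚ * 1ℚ + 0ℚ                                  ≡⟨⟩
    0ℚ                                            ∎
    where open ≡-Reasoning
... | yes (p , α≢0) = x , Ax≡b
  where
  instance
    α-nonZero : NonZero (A p zero)
    α-nonZero = ≢-nonZero α≢0
  α⁻¹ : ℚ
  α⁻¹ = 1/ A p zero
  scale : Fin n → ℚ
  scale r = A (punchIn p r) zero * α⁻¹
  A′ : Matrix n
  A′ r j = A (punchIn p r) (suc j) + (- scale r) * A p (suc j)
  tailRow : Vector ℚ n → Fin (suc n) → ℚ
  tailRow x′ i = sum λ j → A i (suc j) * x′ j
  -- The pivot row with right-hand side `β` determines the first unknown from the others.
  extend : ℚ → Vector ℚ n → Vector ℚ (suc n)
  extend β x′ zero    = α⁻¹ * (β - tailRow x′ p)
  extend β x′ (suc j) = x′ j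
  A′∙ : ∀ x′ r → (A′ ∙ x′) r ≡ tailRow x′ (punchIn p r) + (- scale r) * tailRow x′ p
  A′∙ x′ r = begin
    sum (λ j → A′ r j * x′ j)
      ≡⟨ sum-cong-≗ (λ j → solve 4 (λ a s c x → (a :+ s :* c) :* x := a :* x :+ s :* (c :* x)) refl
           (A (punchIn p r) (suc j)) (- scale r) (A p (suc j)) (x′ j)) ⟩
    sum (λ j → A (punchIn p r) (suc j) * x′ j + (- scale r) * (A p (suc j) * x′ j))
      ≡⟨ ∑-distrib-+ (λ j → A (punchIn p r) (suc j) * x′ j) (λ j → (- scale r) * (A p (suc j) * x′ j)) ⟩
    tailRow x′ (punchIn p r) + sum (λ j → (- scale r) * (A p (suc j) * x′ j))
      ≡⟨ cong (tailRow x′ (punchIn p r) +_) (sum-* (- scale r) (λ j → A p (suc j) * x′ j)) ⟩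
    tailRow x′ (punchIn p r) + (- scale r) * tailRow x′ p ∎
    where open ≡-Reasoning
  pivotRow : ∀ β x′ → (A ∙ extend β x′) p ≡ β
  pivotRow β x′ = begin
    A p zero * (α⁻¹ * (β - s)) + s  ≡⟨ solve 4 (λ a i b s → a :* (i :* (b :- s)) :+ s := a :* i :* (b :- s) :+ s) refl (A p zero) α⁻¹ β s ⟩
    A p zero * α⁻¹ * (β - s) + s    ≡⟨ cong (λ u → u * (β - s) + s) (*-inverseʳ (A p zero)) ⟩
    1ℚ * (β - s) + s                ≡⟨ solve 2 (λ b s → con 1ℚ :* (b :- s) :+ s := b) refl β s ⟩
    β                               ∎
    where
    open ≡-Reasoning
    s = tailRow x′ p
  otherRow : ∀ β x′ r → (A ∙ extend β x′) (punchIn p r) ≡ scale r * β + (A′ ∙ x′) r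
  otherRow β x′ r = begin
    a * (α⁻¹ * (β - s)) + s′              ≡⟨ solve 5 (λ a i b s s′ → a :* (i :* (b :- s)) :+ s′ := a :* i :* b :+ (s′ :+ (:- (a :* i)) :* s)) refl a α⁻¹ β s s′ ⟩
    scale r * β + (s′ + (- scale r) * s)  ≡⟨ cong (scale r * β +_) (A′∙ x′ r) ⟨
    scale r * β + (A′ ∙ x′) r             ∎
    where
    open ≡-Reasoning
    a = A (punchIn p r) zero
    s = tailRow x′ p
    s′ = tailRow x′ (punchIn p r)
  allRows : ∀ {x} (c : Vector ℚ (suc n)) → x p ≡ c p → (∀ r → x (punchIn p r) ≡ c (punchIn p r)) → ∀ i → x i ≡ c i
  allRows {x} c atP others i with p Fin.≟ i
  ... | yes refl = atP
  ... | no p≢i   = subst (λ i → x i ≡ c i) (Fin.punchIn-punchOut p≢i) (others (punchOut p≢i))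
  A′-injective : ∀ x′ → (∀ r → (A′ ∙ x′) r ≡ 0ℚ) → ∀ j → x′ j ≡ 0ℚ
  A′-injective x′ A′x′≡0 j = inj (extend 0ℚ x′)
    (allRows {A ∙ extend 0ℚ x′} (λ _ → 0ℚ) (pivotRow 0ℚ x′) λ r → begin
      (A ∙ extend 0ℚ x′) (punchIn p r)  ≡⟨ otherRow 0ℚ x′ r ⟩
      scale r * 0ℚ + (A′ ∙ x′) r        ≡⟨ cong₂ _+_ (*-zeroʳ (scale r)) (A′x′≡0 r) ⟩
      0ℚ                                ∎)
    (suc j)
    where open ≡-Reasoning
  solution : ∃ λ x′ → ∀ r → (A′ ∙ x′) r ≡ b (punchIn p r) - scale r * b p
  solution = injective⇒surjective A′ A′-injective λ r → b (punchIn p r) - scale r * b p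
  x : Vector ℚ (suc n)
  x = extend (b p) (proj₁ solution)
  Ax≡b : ∀ i → (A ∙ x) i ≡ b i
  Ax≡b = allRows {A ∙ x} b (pivotRow (b p) (proj₁ solution)) λ r → begin
    (A ∙ x) (punchIn p r)                                  ≡⟨ otherRow (b p) (proj₁ solution) r ⟩
    scale r * b p + (A′ ∙ proj₁ solution) r                ≡⟨ cong (scale r * b p +_) (proj₂ solution r) ⟩
    scale r * b p + (b (punchIn p r) - scale r * b p)      ≡⟨ solve 2 (λ s b → s :+ (b :- s) := b) refl (scale r * b p) (b (punchIn p r)) ⟩
    b (punchIn p r)                                        ∎
    where open ≡-Reasoning

-- Sums over enumerated subsets

listSum : ∀ {A : Set} → (A → ℚ) → List A → ℚ
listSum f = foldr (λ x s → f x + s) 0ℚ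

sum-lookup : ∀ {A : Set} (f : A → ℚ) xs → sum (λ i → f (lookup xs i)) ≡ listSum f xs
sum-lookup f []       = refl
sum-lookup f (x ∷ xs) = cong (f x +_) (sum-lookup f xs)

listSum-++ : ∀ {A : Set} (f : A → ℚ) xs ys → listSum f (xs ++ ys) ≡ listSum f xs + listSum f ys
listSum-++ f []       ys = sym (+-identityˡ (listSum f ys))
listSum-++ f (x ∷ xs) ys = trans (cong (f x +_) (listSum-++ f xs ys)) (sym (+-assoc (f x) (listSum f xs) (listSum f ys)))

listSum-map : ∀ {A B : Set} (f : B → ℚ) (g : A → B) xs → listSum f (map g xs) ≡ listSum (f ∘ g) xs
listSum-map f g []       = refl
listSum-map f g (x ∷ xs) = cong (f (g x) +_) (listSum-map f g xs)

listSum-filter : ∀ {A : Set} {P : Pred A 0ℓ} (P? : Decidable P) (f : A → ℚ) xs →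
  listSum f (filter P? xs) ≡ listSum (λ x → 𝟙 (P? x) * f x) xs
listSum-filter P? f [] = refl
listSum-filter P? f (x ∷ xs) with P? x
... | yes _ = cong₂ _+_ (sym (*-identityˡ (f x))) (listSum-filter P? f xs)
... | no _  = trans (listSum-filter P? f xs)
  (sym (trans (cong (_+ rest) (*-zeroˡ (f x))) (+-identityˡ rest)))
  where rest = listSum (λ x → 𝟙 (P? x) * f x) xs

listSum-subsets : ∀ {n} (f : Subset n → ℚ) → listSum f (subsets n) ≡ ∑ f
listSum-subsets {zero}  f = trans (+-identityʳ (f [])) (sym (∑-[] f))
listSum-subsets {suc n} f = begin
  listSum f (map (inside ∷_) (subsets n) ++ map (outside ∷_) (subsets n))
    ≡⟨ listSum-++ f (map (inside ∷_) (subsets n)) (map (outside ∷_) (subsets n)) ⟩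
  listSum f (map (inside ∷_) (subsets n)) + listSum f (map (outside ∷_) (subsets n))
    ≡⟨ cong₂ _+_ (listSum-map f (inside ∷_) (subsets n)) (listSum-map f (outside ∷_) (subsets n)) ⟩
  listSum (λ S → f (inside ∷ S)) (subsets n) + listSum (λ S → f (outside ∷ S)) (subsets n)
    ≡⟨ cong₂ _+_ (listSum-subsets (λ S → f (inside ∷ S))) (listSum-subsets (λ S → f (outside ∷ S))) ⟩
  ∑ (λ S → f (inside ∷ S)) + ∑ (λ S → f (outside ∷ S))
    ≡⟨ ∑-∷ f ⟨
  ∑ f ∎
  where open ≡-Reasoning

fromℕ-length : ∀ {A : Set} (xs : List A) → fromℕ (length xs) ≡ listSum (λ _ → 1ℚ) xs
fromℕ-length []       = refl
fromℕ-length (x ∷ xs) = trans (fromℕ-suc (length xs)) (cong (1ℚ +_) (fromℕ-length xs))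

∈-subsets : ∀ {n} (S : Subset n) → S ∈ₗ subsets n
∈-subsets []            = Any.here refl
∈-subsets (inside  ∷ S) = ∈-++⁺ˡ (∈-map⁺ (inside ∷_) (∈-subsets S))
∈-subsets (outside ∷ S) = ∈-++⁺ʳ (map (inside ∷_) (subsets _)) (∈-map⁺ (outside ∷_) (∈-subsets S))

subsets-unique : ∀ n → Unique (subsets n)
subsets-unique zero    = All.[] ∷ []
subsets-unique (suc n) = Unique.++⁺
  (Unique.map⁺ Vec.∷-injectiveʳ (subsets-unique n))
  (Unique.map⁺ Vec.∷-injectiveʳ (subsets-unique n))
  λ (S∈i , S∈o) → case-disjoint (∈-map⁻ (inside ∷_) S∈i) (∈-map⁻ (outside ∷_) S∈o)
  where
  open import Data.Empty using (⊥)
  case-disjoint : ∀ {S : Subset (suc n)} →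
    (∃ λ S′ → S′ ∈ₗ subsets n × S ≡ inside ∷ S′) → (∃ λ S′ → S′ ∈ₗ subsets n × S ≡ outside ∷ S′) → ⊥
  case-disjoint (_ , _ , refl) (_ , _ , ())

lookup-injective : ∀ {A : Set} {xs : List A} → Unique xs → ∀ i j → lookup xs i ≡ lookup xs j → i ≡ j
lookup-injective (x∉xs ∷ uniq) zero    zero    eq = refl
lookup-injective (x∉xs ∷ uniq) zero    (suc j) eq = contradiction eq (All.lookup x∉xs (∈-lookup j))
lookup-injective (x∉xs ∷ uniq) (suc i) zero    eq = contradiction (sym eq) (All.lookup x∉xs (∈-lookup i))
lookup-injective (x∉xs ∷ uniq) (suc i) (suc j) eq = cong suc (lookup-injective uniq i j eq)

module _ {v : ℕ} {P : Pred (Subset v) 0ℓ} (P? : Decidable P) where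

  private
    xs : List (Subset v)
    xs = filter P? (subsets v)

  sum-subsets : (f : Subset v → ℚ) → sum (λ i → f (lookup xs i)) ≡ (∑⟨ P? ⟩ f)
  sum-subsets f = begin
    sum (λ i → f (lookup xs i))                  ≡⟨ sum-lookup f xs ⟩
    listSum f xs                                 ≡⟨ listSum-filter P? f (subsets v) ⟩
    listSum (λ S → 𝟙 (P? S) * f S) (subsets v)   ≡⟨ listSum-subsets (λ S → 𝟙 (P? S) * f S) ⟩
    ∑ (λ S → 𝟙 (P? S) * f S)                     ≡⟨ ∑⟨⟩-def P? f ⟨
    (∑⟨ P? ⟩ f)                                  ∎
    where open ≡-Reasoning

  fromℕ-countSubsets : fromℕ (countSubsets P?) ≡ (∑⟨ P? ⟩ λ _ → 1ℚ)
  fromℕ-countSubsets = trans (fromℕ-length xs)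
    (trans (sym (sum-lookup (λ _ → 1ℚ) xs)) (sum-subsets (λ _ → 1ℚ)))

  lookup-satisfies : ∀ i → P (lookup xs i)
  lookup-satisfies i = proj₂ (∈-filter⁻ P? {xs = subsets v} (∈-lookup i))

  lookup-filter-injective : ∀ i j → lookup xs i ≡ lookup xs j → i ≡ j
  lookup-filter-injective = lookup-injective (Unique.filter⁺ P? (subsets-unique v))

  private
    position : ∀ {S} → P S → Fin (length xs)
    position {S} PS = index (∈-filter⁺ P? (∈-subsets S) PS)

    extend : Vector ℚ (length xs) → Subset v → ℚ
    extend y S with P? S
    ... | yes PS = y (position PS)
    -- An arbitrary value: sums restricted to `P` weight it by zero.
    ... | no _   = 0ℚ

    extend-lookup : ∀ y i → extend y (lookup xs i) ≡ y i
    extend-lookup y i with P? (lookup xs i)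
    ... | yes PS = cong y (lookup-filter-injective (position PS) i
                     (sym (lookup-index (∈-filter⁺ P? (∈-subsets (lookup xs i)) PS))))
    ... | no ¬PS = contradiction (lookup-satisfies i) ¬PS

  -- The positions in the filtered list are in bijection with the subsets satisfying `P`, so the
  -- square-matrix result carries over to systems indexed by subsets.
  injective-system-solvable : (A : Subset v → Subset v → ℚ) →
    (∀ x → (∀ T → P T → (∑⟨ P? ⟩ λ U → A T U * x U) ≡ 0ℚ) → ∀ U → P U → x U ≡ 0ℚ) →
    ∀ c → ∃ λ x → ∀ T → P T → (∑⟨ P? ⟩ λ U → A T U * x U) ≡ c
  injective-system-solvable A inj c = extend y , λ T PT → begin
    (∑⟨ P? ⟩ λ U → A T U * extend y U)  ≡⟨ cong (λ T → ∑⟨ P? ⟩ λ U → A T U * extend y U) (lookup-index (∈-filter⁺ P? (∈-subsets T) PT)) ⟩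
    (∑⟨ P? ⟩ λ U → A (lookup xs (position PT)) U * extend y U)  ≡⟨ row y (position PT) ⟨
    (B ∙ y) (position PT)               ≡⟨ proj₂ solution (position PT) ⟩
    c                                   ∎
    where
    open ≡-Reasoning
    B : Matrix (length xs)
    B i j = A (lookup xs i) (lookup xs j)
    row : ∀ y i → (B ∙ y) i ≡ (∑⟨ P? ⟩ λ U → A (lookup xs i) U * extend y U)
    row y i = trans
      (sum-cong-≗ λ j → cong (B i j *_) (sym (extend-lookup y j)))
      (sum-subsets λ U → A (lookup xs i) U * extend y U)
    B-injective : ∀ y → (∀ i → (B ∙ y) i ≡ 0ℚ) → ∀ j → y j ≡ 0ℚ
    B-injective y By≡0 j = trans (sym (extend-lookup y j)) (inj (extend y) (λ T PT → begin
      (∑⟨ P? ⟩ λ U → A T U * extend y U)  ≡⟨ cong (λ T → ∑⟨ P? ⟩ λ U → A T U * extend y U) (lookup-index (∈-filter⁺ P? (∈-subsets T) PT)) ⟩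
      (∑⟨ P? ⟩ λ U → A (lookup xs (position PT)) U * extend y U)  ≡⟨ row y (position PT) ⟨
      (B ∙ y) (position PT)               ≡⟨ By≡0 (position PT) ⟩
      0ℚ                                  ∎) (lookup xs j) (lookup-satisfies j))
    solution : ∃ λ y → ∀ i → (B ∙ y) i ≡ c
    solution = injective⇒surjective B B-injective (λ _ → c)
    y = proj₁ solution

argmax : ∀ {n} (f : Subset n → ℚ) → ∃ λ S → ∀ U → f U ≤ f S
argmax {zero}  f = [] , λ { [] → ≤-refl }
argmax {suc n} f with argmax (λ S → f (inside ∷ S)) | argmax (λ S → f (outside ∷ S))
... | Sᵢ , maxᵢ | Sₒ , maxₒ with ≤-total (f (inside ∷ Sᵢ)) (f (outside ∷ Sₒ))
... | inj₁ i≤o = outside ∷ Sₒ , λ { (inside ∷ U) → ≤-trans (maxᵢ U) i≤o ; (outside ∷ U) → maxₒ U }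
... | inj₂ o≤i = inside ∷ Sᵢ , λ { (inside ∷ U) → maxᵢ U ; (outside ∷ U) → ≤-trans (maxₒ U) o≤i }

-- The clique matrix as a perturbation of the complete one

-- Removing 9 · 2² = 4 · 3² = 36 leaves 2^s ≤ 3^s. The inequality says that (3/2)² 2^t ≤ 3^t, with
-- equality at t = 2, and it is what requires t to be at least 2.
9*2^t≤4*3^t : ∀ {t} → 2 ℕ.≤ t → 9 ℕ.* 2 ℕ.^ t ℕ.≤ 4 ℕ.* 3 ℕ.^ t
9*2^t≤4*3^t {suc (suc s)} (ℕ.s≤s (ℕ.s≤s ℕ.z≤n)) = begin
  9 ℕ.* (2 ℕ.* (2 ℕ.* 2 ℕ.^ s))  ≡⟨ trans (sym (ℕ.*-assoc 9 2 (2 ℕ.* 2 ℕ.^ s))) (sym (ℕ.*-assoc 18 2 (2 ℕ.^ s))) ⟩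
  36 ℕ.* 2 ℕ.^ s                 ≤⟨ ℕ.*-monoʳ-≤ 36 (ℕ.^-monoˡ-≤ s (ℕ.n≤1+n 2)) ⟩
  36 ℕ.* 3 ℕ.^ s                 ≡⟨ trans (sym (ℕ.*-assoc 4 3 (3 ℕ.* 3 ℕ.^ s))) (sym (ℕ.*-assoc 12 3 (3 ℕ.^ s))) ⟨
  4 ℕ.* (3 ℕ.* (3 ℕ.* 3 ℕ.^ s))  ∎
  where open ℕ.≤-Reasoning

½+½ : ∀ p → fromℕ 2 * (½ * p) ≡ p
½+½ p = solve 1 (λ p → con (fromℕ 2) :* (con ½ :* p) := p) refl p

extensions≡C : ∀ {v k t} → t ℕ.≤ k → extensions t (v ∸ t) k ≡ (v ∸ t) C (k ∸ t)
extensions≡C {v} {k} {t} t≤k = trans (cong (extensions t (v ∸ t)) (sym (ℕ.m+[n∸m]≡n t≤k))) (extensions-+ t (v ∸ t) (k ∸ t))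

C-pos : ∀ {n k} → k ℕ.≤ n → 0ℚ < fromℕ (n C k)
C-pos {n} {k} k≤n = fromℕ-pos (ℕ.>-nonZero⁻¹ (n C k) {{C-nonZero k≤n}})

above-* : ∀ {v} k c (z : Subset v → ℚ) I → above k (λ K → c * z K) I ≡ c * above k z I
above-* k c z I = trans
  (∑⟨⟩-cong λ K _ → solve 3 (λ a c z → a :* (c :* z) := c :* (a :* z)) refl (𝟙 (I ⊆? K)) c (z K))
  (∑⟨⟩-* c (λ K → 𝟙 (I ⊆? K) * z K))

above-const : ∀ {v} k c (I : Subset v) → above k (λ _ → c) I ≡ c * fromℕ (extensions #[ I ] (v ∸ #[ I ]) k)
above-const {v} k c I = begin
  (∑⟨ size? k ⟩ λ K → 𝟙 (I ⊆? K) * c)  ≡⟨ ∑⟨⟩-cong (λ K _ → *-comm (𝟙 (I ⊆? K)) c) ⟩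
  (∑⟨ size? k ⟩ λ K → c * 𝟙 (I ⊆? K))  ≡⟨ ∑⟨⟩-* c (λ K → 𝟙 (I ⊆? K)) ⟩
  c * (∑⟨ size? k ⟩ λ K → 𝟙 (I ⊆? K))  ≡⟨ cong (c *_) (count-above I k) ⟩
  c * fromℕ (extensions #[ I ] (v ∸ #[ I ]) k) ∎
  where open ≡-Reasoning

above-+ : ∀ {v} k (y z : Subset v → ℚ) I → above k (λ K → y K + z K) I ≡ above k y I + above k z I
above-+ k y z I = trans (∑⟨⟩-cong λ K _ → *-distribˡ-+ (𝟙 (I ⊆? K)) (y K) (z K))
  (∑⟨⟩-+ (λ K → 𝟙 (I ⊆? K) * y K) (λ K → 𝟙 (I ⊆? K) * z K))

above-cong : ∀ {v k} {y z : Subset v → ℚ} {I} → (∀ K → #[ K ] ≡ k → y K ≡ z K) → above k y I ≡ above k z I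
above-cong {I = I} y≡z = ∑⟨⟩-cong λ K #K → cong (𝟙 (I ⊆? K) *_) (y≡z K #K)

above-abs : ∀ {v k} {y z : Subset v → ℚ} {I} → (∀ K → #[ K ] ≡ k → abs (y K) ≤ z K) →
  abs (above k y I) ≤ above k z I
above-abs {k = k} {y} {z} {I} y≤z = ≤-trans (∑⟨⟩-abs λ K → 𝟙 (I ⊆? K) * y K)
  (∑⟨⟩-mono λ K #K → ≤-trans (≤-reflexive (abs-* (y K) (𝟙-nonNeg (I ⊆? K))))
    (*-monoˡ (𝟙-nonNeg (I ⊆? K)) (y≤z K #K)))

below-abs : ∀ {v} t (x : Subset v → ℚ) {μ} → (∀ U → #[ U ] ≡ t → abs (x U) ≤ μ) →
  ∀ K → abs (below t x K) ≤ fromℕ (#[ K ] C t) * μ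
below-abs t x {μ} x≤μ K = begin
  abs (below t x K)                          ≤⟨ ∑⟨⟩-abs (λ U → 𝟙 (U ⊆? K) * x U) ⟩
  (∑⟨ size? t ⟩ λ U → abs (𝟙 (U ⊆? K) * x U)) ≤⟨ ∑⟨⟩-mono (λ U #U → begin
    abs (𝟙 (U ⊆? K) * x U)  ≡⟨ abs-* (x U) (𝟙-nonNeg (U ⊆? K)) ⟩
    𝟙 (U ⊆? K) * abs (x U)  ≤⟨ *-monoˡ (𝟙-nonNeg (U ⊆? K)) (x≤μ U #U) ⟩
    𝟙 (U ⊆? K) * μ          ≡⟨ *-comm (𝟙 (U ⊆? K)) μ ⟩
    μ * 𝟙 (U ⊆? K)          ∎) ⟩
  (∑⟨ size? t ⟩ λ U → μ * 𝟙 (U ⊆? K))        ≡⟨ ∑⟨⟩-* μ (λ U → 𝟙 (U ⊆? K)) ⟩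
  μ * (∑⟨ size? t ⟩ λ U → 𝟙 (U ⊆? K))        ≡⟨ cong (μ *_) (count-below K t) ⟩
  μ * fromℕ (#[ K ] C t)                     ≡⟨ *-comm μ (fromℕ (#[ K ] C t)) ⟩
  fromℕ (#[ K ] C t) * μ                     ∎
  where open ≤-Reasoning

below-shift : ∀ {v} t (x : Subset v → ℚ) κ K →
  below t (λ U → x U - κ) K ≡ below t x K + - (κ * fromℕ (#[ K ] C t))
below-shift t x κ K = begin
  (∑⟨ size? t ⟩ λ U → 𝟙 (U ⊆? K) * (x U - κ))
    ≡⟨ ∑⟨⟩-cong (λ U _ → solve 3 (λ a x κ → a :* (x :- κ) := a :* x :+ (:- κ) :* a) refl (𝟙 (U ⊆? K)) (x U) κ) ⟩
  (∑⟨ size? t ⟩ λ U → 𝟙 (U ⊆? K) * x U + (- κ) * 𝟙 (U ⊆? K))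
    ≡⟨ ∑⟨⟩-+ (λ U → 𝟙 (U ⊆? K) * x U) (λ U → (- κ) * 𝟙 (U ⊆? K)) ⟩
  below t x K + (∑⟨ size? t ⟩ λ U → (- κ) * 𝟙 (U ⊆? K))
    ≡⟨ cong (below t x K +_) (trans (∑⟨⟩-* (- κ) (λ U → 𝟙 (U ⊆? K))) (cong ((- κ) *_) (count-below K t))) ⟩
  below t x K + (- κ) * fromℕ (#[ K ] C t)
    ≡⟨ cong (below t x K +_) (neg-distribˡ-* κ (fromℕ (#[ K ] C t))) ⟨
  below t x K + - (κ * fromℕ (#[ K ] C t)) ∎
  where open ≡-Reasoning

-- Rows of edges count cliques; rows of non-edges count all k-sets, which makes
-- the extension of M̂ to all t-subsets close to the matrix of the complete graph.
module Perturbation {v k t : ℕ} (2≤t : 2 ℕ.≤ t) (t≤k : t ℕ.≤ k) (large : k ℕ.* (3 ℕ.* t) ℕ.+ t ℕ.+ k ℕ.≤ v)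
  (G : TGraph t v) {q : ℚ} (0≤q : 0ℚ ≤ q)
  (sparse : ∀ S → #[ S ] ≡ t ∸ 1 → above t (λ U → 𝟙 (¬? (Edge? G U))) S ≤ q * fromℕ (suc (v ∸ t)))
  where

  c B : ℚ
  c = fromℕ (extensions t (v ∸ t) k)
  B = fromℕ (k C t)

  a : ℚ
  a = fromℕ (3 ℕ.^ t) * (B * B) * q

  missing : Subset v → ℚ
  missing U = 𝟙 (¬? (Edge? G U))

  cliqueWeight : Subset v → Subset v → ℚ
  cliqueWeight T K = if does (Edge? G T) then 𝟙 (inducesClique? G K) else 1ℚ

  defect : Subset v → Subset v → ℚ
  defect T K = if does (Edge? G T) then 𝟙 (¬? (inducesClique? G K)) else 0ℚ

  row : (Subset v → ℚ) → Subset v → ℚ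
  row x T = above k (λ K → cliqueWeight T K * below t x K) T

  private
    0<c : 0ℚ < c
    0<c = subst (λ e → 0ℚ < fromℕ e) (sym (extensions≡C t≤k)) (C-pos (ℕ.∸-monoˡ-≤ t (ℕ.≤-trans (ℕ.m≤n+m k (k ℕ.* (3 ℕ.* t) ℕ.+ t)) large)))

    0≤B : 0ℚ ≤ B
    0≤B = fromℕ-nonNeg (k C t)

    weight+defect : ∀ T K → cliqueWeight T K + defect T K ≡ 1ℚ
    weight+defect T K with does (Edge? G T)
    ... | true  = 𝟙-¬ (inducesClique? G K)
    ... | false = refl

    -- Union bound: a set that is not a clique contains a t-subset that is a non-edge, and this one
    -- already contributes 1 on the right.
    defect≤missing : ∀ K → 𝟙 (¬? (inducesClique? G K)) ≤ below t missing K
    defect≤missing K with Subset.anySubset? (λ U → (U ⊆? K) ×-dec (size? t U ×-dec ¬? (Edge? G U)))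
    ... | yes (U , U⊆K , #U , ¬edge) = begin
      𝟙 (¬? (inducesClique? G K))              ≤⟨ 𝟙≤1 (¬? (inducesClique? G K)) ⟩
      1ℚ                                       ≡⟨ cong₂ _*_ (𝟙-yes (U ⊆? K) U⊆K) (𝟙-yes (¬? (Edge? G U)) ¬edge) ⟨
      𝟙 (U ⊆? K) * 𝟙 (¬? (Edge? G U))          ≤⟨ term≤∑⟨⟩ (size? t) (λ U _ → *-nonNeg (𝟙-nonNeg (U ⊆? K)) (𝟙-nonNeg (¬? (Edge? G U)))) {U} #U ⟩
      below t missing K                        ∎
      where
      open ≤-Reasoning
    ... | no ∄ = ≤-trans
      (≤-reflexive (𝟙-no (¬? (inducesClique? G K)) λ ¬clique → ¬clique λ U U⊆K #U →
        decidable-stable (Edge? G U) λ ¬edge → ∄ (U , (λ {x} → U⊆K {x}) , #U , ¬edge)))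
      (∑⟨⟩-nonNeg λ U _ → *-nonNeg (𝟙-nonNeg (U ⊆? K)) (𝟙-nonNeg (¬? (Edge? G U))))

    0≤defect : ∀ T K → 0ℚ ≤ defect T K
    0≤defect T K with does (Edge? G T)
    ... | true  = 𝟙-nonNeg (¬? (inducesClique? G K))
    ... | false = ≤-refl

    -- `missing-total` requires `T` itself to be present, so it serves the rows of edges. The rows
    -- of non-edges have no defect, which is the reason for giving them complete rows.
    defect-total : ∀ {T} → #[ T ] ≡ t → fromℕ 2 * above k (defect T) T ≤ fromℕ 3 * (q * c) * B
    defect-total {T} #T with Edge? G T in eq
    ... | yes edge = ≤-trans
      (*-monoˡ (fromℕ-nonNeg 2) (∑⟨⟩-mono λ K _ → *-monoˡ (𝟙-nonNeg (T ⊆? K)) (defect≤missing K)))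
      (missing-total (ℕ.≤-trans (ℕ.n≤1+n 1) 2≤t) t≤k large missing (λ U → 𝟙-nonNeg (¬? (Edge? G U))) 0≤q sparse #T
        (𝟙-no (¬? (Edge? G T)) (λ ¬edge → ¬edge edge)))
    ... | no _ = ≤-trans
      (≤-reflexive (cong (fromℕ 2 *_) (trans (above-const k 0ℚ T) (*-zeroˡ (fromℕ (extensions #[ T ] (v ∸ #[ T ]) k))))))
      (*-nonNeg (*-nonNeg (fromℕ-nonNeg 3) (*-nonNeg 0≤q (<⇒≤ 0<c))) 0≤B)

  0≤a : 0ℚ ≤ a
  0≤a = *-nonNeg (*-nonNeg (fromℕ-nonNeg (3 ℕ.^ t)) (*-nonNeg 0≤B 0≤B)) 0≤q

  -- Apply the complete matrix to e = x - κ. The constant κ contributes κ B c, which cancels the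
  -- prescribed row value, so only the defect part of the rows remains. It is at most (3/2) q c B ·
  -- B μ, one `B` from `defect-total` and one from |z K| ≤ B μ, and the inverse multiplies it by at
  -- most (3/2) 2^t / c.
  perturbation-bound : ∀ (x : Subset v → ℚ) κ {μ} → 0ℚ ≤ μ →
    (∀ U → #[ U ] ≡ t → abs (x U) ≤ μ) →
    (∀ T → #[ T ] ≡ t → row x T ≡ κ * (B * c)) →
    ∀ T → #[ T ] ≡ t → abs (x T - κ) ≤ a * μ
  -- The factor 4 clears the denominators of the two constants 3/2.
  perturbation-bound x κ {μ} 0≤μ x≤μ rows T #T = *-cancelˡ (*-pos (positive⁻¹ (fromℕ 4)) 0<c) (begin
    fromℕ 4 * c * abs (e T)
      ≡⟨ solve 2 (λ c e → con (fromℕ 4) :* c :* e := con (fromℕ 2) :* (con (fromℕ 2) :* (c :* e))) refl c (abs (e T)) ⟩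
    fromℕ 2 * (fromℕ 2 * (c * abs (e T)))
      ≤⟨ *-monoˡ (fromℕ-nonNeg 2) (inverse-bound (ℕ.≤-trans (ℕ.n≤1+n 1) 2≤t) t≤k large e error T #T) ⟩
    fromℕ 2 * (fromℕ 3 * (fromℕ (2 ℕ.^ t) * (½ * (fromℕ 3 * (q * c) * B * (B * μ)))))
      ≡⟨ solve 5 (λ p q c B μ → con (fromℕ 2) :* (con (fromℕ 3) :* (p :* (con ½ :* (con (fromℕ 3) :* (q :* c) :* B :* (B :* μ)))))
           := con (fromℕ 9) :* p :* (c :* (B :* B :* q :* μ))) refl (fromℕ (2 ℕ.^ t)) q c B μ ⟩
    fromℕ 9 * fromℕ (2 ℕ.^ t) * (c * (B * B * q * μ))
      ≤⟨ *-monoʳ (*-nonNeg (<⇒≤ 0<c) (*-nonNeg (*-nonNeg (*-nonNeg 0≤B 0≤B) 0≤q) 0≤μ))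
           (subst₂ _≤_ (fromℕ-* 9 (2 ℕ.^ t)) (fromℕ-* 4 (3 ℕ.^ t)) (fromℕ-mono (9*2^t≤4*3^t 2≤t))) ⟩
    fromℕ 4 * fromℕ (3 ℕ.^ t) * (c * (B * B * q * μ))
      ≡⟨ solve 5 (λ p q c B μ → con (fromℕ 4) :* p :* (c :* (B :* B :* q :* μ)) := con (fromℕ 4) :* c :* (p :* (B :* B) :* q :* μ)) refl (fromℕ (3 ℕ.^ t)) q c B μ ⟩
    fromℕ 4 * c * (a * μ) ∎)
    where
    open ≤-Reasoning
    e : Subset v → ℚ
    e U = x U - κ
    residual : ∀ T → #[ T ] ≡ t → above k (below t e) T ≡ above k (λ K → defect T K * below t x K) T
    residual T #T = begin-equality
      above k (below t e) T
        ≡⟨ above-cong {I = T} (λ K #K → begin-equality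
             below t e K                                                              ≡⟨ below-shift t x κ K ⟩
             b K + - (κ * fromℕ (#[ K ] C t))                                         ≡⟨ cong (λ s → b K + - (κ * fromℕ (s C t))) #K ⟩
             b K + - (κ * B)                                                          ≡⟨ cong (_+ - (κ * B)) (*-identityˡ (b K)) ⟨
             1ℚ * b K + - (κ * B)                                                     ≡⟨ cong (λ u → u * b K + - (κ * B)) (weight+defect T K) ⟨
             (cliqueWeight T K + defect T K) * b K + - (κ * B)                             ≡⟨ cong (_+ - (κ * B)) (*-distribʳ-+ (b K) (cliqueWeight T K) (defect T K)) ⟩
             cliqueWeight T K * b K + defect T K * b K + - (κ * B)                         ∎) ⟩
      above k (λ K → cliqueWeight T K * b K + defect T K * b K + - (κ * B)) T
        ≡⟨ above-+ k (λ K → cliqueWeight T K * b K + defect T K * b K) (λ _ → - (κ * B)) T ⟩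
      above k (λ K → cliqueWeight T K * b K + defect T K * b K) T + above k (λ _ → - (κ * B)) T
        ≡⟨ cong₂ _+_ (above-+ k (λ K → cliqueWeight T K * b K) (λ K → defect T K * b K) T)
             (trans (above-const k (- (κ * B)) T) (cong (λ s → - (κ * B) * fromℕ (extensions s (v ∸ s) k)) #T)) ⟩
      row x T + d + - (κ * B) * c
        ≡⟨ cong (λ r → r + d + - (κ * B) * c) (rows T #T) ⟩
      κ * (B * c) + d + - (κ * B) * c
        ≡⟨ solve 4 (λ κ B c d → κ :* (B :* c) :+ d :+ (:- (κ :* B)) :* c := d) refl κ B c d ⟩
      d ∎
      where
      b : Subset v → ℚ
      b = below t x
      d = above k (λ K → defect T K * b K) T
    error : ∀ T → #[ T ] ≡ t → abs (above k (below t e) T) ≤ ½ * (fromℕ 3 * (q * c) * B * (B * μ))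
    error T #T = *-cancelˡ (positive⁻¹ (fromℕ 2)) (begin
      fromℕ 2 * abs (above k (below t e) T)                    ≡⟨ cong (λ r → fromℕ 2 * abs r) (residual T #T) ⟩
      fromℕ 2 * abs (above k (λ K → defect T K * below t x K) T)
        ≤⟨ *-monoˡ (fromℕ-nonNeg 2) (above-abs {I = T} λ K #K → begin
             abs (defect T K * below t x K)                        ≡⟨ abs-* (below t x K) (0≤defect T K) ⟩
             defect T K * abs (below t x K)                        ≤⟨ *-monoˡ (0≤defect T K) (below-abs t x x≤μ K) ⟩
             defect T K * (fromℕ (#[ K ] C t) * μ)                 ≡⟨ cong (λ s → defect T K * (fromℕ (s C t) * μ)) #K ⟩
             defect T K * (B * μ)                                  ≡⟨ *-comm (defect T K) (B * μ) ⟩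
             B * μ * defect T K                                    ∎) ⟩
      fromℕ 2 * above k (λ K → B * μ * defect T K) T           ≡⟨ cong (fromℕ 2 *_) (above-* k (B * μ) (defect T) T) ⟩
      fromℕ 2 * (B * μ * above k (defect T) T)                 ≡⟨ solve 3 (λ a b c → a :* (b :* c) := a :* c :* b) refl (fromℕ 2) (B * μ) (above k (defect T) T) ⟩
      fromℕ 2 * above k (defect T) T * (B * μ)                 ≤⟨ *-monoʳ (*-nonNeg 0≤B 0≤μ) (defect-total {T} #T) ⟩
      fromℕ 3 * (q * c) * B * (B * μ)                          ≡⟨ ½+½ (fromℕ 3 * (q * c) * B * (B * μ)) ⟨
      fromℕ 2 * (½ * (fromℕ 3 * (q * c) * B * (B * μ)))        ∎)

-- Solving the perturbed system.

≤+½*⇒≤2* : ∀ {p κ} → p ≤ κ + ½ * p → p ≤ fromℕ 2 * κ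
≤+½*⇒≤2* {p} {κ} p≤ = begin
  p                                   ≡⟨ solve 1 (λ p → p := con (fromℕ 2) :* (p :- con ½ :* p)) refl p ⟩
  fromℕ 2 * (p - ½ * p)               ≤⟨ *-monoˡ (fromℕ-nonNeg 2) (+-monoˡ-≤ (- (½ * p)) p≤) ⟩
  fromℕ 2 * (κ + ½ * p - ½ * p)       ≡⟨ solve 2 (λ κ p → con (fromℕ 2) :* (κ :+ p :- p) := con (fromℕ 2) :* κ) refl κ (½ * p) ⟩
  fromℕ 2 * κ                         ∎
  where open ≤-Reasoning

module Solution {v k t : ℕ} (2≤t : 2 ℕ.≤ t) (t≤k : t ℕ.≤ k) (large : k ℕ.* (3 ℕ.* t) ℕ.+ t ℕ.+ k ℕ.≤ v)
  (G : TGraph t v) {q : ℚ} (0≤q : 0ℚ ≤ q)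
  (sparse : ∀ S → #[ S ] ≡ t ∸ 1 → above t (λ U → 𝟙 (¬? (Edge? G U))) S ≤ q * fromℕ (suc (v ∸ t)))
  (q-small : fromℕ (3 ℕ.^ t) * (fromℕ (k C t) * fromℕ (k C t)) * q < ½)
  where

  open Perturbation 2≤t t≤k large G 0≤q sparse

  -- A bootstrap: at a set where |x| attains its maximum μ, the perturbation bound gives μ ≤ κ + a
  -- μ, and a < 1/2 yields μ ≤ 2κ. The value κ = 0 shows that the kernel is trivial, κ = 1 locates
  -- the solution near 1.
  near-constant : ∀ x κ → 0ℚ ≤ κ → (∀ T → #[ T ] ≡ t → row x T ≡ κ * (B * c)) →
    ∃ λ μ → μ ≤ fromℕ 2 * κ × (∀ U → #[ U ] ≡ t → abs (x U) ≤ μ) × (∀ T → #[ T ] ≡ t → abs (x T - κ) ≤ a * μ)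
  near-constant x κ 0≤κ rows = μ , μ≤2κ , x≤μ , near
    where
    -- The indicator allows a maximum over all subsets; if the maximizer does not have size t, then
    -- μ = 0.
    largest : ∃ λ S → ∀ U → 𝟙 (size? t U) * abs (x U) ≤ 𝟙 (size? t S) * abs (x S)
    largest = argmax λ U → 𝟙 (size? t U) * abs (x U)
    S = proj₁ largest
    μ : ℚ
    μ = 𝟙 (size? t S) * abs (x S)
    0≤μ : 0ℚ ≤ μ
    0≤μ = *-nonNeg (𝟙-nonNeg (size? t S)) (0≤∣p∣ (x S))
    x≤μ : ∀ U → #[ U ] ≡ t → abs (x U) ≤ μ
    x≤μ U #U = subst (_≤ μ) (𝟙-yes-* (size? t U) #U (abs (x U))) (proj₂ largest U)
    near : ∀ T → #[ T ] ≡ t → abs (x T - κ) ≤ a * μ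
    near = perturbation-bound x κ 0≤μ x≤μ rows
    open ≤-Reasoning
    attained : Dec (#[ S ] ≡ t) → μ ≤ κ + a * μ
    attained (yes #S) = begin
      μ                        ≡⟨ 𝟙-yes-* (size? t S) #S (abs (x S)) ⟩
      abs (x S)                ≡⟨ cong abs (solve 2 (λ x κ → x := κ :+ (x :- κ)) refl (x S) κ) ⟩
      abs (κ + (x S - κ))      ≤⟨ ∣p+q∣≤∣p∣+∣q∣ κ (x S - κ) ⟩
      abs κ + abs (x S - κ)    ≤⟨ +-mono-≤ (≤-reflexive (0≤p⇒∣p∣≡p 0≤κ)) (near S #S) ⟩
      κ + a * μ                ∎
    attained (no ¬#S) = begin
      μ          ≡⟨ 𝟙-no-* (size? t S) ¬#S (abs (x S)) ⟩
      0ℚ         ≤⟨ +-mono-≤ 0≤κ (*-nonNeg 0≤a 0≤μ) ⟩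
      κ + a * μ  ∎
    μ≤2κ : μ ≤ fromℕ 2 * κ
    μ≤2κ = ≤+½*⇒≤2* {μ} {κ} (≤-trans (attained (size? t S)) (+-monoʳ-≤ κ (*-monoʳ 0≤μ (<⇒≤ q-small))))

  private
    entry : Subset v → Subset v → ℚ
    entry T U = above k (λ K → cliqueWeight T K * 𝟙 (U ⊆? K)) T

  row-entries : ∀ x T → (∑⟨ size? t ⟩ λ U → entry T U * x U) ≡ row x T
  row-entries x T = begin
    (∑⟨ size? t ⟩ λ U → entry T U * x U)
      ≡⟨ ∑⟨⟩-cong (λ U _ → trans (*-comm (entry T U) (x U))
           (sym (∑⟨⟩-* (x U) (λ K → 𝟙 (T ⊆? K) * (cliqueWeight T K * 𝟙 (U ⊆? K)))))) ⟩
    (∑⟨ size? t ⟩ λ U → ∑⟨ size? k ⟩ λ K → x U * (𝟙 (T ⊆? K) * (cliqueWeight T K * 𝟙 (U ⊆? K))))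
      ≡⟨ ∑⟨⟩-comm (λ U K → x U * (𝟙 (T ⊆? K) * (cliqueWeight T K * 𝟙 (U ⊆? K)))) ⟩
    (∑⟨ size? k ⟩ λ K → ∑⟨ size? t ⟩ λ U → x U * (𝟙 (T ⊆? K) * (cliqueWeight T K * 𝟙 (U ⊆? K))))
      ≡⟨ ∑⟨⟩-cong (λ K _ → trans
           (∑⟨⟩-cong λ U _ → solve 4 (λ x a w b → x :* (a :* (w :* b)) := a :* w :* (b :* x)) refl (x U) (𝟙 (T ⊆? K)) (cliqueWeight T K) (𝟙 (U ⊆? K)))
           (trans (∑⟨⟩-* (𝟙 (T ⊆? K) * cliqueWeight T K) (λ U → 𝟙 (U ⊆? K) * x U))
                  (*-assoc (𝟙 (T ⊆? K)) (cliqueWeight T K) (below t x K)))) ⟩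
    row x T ∎
    where open ≡-Reasoning

  -- A uniform lower bound for the solution, from |x T - 1| ≤ a μ with μ ≤ 2.
  δ : ℚ
  δ = 1ℚ - a * fromℕ 2

  0<δ : 0ℚ < δ
  0<δ = begin-strict
    0ℚ                ≡⟨⟩
    1ℚ - ½ * fromℕ 2  <⟨ +-monoʳ-< 1ℚ (neg-antimono-< (*-monoˡ-<-pos (fromℕ 2) q-small)) ⟩
    1ℚ - a * fromℕ 2  ∎
    where open ≤-Reasoning

  positive-solution : ∃ λ x → (∀ T → #[ T ] ≡ t → row x T ≡ B * c) × (∀ T → #[ T ] ≡ t → δ ≤ x T)
  positive-solution = x , rows , δ≤x
    where
    kernel-trivial : ∀ x → (∀ T → #[ T ] ≡ t → (∑⟨ size? t ⟩ λ U → entry T U * x U) ≡ 0ℚ) →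
      ∀ U → #[ U ] ≡ t → x U ≡ 0ℚ
    kernel-trivial x Ax≡0 U #U = ∣p∣≡0⇒p≡0 (x U) (≤-antisym (≤-trans (x≤μ U #U) μ≤0) (0≤∣p∣ (x U)))
      where
      bounded = near-constant x 0ℚ ≤-refl
        λ T #T → trans (sym (row-entries x T)) (trans (Ax≡0 T #T) (sym (*-zeroˡ (B * c))))
      μ≤0 = proj₁ (proj₂ bounded)
      x≤μ = proj₁ (proj₂ (proj₂ bounded))
    solution : ∃ λ x → ∀ T → #[ T ] ≡ t → (∑⟨ size? t ⟩ λ U → entry T U * x U) ≡ B * c
    solution = injective-system-solvable (size? t) entry kernel-trivial (B * c)
    x = proj₁ solution
    rows : ∀ T → #[ T ] ≡ t → row x T ≡ B * c
    rows T #T = trans (sym (row-entries x T)) (proj₂ solution T #T)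
    δ≤x : ∀ T → #[ T ] ≡ t → δ ≤ x T
    δ≤x T #T = begin
      1ℚ - a * fromℕ 2          ≤⟨ +-monoʳ-≤ 1ℚ (neg-antimono-≤ (begin
        - (x T - 1ℚ)              ≤⟨ p≤abs (- (x T - 1ℚ)) ⟩
        abs (- (x T - 1ℚ))        ≡⟨ ∣-p∣≡∣p∣ (x T - 1ℚ) ⟩
        abs (x T - 1ℚ)            ≤⟨ near T #T ⟩
        a * μ                     ≤⟨ *-monoˡ 0≤a μ≤2 ⟩
        a * (fromℕ 2 * 1ℚ)        ≡⟨ cong (a *_) (*-identityʳ (fromℕ 2)) ⟩
        a * fromℕ 2               ∎)) ⟩
      1ℚ - - (x T - 1ℚ)         ≡⟨ solve 1 (λ x → con 1ℚ :- :- (x :- con 1ℚ) := x) refl (x T) ⟩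
      x T                       ∎
      where
      open ≤-Reasoning
      bounded = near-constant x 1ℚ (nonNegative⁻¹ 1ℚ) λ T #T → trans (rows T #T) (sym (*-identityˡ (B * c)))
      μ = proj₁ bounded
      μ≤2 = proj₁ (proj₂ bounded)
      near = proj₂ (proj₂ (proj₂ bounded))

-- Copies of the complete t-graph

enumerate : ∀ {v} (K : Subset v) → Fin #[ K ] → Fin v
enumerate (inside  ∷ K) zero    = zero
enumerate (inside  ∷ K) (suc i) = suc (enumerate K i)
enumerate (outside ∷ K) i       = suc (enumerate K i)

enumerate-injective : ∀ {v} (K : Subset v) → Injective _≡_ _≡_ (enumerate K)
enumerate-injective (inside  ∷ K) {zero}  {zero}  _  = refl
enumerate-injective (inside  ∷ K) {suc i} {suc j} eq = cong suc (enumerate-injective K (Fin.suc-injective eq))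
enumerate-injective (outside ∷ K) eq                 = enumerate-injective K (Fin.suc-injective eq)

enumerate-∈ : ∀ {v} (K : Subset v) i → enumerate K i ∈ K
enumerate-∈ (inside  ∷ K) zero    = here
enumerate-∈ (inside  ∷ K) (suc i) = there (enumerate-∈ K i)
enumerate-∈ (outside ∷ K) i       = there (enumerate-∈ K i)

enumerate-onto : ∀ {v} (K : Subset v) {y} → y ∈ K → ∃ λ i → enumerate K i ≡ y
enumerate-onto (inside  ∷ K) here        = zero , refl
enumerate-onto (inside  ∷ K) (there y∈K) with i , eq ← enumerate-onto K y∈K = suc i , cong suc eq
enumerate-onto (outside ∷ K) (there y∈K) with i , eq ← enumerate-onto K y∈K = i , cong suc eq

-- The image of `S` under `enumerate K`, by recursion on `K` so that its size can be read off;
-- `image` is a tabulated search.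
spread : ∀ {v} (K : Subset v) → Subset #[ K ] → Subset v
spread []            []      = []
spread (inside  ∷ K) (s ∷ S) = s ∷ spread K S
spread (outside ∷ K) S       = outside ∷ spread K S

#-spread : ∀ {v} (K : Subset v) S → #[ spread K S ] ≡ #[ S ]
#-spread []            []            = refl
#-spread (inside  ∷ K) (inside  ∷ S) = cong suc (#-spread K S)
#-spread (inside  ∷ K) (outside ∷ S) = #-spread K S
#-spread (outside ∷ K) S             = #-spread K S

∈-spread⁺ : ∀ {v} (K : Subset v) {S x} → x ∈ S → enumerate K x ∈ spread K S
∈-spread⁺ (inside  ∷ K) {s ∷ S} here        = here
∈-spread⁺ (inside  ∷ K) {s ∷ S} (there x∈S) = there (∈-spread⁺ K x∈S)
∈-spread⁺ (outside ∷ K) x∈S                 = there (∈-spread⁺ K x∈S)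

∈-spread⁻ : ∀ {v} (K : Subset v) {S y} → y ∈ spread K S → ∃ λ x → x ∈ S × enumerate K x ≡ y
∈-spread⁻ (inside  ∷ K) {s ∷ S} here         = zero , here , refl
∈-spread⁻ (inside  ∷ K) {s ∷ S} (there y∈KS) with x , x∈S , eq ← ∈-spread⁻ K y∈KS = suc x , there x∈S , cong suc eq
∈-spread⁻ (outside ∷ K) (there y∈KS)         with x , x∈S , eq ← ∈-spread⁻ K y∈KS = x , x∈S , cong suc eq

∈-image⁺ : ∀ {m n} (f : Fin m → Fin n) {S x} → x ∈ S → f x ∈ image f S
∈-image⁺ f {S} {x} x∈S = Vec.lookup⇒[]= (f x) (image f S) (trans (Vec.lookup∘tabulate _ (f x))
  (trans (isYes≗does (decide (f x))) (dec-true (decide (f x)) (x , x∈S , refl))))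
  where
  decide : ∀ y → Dec (∃ λ x → x ∈ S × f x ≡ y)
  decide y = Fin.any? λ x → (x ∈? S) ×-dec (f x Fin.≟ y)

∈-image⁻ : ∀ {m n} (f : Fin m → Fin n) {S y} → y ∈ image f S → ∃ λ x → x ∈ S × f x ≡ y
∈-image⁻ f {S} {y} y∈ = toWitness {a? = decide y}
  (subst Bool.T (sym (trans (sym (Vec.lookup∘tabulate (λ y → isYes (decide y)) y)) (Vec.[]=⇒lookup y∈))) _)
  where
  decide : ∀ y → Dec (∃ λ x → x ∈ S × f x ≡ y)
  decide y = Fin.any? λ x → (x ∈? S) ×-dec (f x Fin.≟ y)

image-enumerate : ∀ {v} (K : Subset v) S → image (enumerate K) S ≡ spread K S
image-enumerate K S = Subset.⊆-antisym
  (λ y∈image → let x , x∈S , eq = ∈-image⁻ (enumerate K) y∈image in subst (_∈ spread K S) eq (∈-spread⁺ K x∈S))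
  (λ y∈spread → let x , x∈S , eq = ∈-spread⁻ K y∈spread in subst (_∈ image (enumerate K) S) eq (∈-image⁺ (enumerate K) x∈S))

module _ {v t : ℕ} (G : TGraph t v) where

  completeOn : (K : Subset v) → InducesClique G K → Subgraph G
  completeOn K clique .vertices      = K
  completeOn K clique .graph .Edge T = T ⊆ K × #[ T ] ≡ t
  completeOn K clique .graph .Edge? T = (T ⊆? K) ×-dec size? t T
  completeOn K clique .graph .uniform (_ , #T) = #T
  completeOn K clique .incident (T⊆K , _) = T⊆K
  completeOn K clique .subgraph {T} (T⊆K , #T) = clique T T⊆K #T

  completeOn-≅ : ∀ {k} (K : Subset v) (clique : InducesClique G K) → #[ K ] ≡ k → complete t k ≅ completeOn K clique
  completeOn-≅ K clique refl = record
    { to        = enumerate K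
    ; injective = enumerate-injective K
    ; onto      = λ y → mk⇔ (enumerate-onto K) λ (x , eq) → subst (_∈ K) eq (enumerate-∈ K x)
    ; edges⇔    = λ S → mk⇔
        (λ #S → (λ {y} → image⊆K S {y}) , trans (#image S) #S)
        (λ (_ , #image-S) → trans (sym (#image S)) #image-S)
    }
    where
    #image : ∀ S → #[ image (enumerate K) S ] ≡ #[ S ]
    #image S = trans (cong #[_] (image-enumerate K S)) (#-spread K S)
    image⊆K : ∀ S → image (enumerate K) S ⊆ K
    image⊆K S y∈image = let x , _ , eq = ∈-image⁻ (enumerate K) y∈image in subst (_∈ K) eq (enumerate-∈ K x)

-- Density and the threshold

fromℕ*1/ : ∀ m .{{_ : ℕ.NonZero m}} → fromℕ m * (ℤ.+ 1 / m) ≡ 1ℚ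
fromℕ*1/ (suc m) = toℚᵘ-injective (begin
  toℚᵘ (fromℕ (suc m) * (ℤ.+ 1 / suc m))                ≈⟨ toℚᵘ-homo-* (fromℕ (suc m)) (ℤ.+ 1 / suc m) ⟩
  toℚᵘ (fromℕ (suc m)) ℚᵘ.* toℚᵘ (ℤ.+ 1 / suc m)        ≈⟨ ℚᵘ.*-cong (toℚᵘ-fromℚᵘ (ℚᵘ.mkℚᵘ (ℤ.+ suc m) 0)) (toℚᵘ-fromℚᵘ (ℚᵘ.mkℚᵘ (ℤ.+ 1) m)) ⟩
  ℚᵘ.mkℚᵘ (ℤ.+ suc m) 0 ℚᵘ.* ℚᵘ.mkℚᵘ (ℤ.+ 1) m          ≈⟨ ℚᵘ.*≡* (trans (ℤ.*-identityʳ _) (trans (ℤ.*-identityʳ (ℤ.+ suc m))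
                                                             (sym (trans (ℤ.*-identityˡ _) (cong (λ s → ℤ.+ suc s) (ℕ.+-identityʳ m)))))) ⟩
  toℚᵘ 1ℚ                                               ∎)
  where open ℚᵘ.≃-Reasoning

below-threshold : ∀ {k t} (t≤k : t ℕ.≤ k) {q} → q < ε-bound k t t≤k →
  fromℕ (3 ℕ.^ t) * (fromℕ (k C t) * fromℕ (k C t)) * q < ½
below-threshold {k} {t} t≤k {q} q<bound = begin-strict
  p * (b * b) * q                    <⟨ *-monoʳ-<-pos (p * (b * b)) {{positive (*-pos 0<p (*-pos 0<b 0<b))}} q<bound ⟩
  p * (b * b) * (½ * p⁻¹ * b²⁻¹)     ≡⟨ solve 5 (λ p b h r s → p :* b :* (h :* r :* s) := h :* (p :* r) :* (b :* s)) refl p (b * b) ½ p⁻¹ b²⁻¹ ⟩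
  ½ * (p * p⁻¹) * (b * b * b²⁻¹)     ≡⟨ cong (λ s → ½ * (p * p⁻¹) * (s * b²⁻¹)) b*b ⟨
  ½ * (p * p⁻¹) * (fromℕ ((k C t) ℕ.^ 2) * b²⁻¹) ≡⟨ cong₂ (λ r s → ½ * r * s) (fromℕ*1/ (3 ℕ.^ t)) (fromℕ*1/ ((k C t) ℕ.^ 2)) ⟩
  ½ * 1ℚ * 1ℚ                        ≡⟨⟩
  ½                                  ∎
  where
  open ≤-Reasoning
  instance
    _ = ℕ.m^n≢0 3 t
    _ = ℕ.m^n≢0 (k C t) 2 {{C-nonZero t≤k}}
  p b p⁻¹ b²⁻¹ : ℚ
  p = fromℕ (3 ℕ.^ t)
  b = fromℕ (k C t)
  p⁻¹ = ℤ.+ 1 / (3 ℕ.^ t)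
  b²⁻¹ = ℤ.+ 1 / ((k C t) ℕ.^ 2)
  0<p : 0ℚ < p
  0<p = fromℕ-pos (ℕ.>-nonZero⁻¹ (3 ℕ.^ t))
  0<b : 0ℚ < b
  0<b = C-pos t≤k
  b*b : fromℕ ((k C t) ℕ.^ 2) ≡ b * b
  b*b = trans (fromℕ-* (k C t) ((k C t) ℕ.* 1)) (cong (λ s → b * fromℕ s) (ℕ.*-identityʳ (k C t)))

positive-upper : ∀ {ε q} → fromℚ 0ℚ <ᴿ ε → ℝ.upper ε q → 0ℚ < q
positive-upper {ε} {q} (p , 0<p , p<ε) ε<q = ≰⇒> λ q≤0 →
  ℝ.disjoint ε (ℝ.lower-closed ε (≤-<-trans q≤0 0<p) p<ε) ε<q

∑⟨⟩-change : ∀ {n} {P Q : Pred (Subset n) 0ℓ} (P? : Decidable P) (Q? : Decidable Q) {f g : Subset n → ℚ} →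
  (∀ S → 𝟙 (P? S) * f S ≡ 𝟙 (Q? S) * g S) → (∑⟨ P? ⟩ f) ≡ (∑⟨ Q? ⟩ g)
∑⟨⟩-change P? Q? {f} {g} eq = trans (∑⟨⟩-def P? f) (trans (∑-cong eq) (sym (∑⟨⟩-def Q? g)))

module _ {v t : ℕ} (G : TGraph t v) where

  𝟙-Edge : ∀ U → 𝟙 (Edge? G U) ≡ 𝟙 (size? t U) * 𝟙 (Edge? G U)
  𝟙-Edge U = trans
    (𝟙-⇔ (Edge? G U) (size? t U ×-dec Edge? G U) (λ edge → uniform G edge , edge) proj₂)
    (𝟙-× (size? t U) (Edge? G U))

  degree+missing : 1 ℕ.≤ t → t ℕ.≤ v → ∀ S → #[ S ] ≡ t ∸ 1 →
    fromℕ (degree G S) + above t (λ U → 𝟙 (¬? (Edge? G U))) S ≡ fromℕ (suc (v ∸ t))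
  degree+missing 1≤t t≤v S #S = begin
    fromℕ (degree G S) + above t missing S
      ≡⟨ cong (_+ above t missing S) (fromℕ-countSubsets (λ U → Edge? G U ×-dec S ⊆? U)) ⟩
    (∑⟨ (λ U → Edge? G U ×-dec S ⊆? U) ⟩ λ _ → 1ℚ) + above t missing S
      ≡⟨ cong (_+ above t missing S) (∑⟨⟩-change (λ U → Edge? G U ×-dec S ⊆? U) (size? t) λ U → begin
           𝟙 (Edge? G U ×-dec S ⊆? U) * 1ℚ                   ≡⟨ *-identityʳ (𝟙 (Edge? G U ×-dec S ⊆? U)) ⟩
           𝟙 (Edge? G U ×-dec S ⊆? U)                        ≡⟨ 𝟙-× (Edge? G U) (S ⊆? U) ⟩
           𝟙 (Edge? G U) * 𝟙 (S ⊆? U)                        ≡⟨ cong (_* 𝟙 (S ⊆? U)) (𝟙-Edge U) ⟩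
           𝟙 (size? t U) * 𝟙 (Edge? G U) * 𝟙 (S ⊆? U)        ≡⟨ solve 3 (λ a b c → a :* b :* c := a :* (c :* b)) refl (𝟙 (size? t U)) (𝟙 (Edge? G U)) (𝟙 (S ⊆? U)) ⟩
           𝟙 (size? t U) * (𝟙 (S ⊆? U) * 𝟙 (Edge? G U))      ∎) ⟩
    above t (λ U → 𝟙 (Edge? G U)) S + above t missing S
      ≡⟨ above-+ t (λ U → 𝟙 (Edge? G U)) missing S ⟨
    above t (λ U → 𝟙 (Edge? G U) + missing U) S
      ≡⟨ above-cong {I = S} (λ U _ → 𝟙-¬ (Edge? G U)) ⟩
    above t (λ _ → 1ℚ) S
      ≡⟨ trans (above-const t 1ℚ S) (*-identityˡ (fromℕ (extensions #[ S ] (v ∸ #[ S ]) t))) ⟩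
    fromℕ (extensions #[ S ] (v ∸ #[ S ]) t)
      ≡⟨ cong fromℕ (trans (cong (λ s → extensions s (v ∸ s) t) #S) (last 1≤t t≤v)) ⟩
    fromℕ (suc (v ∸ t)) ∎
    where
    open ≡-Reasoning
    missing : Subset v → ℚ
    missing U = 𝟙 (¬? (Edge? G U))
    last : ∀ {t} → 1 ℕ.≤ t → t ℕ.≤ v → extensions (t ∸ 1) (v ∸ (t ∸ 1)) t ≡ suc (v ∸ t)
    last {suc s} _ s<v = begin
      extensions s (v ∸ s) (suc s)      ≡⟨ cong (extensions s (v ∸ s)) (ℕ.+-comm s 1) ⟨
      extensions s (v ∸ s) (s ℕ.+ 1)    ≡⟨ extensions-+ s (v ∸ s) 1 ⟩
      (v ∸ s) C 1                       ≡⟨ ℕ.nC1≡n (v ∸ s) ⟩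
      v ∸ s                             ≡⟨ ℕ.+-∸-assoc 1 s<v ⟩
      suc (v ∸ suc s)                   ∎

  -- Let s = v - t + 1. As ε < q, the rational (1 - q) s lies in the lower cut of (1 - ε) s, so
  -- density puts it below the degree; subtracting from the total s bounds the missing edges.
  dense⇒sparse : 1 ℕ.≤ t → t ℕ.≤ v → ∀ {ε q} → ℝ.upper ε q → Dense G ε → ∀ S → #[ S ] ≡ t ∸ 1 →
    above t (λ U → 𝟙 (¬? (Edge? G U))) S ≤ q * fromℕ (suc (v ∸ t))
  dense⇒sparse 1≤t t≤v {ε} {q} ε<q dense S #S = begin
    N                         ≡⟨ solve 2 (λ d n → n := d :+ n :- d) refl d N ⟩
    d + N - d                 ≡⟨ cong (_- d) (degree+missing 1≤t t≤v S #S) ⟩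
    s - d                     ≤⟨ +-monoʳ-≤ s (neg-antimono-≤ (<⇒≤ (dense S #S (subst (ℝ.upper ε) (sym cut) ε<q)))) ⟩
    s - (1ℚ - q) * s          ≡⟨ solve 2 (λ s q → s :- (con 1ℚ :- q) :* s := q :* s) refl s q ⟩
    q * s                     ∎
    where
    open ≤-Reasoning
    d s N : ℚ
    d = fromℕ (degree G S)
    s = fromℕ (suc (v ∸ t))
    N = above t (λ U → 𝟙 (¬? (Edge? G U))) S
    instance
      s-nonZero : NonZero s
      s-nonZero = pos⇒nonZero s {{normalize-pos (suc (v ∸ t)) 1}}
    -- The cut of (1 - ε) s at (1 - q) s unfolds to the claim that this quantity is an upper bound
    -- of ε.
    cut : 1ℚ - (1ℚ - q) * s * (1/ s) ≡ q
    cut = begin-equality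
      1ℚ - (1ℚ - q) * s * (1/ s)    ≡⟨ cong (λ u → 1ℚ - u) (*-assoc (1ℚ - q) s (1/ s)) ⟩
      1ℚ - (1ℚ - q) * (s * (1/ s))  ≡⟨ cong (λ u → 1ℚ - (1ℚ - q) * u) (*-inverseʳ s) ⟩
      1ℚ - (1ℚ - q) * 1ℚ            ≡⟨ solve 1 (λ q → con 1ℚ :- (con 1ℚ :- q) :* con 1ℚ := q) refl q ⟩
      q                             ∎

  -- From the clique matrix to a fractional decomposition.

  cliqueRow : ℕ → (Subset v → ℚ) → Subset v → ℚ
  cliqueRow k x T = above k (λ K → 𝟙 (inducesClique? G K) * below t x K) T

  -- The t-subsets of a clique are exactly the edges inside it, so summing over edges below a clique
  -- is the same as summing over all its t-subsets. Hence `x` may take any values at non-edges.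
  M̂-row : ∀ k (x : Subset v → ℚ) i → (M̂ G k *ᵥ λ j → x (edge G j)) i ≡ cliqueRow k x (edge G i)
  M̂-row k x i = begin
    sum (λ j → fromℕ (M̂ G k i j) * x (edge G j))
      ≡⟨ sum-subsets (Edge? G) (λ U → fromℕ (countSubsets (contains? U)) * x U) ⟩
    (∑⟨ Edge? G ⟩ λ U → fromℕ (countSubsets (contains? U)) * x U)
      ≡⟨ ∑⟨⟩-cong (λ U _ → begin
           fromℕ (countSubsets (contains? U)) * x U   ≡⟨ cong (_* x U) (fromℕ-countSubsets (contains? U)) ⟩
           (∑⟨ contains? U ⟩ λ _ → 1ℚ) * x U          ≡⟨ cong (_* x U) (∑⟨⟩-change (contains? U) (size? k) (λ K → expand U K)) ⟩
           (∑⟨ size? k ⟩ λ K → 𝟙 (T ⊆? K) * (χ K * 𝟙 (U ⊆? K))) * x U ≡⟨ *-comm _ (x U) ⟩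
           x U * (∑⟨ size? k ⟩ λ K → 𝟙 (T ⊆? K) * (χ K * 𝟙 (U ⊆? K))) ≡⟨ ∑⟨⟩-* (x U) (λ K → 𝟙 (T ⊆? K) * (χ K * 𝟙 (U ⊆? K))) ⟨
           (∑⟨ size? k ⟩ λ K → x U * (𝟙 (T ⊆? K) * (χ K * 𝟙 (U ⊆? K)))) ∎) ⟩
    (∑⟨ Edge? G ⟩ λ U → ∑⟨ size? k ⟩ λ K → x U * (𝟙 (T ⊆? K) * (χ K * 𝟙 (U ⊆? K))))
      ≡⟨ ∑⟨⟩-comm (λ U K → x U * (𝟙 (T ⊆? K) * (χ K * 𝟙 (U ⊆? K)))) ⟩
    (∑⟨ size? k ⟩ λ K → ∑⟨ Edge? G ⟩ λ U → x U * (𝟙 (T ⊆? K) * (χ K * 𝟙 (U ⊆? K))))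
      ≡⟨ ∑⟨⟩-cong (λ K _ → begin
           (∑⟨ Edge? G ⟩ λ U → x U * (𝟙 (T ⊆? K) * (χ K * 𝟙 (U ⊆? K))))   ≡⟨ ∑⟨⟩-cong (λ U _ →
             solve 4 (λ x a w b → x :* (a :* (w :* b)) := a :* w :* (b :* x)) refl (x U) (𝟙 (T ⊆? K)) (χ K) (𝟙 (U ⊆? K))) ⟩
           (∑⟨ Edge? G ⟩ λ U → 𝟙 (T ⊆? K) * χ K * (𝟙 (U ⊆? K) * x U))     ≡⟨ ∑⟨⟩-* (𝟙 (T ⊆? K) * χ K) (λ U → 𝟙 (U ⊆? K) * x U) ⟩
           𝟙 (T ⊆? K) * χ K * (∑⟨ Edge? G ⟩ λ U → 𝟙 (U ⊆? K) * x U)       ≡⟨ *-assoc (𝟙 (T ⊆? K)) (χ K) _ ⟩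
           𝟙 (T ⊆? K) * (χ K * (∑⟨ Edge? G ⟩ λ U → 𝟙 (U ⊆? K) * x U))     ≡⟨ cong (𝟙 (T ⊆? K) *_) (𝟙-cong (inducesClique? G K) (edges-below K)) ⟩
           𝟙 (T ⊆? K) * (χ K * below t x K)                               ∎) ⟩
    cliqueRow k x T ∎
    where
    open ≡-Reasoning
    T = edge G i
    χ : Subset v → ℚ
    χ K = 𝟙 (inducesClique? G K)
    contains? : ∀ U K → Dec (#[ K ] ≡ k × (T ∪ U) ⊆ K × InducesClique G K)
    contains? U K = size? k K ×-dec (((T ∪ U) ⊆? K) ×-dec inducesClique? G K)
    expand : ∀ U K → 𝟙 (contains? U K) * 1ℚ ≡ 𝟙 (size? k K) * (𝟙 (T ⊆? K) * (χ K * 𝟙 (U ⊆? K)))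
    expand U K = begin
      𝟙 (contains? U K) * 1ℚ                           ≡⟨ *-identityʳ (𝟙 (contains? U K)) ⟩
      𝟙 (contains? U K)                                ≡⟨ 𝟙-× (size? k K) (((T ∪ U) ⊆? K) ×-dec inducesClique? G K) ⟩
      𝟙 (size? k K) * 𝟙 (((T ∪ U) ⊆? K) ×-dec inducesClique? G K) ≡⟨ cong (𝟙 (size? k K) *_) (begin
        𝟙 (((T ∪ U) ⊆? K) ×-dec inducesClique? G K)      ≡⟨ 𝟙-× ((T ∪ U) ⊆? K) (inducesClique? G K) ⟩
        𝟙 ((T ∪ U) ⊆? K) * χ K                           ≡⟨ cong (_* χ K) (𝟙-⊆-∪ T U K) ⟨
        𝟙 (T ⊆? K) * 𝟙 (U ⊆? K) * χ K                    ≡⟨ solve 3 (λ a b c → a :* b :* c := a :* (c :* b)) refl (𝟙 (T ⊆? K)) (𝟙 (U ⊆? K)) (χ K) ⟩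
        𝟙 (T ⊆? K) * (χ K * 𝟙 (U ⊆? K))                  ∎) ⟩
      𝟙 (size? k K) * (𝟙 (T ⊆? K) * (χ K * 𝟙 (U ⊆? K)))  ∎
    edges-below : ∀ K → InducesClique G K → (∑⟨ Edge? G ⟩ λ U → 𝟙 (U ⊆? K) * x U) ≡ below t x K
    edges-below K clique = ∑⟨⟩-change (Edge? G) (size? t) λ U → begin
      𝟙 (Edge? G U) * (𝟙 (U ⊆? K) * x U)     ≡⟨ *-assoc (𝟙 (Edge? G U)) (𝟙 (U ⊆? K)) (x U) ⟨
      𝟙 (Edge? G U) * 𝟙 (U ⊆? K) * x U       ≡⟨ cong (_* x U) (begin
        𝟙 (Edge? G U) * 𝟙 (U ⊆? K)             ≡⟨ 𝟙-× (Edge? G U) (U ⊆? K) ⟨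
        𝟙 (Edge? G U ×-dec (U ⊆? K))           ≡⟨ 𝟙-⇔ (Edge? G U ×-dec (U ⊆? K)) (size? t U ×-dec (U ⊆? K))
          (λ (e , U⊆K) → uniform G e , (λ {y} → U⊆K {y})) (λ (#U , U⊆K) → clique U U⊆K #U , (λ {y} → U⊆K {y})) ⟩
        𝟙 (size? t U ×-dec (U ⊆? K))           ≡⟨ 𝟙-× (size? t U) (U ⊆? K) ⟩
        𝟙 (size? t U) * 𝟙 (U ⊆? K)             ∎) ⟩
      𝟙 (size? t U) * 𝟙 (U ⊆? K) * x U       ≡⟨ *-assoc (𝟙 (size? t U)) (𝟙 (U ⊆? K)) (x U) ⟩
      𝟙 (size? t U) * (𝟙 (U ⊆? K) * x U)     ∎

  -- A clique `K` receives the weight z K / θ, where z K adds the values of `x` on its t-subsets.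
  -- The equation of row `T` then says that the weights of the cliques over `T` add up to 1, and z K
  -- ≥ δ C(k,t) > 0.
  decomposition : ∀ {k} → t ℕ.≤ k → (x : Subset v → ℚ) {δ θ : ℚ} → 0ℚ < δ → 0ℚ < θ →
    (∀ U → #[ U ] ≡ t → δ ≤ x U) → (∀ T → Edge G T → cliqueRow k x T ≡ θ) →
    FractionalDecomposition G (complete t k)
  decomposition {k} t≤k x {δ} {θ} 0<δ 0<θ δ≤x rows = record
    { copy     = λ i → completeOn G (K i) (proj₂ (K-clique i))
    ; weight   = λ i → w (K i)
    ; iso      = λ i → completeOn-≅ G (K i) (proj₂ (K-clique i)) (proj₁ (K-clique i))
    ; positive = λ i → positive (0<w (K i) (proj₁ (K-clique i)))
    ; distinct = λ i j copies≈ _ → lookup-filter-injective clique? i j (_≈_.vertices≡ copies≈)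
    ; covers   = covers
    }
    where
    clique? : ∀ K → Dec (#[ K ] ≡ k × InducesClique G K)
    clique? K = size? k K ×-dec inducesClique? G K
    K : Fin (countSubsets clique?) → Subset v
    K = lookup (filter clique? (subsets v))
    K-clique : ∀ i → #[ K i ] ≡ k × InducesClique G (K i)
    K-clique = lookup-satisfies clique?
    instance
      θ-positive : Positive θ
      θ-positive = positive 0<θ
      θ-nonZero : NonZero θ
      θ-nonZero = pos⇒nonZero θ
    w : Subset v → ℚ
    w K = (1/ θ) * below t x K
    0<w : ∀ K → #[ K ] ≡ k → 0ℚ < w K
    0<w K #K = *-pos (positive⁻¹ (1/ θ) {{1/pos⇒pos θ}}) (begin-strict
      0ℚ                                       <⟨ *-pos 0<δ (C-pos t≤k) ⟩
      δ * fromℕ (k C t)                        ≡⟨ cong (λ s → δ * fromℕ (s C t)) #K ⟨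
      δ * fromℕ (#[ K ] C t)                   ≡⟨ cong (δ *_) (count-below K t) ⟨
      δ * (∑⟨ size? t ⟩ λ U → 𝟙 (U ⊆? K))      ≡⟨ ∑⟨⟩-* δ (λ U → 𝟙 (U ⊆? K)) ⟨
      (∑⟨ size? t ⟩ λ U → δ * 𝟙 (U ⊆? K))      ≤⟨ ∑⟨⟩-mono (λ U #U → ≤-trans (≤-reflexive (*-comm δ (𝟙 (U ⊆? K)))) (*-monoˡ (𝟙-nonNeg (U ⊆? K)) (δ≤x U #U))) ⟩
      below t x K                              ∎)
      where open ≤-Reasoning
    covers : ∀ T → Edge G T →
      sum (λ i → if does ((T ⊆? K i) ×-dec size? t T) then w (K i) else 0ℚ) ≡ 1ℚ
    covers T T∈G = begin
      sum (λ i → if does ((T ⊆? K i) ×-dec size? t T) then w (K i) else 0ℚ)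
        ≡⟨ sum-subsets clique? (λ K → if does ((T ⊆? K) ×-dec size? t T) then w K else 0ℚ) ⟩
      (∑⟨ clique? ⟩ λ K → if does ((T ⊆? K) ×-dec size? t T) then w K else 0ℚ)
        ≡⟨ ∑⟨⟩-change clique? (size? k) (λ K → begin
             𝟙 (clique? K) * (if does ((T ⊆? K) ×-dec size? t T) then w K else 0ℚ)
               ≡⟨ cong₂ _*_ (𝟙-× (size? k K) (inducesClique? G K)) (if-𝟙 (does ((T ⊆? K) ×-dec size? t T)) (w K)) ⟩
             𝟙 (size? k K) * 𝟙 (inducesClique? G K) * (𝟙 ((T ⊆? K) ×-dec size? t T) * w K)
               ≡⟨ cong (λ s → 𝟙 (size? k K) * 𝟙 (inducesClique? G K) * (s * w K))
                    (trans (𝟙-× (T ⊆? K) (size? t T)) (trans (cong (𝟙 (T ⊆? K) *_) (𝟙-yes (size? t T) (uniform G T∈G))) (*-identityʳ (𝟙 (T ⊆? K))))) ⟩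
             𝟙 (size? k K) * 𝟙 (inducesClique? G K) * (𝟙 (T ⊆? K) * w K)
               ≡⟨ solve 5 (λ a b c d e → a :* b :* (c :* (d :* e)) := a :* (d :* (c :* (b :* e)))) refl
                    (𝟙 (size? k K)) (𝟙 (inducesClique? G K)) (𝟙 (T ⊆? K)) (1/ θ) (below t x K) ⟩
             𝟙 (size? k K) * ((1/ θ) * (𝟙 (T ⊆? K) * (𝟙 (inducesClique? G K) * below t x K))) ∎) ⟩
      (∑⟨ size? k ⟩ λ K → (1/ θ) * (𝟙 (T ⊆? K) * (𝟙 (inducesClique? G K) * below t x K)))
        ≡⟨ ∑⟨⟩-* (1/ θ) (λ K → 𝟙 (T ⊆? K) * (𝟙 (inducesClique? G K) * below t x K)) ⟩
      (1/ θ) * cliqueRow k x T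
        ≡⟨ cong ((1/ θ) *_) (rows T T∈G) ⟩
      (1/ θ) * θ
        ≡⟨ *-inverseˡ θ ⟩
      1ℚ ∎
      where
      open ≡-Reasoning
      if-𝟙 : ∀ b p → (if b then p else 0ℚ) ≡ (if b then 1ℚ else 0ℚ) * p
      if-𝟙 true  p = sym (*-identityˡ p)
      if-𝟙 false p = sym (*-zeroˡ p)

mainTheorem3 : (k t : ℕ) → 2 ℕ.≤ t → (t≤k : t ℕ.≤ k) →
    (ε : ℝ) → fromℚ 0ℚ <ᴿ ε → ε <ᴿ fromℚ (ε-bound k t t≤k) →
    ∃[ v₀ ] ((v : ℕ) → v₀ ℕ.≤ v → (G : TGraph t v) → Dense G ε →
    (Σ[ x ∈ Vector ℚ (#edges G) ] ((∀ i → Positive (x i)) ×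
    (M̂ G k *ᵥ x) ≗ replicate (#edges G) (θ₀ k t v)))
    × FractionalDecomposition G (complete t k))
-- The strict inequality of cuts supplies the rational `q`. The bound v - k ≥ 3tk + t is what
-- `↓-ratio` asks for with d = k; its other use, with d ≤ t and v - t in place of v - k, is weaker.
mainTheorem3 k t 2≤t t≤k ε 0<ε (q , ε<q , q<bound) = k ℕ.* (3 ℕ.* t) ℕ.+ t ℕ.+ k , conclusion
  where
  conclusion : ∀ v → k ℕ.* (3 ℕ.* t) ℕ.+ t ℕ.+ k ℕ.≤ v → (G : TGraph t v) → Dense G ε → _
  conclusion v large G dense =
    ((λ i → x (edge G i)) , (λ i → positive (<-≤-trans 0<δ (δ≤x (edge G i) (uniform G (lookup-satisfies (Edge? G) i))))) , λ i →
      trans (M̂-row G k x i) (cliqueRow≡θ₀ (edge G i) (lookup-satisfies (Edge? G) i))) ,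
    decomposition G t≤k x 0<δ 0<θ₀ δ≤x cliqueRow≡θ₀
    where
    1≤t : 1 ℕ.≤ t
    1≤t = ℕ.≤-trans (ℕ.n≤1+n 1) 2≤t
    k≤v : k ℕ.≤ v
    k≤v = ℕ.≤-trans (ℕ.m≤n+m k (k ℕ.* (3 ℕ.* t) ℕ.+ t)) large
    0≤q : 0ℚ ≤ q
    0≤q = <⇒≤ (positive-upper {ε} 0<ε ε<q)
    sparse : ∀ S → #[ S ] ≡ t ∸ 1 → above t (λ U → 𝟙 (¬? (Edge? G U))) S ≤ q * fromℕ (suc (v ∸ t))
    sparse = dense⇒sparse G 1≤t (ℕ.≤-trans t≤k k≤v) {ε} ε<q dense
    open Perturbation 2≤t t≤k large G 0≤q sparse
    open Solution 2≤t t≤k large G 0≤q sparse (below-threshold t≤k q<bound)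
    x : Subset v → ℚ
    x = proj₁ positive-solution
    δ≤x : ∀ T → #[ T ] ≡ t → δ ≤ x T
    δ≤x = proj₂ (proj₂ positive-solution)
    Bc≡θ₀ : B * c ≡ θ₀ k t v
    Bc≡θ₀ = trans (cong (λ e → B * fromℕ e) (extensions≡C t≤k)) (sym (fromℕ-* (k C t) ((v ∸ t) C (k ∸ t))))
    0<θ₀ : 0ℚ < θ₀ k t v
    0<θ₀ = subst (0ℚ <_) (sym (fromℕ-* (k C t) ((v ∸ t) C (k ∸ t)))) (*-pos (C-pos t≤k) (C-pos (ℕ.∸-monoˡ-≤ t k≤v)))
    cliqueRow≡θ₀ : ∀ T → Edge G T → cliqueRow G k x T ≡ θ₀ k t v
    cliqueRow≡θ₀ T T∈G = begin
      cliqueRow G k x T   ≡⟨ above-cong {I = T} (λ K _ → cong (λ b → (if b then 𝟙 (inducesClique? G K) else 1ℚ) * below t x K) (dec-true (Edge? G T) T∈G)) ⟨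
      row x T             ≡⟨ proj₁ (proj₂ positive-solution) T (uniform G T∈G) ⟩
      B * c               ≡⟨ Bc≡θ₀ ⟩
      θ₀ k t v            ∎
      where open ≡-Reasoning
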